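{- Let $(G,\mathcal{B},\mathcal{L},\mathcal{F})$ be a quasi-biased graph such that neither $\mathcal{L}$ nor $\mathcal{F}$ is degenerate, and suppose $M=M(G,\mathcal{B},\mathcal{L},\mathcal{F})$ is simple and connected. If $M$ is not $3$-connected, then $M$ is not unbreakable.
   Context: Graphs are finite with loops and parallel edges allowed; cycles include loops and 2-cycles. A quasi-biased graph $(G,\mathcal{B},\mathcal{L},\mathcal{F})$ is a graph $G$ with a partition $(\mathcal{B},\mathcal{L},\mathcal{F})$ of its cycles such that no theta subgraph contains exactly two cycles of $\mathcal{B}$ and every cycle in $\mathcal{L}$ shares a vertex with every cycle in $\mathcal{F}$. $M(G,\mathcal{B},\mathcal{L},\mathcal{F})$ is the matroid on $E(G)$ whose circuits are: cycles in $\mathcal{B}$; theta subgraphs containing no cycle of $\mathcal{B}$; tight handcuffs (two edge-disjoint cycles sharing exactly one vertex) with neither cycle in $\mathcal{B}$; unions of two vertex-disjoint cycles of $\mathcal{L}$; loose handcuffs (two vertex-disjoint cycles plus a minimal path joining them) with both cycles in $\mathcal{F}$. $\mathcal{L}$ (resp. $\mathcal{F}$) is degenerate if it contains no two vertex-disjoint cycles. A matroid is unbreakable if it is connected and $M/F$ is connected for every flat $F$. -}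

module Defs where

open import Data.Nat using (ℕ; zero; suc; _+_; _≤_; _<_)
open import Data.Bool using (Bool; true; false; if_then_else_)
open import Data.Fin using (Fin; _≟_)
open import Data.Fin.Subset using (Subset; _∈_; _∉_; _⊆_; _∪_; _∩_; _─_; ∁; ⁅_⁆; ⊤; ∣_∣; Nonempty)
open import Data.Vec using (Vec; lookup; tabulate; sum)
open import Data.Product using (Σ; _×_; _,_; ∃; ∃-syntax)
open import Data.Sum using (_⊎_)
open import Data.Empty renaming (⊥ to False)
open import Relation.Nullary using (¬_; does)
open import Relation.Binary.PropositionalEquality using (_≡_; _≢_)

-- Graphs: finite, loops and parallel edges allowed.
-- Vertices are Fin n, edges are Fin m; each edge has two (unordered) ends;
-- a loop is an edge whose two ends coincide.
-- A subgraph without isolated vertices (cycles, thetas, handcuffs, paths)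
-- is represented by its edge set, a Subset m.

record Graph (n m : ℕ) : Set where
  field
    end₁ : Fin m → Fin n
    end₂ : Fin m → Fin n

module _ {n m : ℕ} (G : Graph n m) where
  open Graph G

  IsEnd : Fin n → Fin m → Set
  IsEnd v e = (end₁ e ≡ v) ⊎ (end₂ e ≡ v)

  OnV : Subset m → Fin n → Set
  OnV X v = ∃[ e ] (e ∈ X × IsEnd v e)

  VertexDisjoint : Subset m → Subset m → Set
  VertexDisjoint X Y = ∀ v → OnV X v → OnV Y v → False

  private
    ind : Bool → ℕ
    ind true = 1
    ind false = 0

  deg : Subset m → Fin n → ℕ
  deg X v = sum (tabulate λ e →
    if lookup X e then ind (does (end₁ e ≟ v)) + ind (does (end₂ e ≟ v)) else 0)

  ConnectedES : Subset m → Set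
  ConnectedES X = ∀ (A B : Subset m) → A ∪ B ≡ X → (∀ e → e ∈ A → e ∈ B → False) →
                  Nonempty A → Nonempty B → ∃[ v ] (OnV A v × OnV B v)

  Cycle : Subset m → Set
  Cycle C = Nonempty C × ConnectedES C × (∀ v → (deg C v ≡ 0) ⊎ (deg C v ≡ 2))

  PathBetween : Fin n → Fin n → Subset m → Set
  PathBetween u w P = u ≢ w × Nonempty P × ConnectedES P × deg P u ≡ 1 × deg P w ≡ 1 ×
    (∀ v → v ≢ u → v ≢ w → (deg P v ≡ 0) ⊎ (deg P v ≡ 2))

  -- theta subgraph: a 2-connected subgraph with exactly two vertices of degree 3
  -- and all other vertices of degree 2 (i.e. three internally disjoint paths
  -- between two distinct vertices); 2-connectivity is expressed as
  -- "connected and stays connected after deleting any one edge"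
  -- (equivalent for graphs of maximum degree 3).
  Theta : Subset m → Set
  Theta T = ConnectedES T × (∀ e → e ∈ T → ConnectedES (T ─ ⁅ e ⁆)) ×
    (∃[ u ] ∃[ w ] (u ≢ w × deg T u ≡ 3 × deg T w ≡ 3 ×
       (∀ v → v ≢ u → v ≢ w → (deg T v ≡ 0) ⊎ (deg T v ≡ 2))))

  ExactlyTwoCyclesIn : (Subset m → Bool) → Subset m → Set
  ExactlyTwoCyclesIn P T = ∃[ C₁ ] ∃[ C₂ ] (C₁ ≢ C₂ ×
    Cycle C₁ × C₁ ⊆ T × P C₁ ≡ true × Cycle C₂ × C₂ ⊆ T × P C₂ ≡ true ×
    (∀ C → Cycle C → C ⊆ T → P C ≡ true → (C ≡ C₁) ⊎ (C ≡ C₂)))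

  TightHandcuff : Subset m → Subset m → Subset m → Set
  TightHandcuff C₁ C₂ H = Cycle C₁ × Cycle C₂ × (∀ e → e ∈ C₁ → e ∈ C₂ → False) ×
    H ≡ C₁ ∪ C₂ × ∃[ u ] (OnV C₁ u × OnV C₂ u × (∀ v → OnV C₁ v → OnV C₂ v → v ≡ u))

  LooseHandcuff : Subset m → Subset m → Subset m → Set
  LooseHandcuff C₁ C₂ H = Cycle C₁ × Cycle C₂ × VertexDisjoint C₁ C₂ ×
    ∃[ P ] ∃[ u ] ∃[ w ] (PathBetween u w P × OnV C₁ u × OnV C₂ w ×
      (∀ v → OnV P v → OnV C₁ v → v ≡ u) × (∀ v → OnV P v → OnV C₂ v → v ≡ w) ×
      H ≡ (C₁ ∪ C₂) ∪ P)

  record QuasiBiased (B L F : Subset m → Bool) : Set where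
    field
      B-cycle : ∀ C → B C ≡ true → Cycle C
      L-cycle : ∀ C → L C ≡ true → Cycle C
      F-cycle : ∀ C → F C ≡ true → Cycle C
      covers : ∀ C → Cycle C → (B C ≡ true) ⊎ (L C ≡ true) ⊎ (F C ≡ true)
      BL-disj : ∀ C → B C ≡ true → L C ≡ true → False
      BF-disj : ∀ C → B C ≡ true → F C ≡ true → False
      LF-disj : ∀ C → L C ≡ true → F C ≡ true → False
      theta-B : ∀ T → Theta T → ¬ ExactlyTwoCyclesIn B T
      L-meets-F : ∀ C₁ C₂ → L C₁ ≡ true → F C₂ ≡ true → ∃[ v ] (OnV C₁ v × OnV C₂ v)

  NonDegenerate : (Subset m → Bool) → Set
  NonDegenerate P = ∃[ C₁ ] ∃[ C₂ ] (P C₁ ≡ true × P C₂ ≡ true × VertexDisjoint C₁ C₂)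

  FrameCircuit : (B L F : Subset m → Bool) → Subset m → Set
  FrameCircuit B L F X =
      (Cycle X × B X ≡ true)
    ⊎ (Theta X × (∀ C → Cycle C → C ⊆ X → B C ≡ false))
    ⊎ (∃[ C₁ ] ∃[ C₂ ] (TightHandcuff C₁ C₂ X × B C₁ ≡ false × B C₂ ≡ false))
    ⊎ (∃[ C₁ ] ∃[ C₂ ] (L C₁ ≡ true × L C₂ ≡ true × Cycle C₁ × Cycle C₂ ×
                         VertexDisjoint C₁ C₂ × X ≡ C₁ ∪ C₂))
    ⊎ (∃[ C₁ ] ∃[ C₂ ] (LooseHandcuff C₁ C₂ X × F C₁ ≡ true × F C₂ ≡ true))

-- Matroids on ground set Fin m, given by their circuits.

module _ {m : ℕ} (Circ : Subset m → Set) where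

  Indep : Subset m → Set
  Indep I = ∀ C → Circ C → C ⊆ I → False

  IsRank : Subset m → ℕ → Set
  IsRank X k = (∃[ I ] (I ⊆ X × Indep I × ∣ I ∣ ≡ k)) ×
               (∀ J → J ⊆ X → Indep J → ∣ J ∣ ≤ k)

  Simple : Set
  Simple = ∀ C → Circ C → ¬ (∣ C ∣ ≡ 1) × ¬ (∣ C ∣ ≡ 2)

  Connected : Set
  Connected = ∀ e f → e ≢ f → ∃[ C ] (Circ C × e ∈ C × f ∈ C)

  Separation : ℕ → Set
  Separation k = ∃[ X ] (k ≤ ∣ X ∣ × k ≤ ∣ ∁ X ∣ ×
    ∃[ rX ] ∃[ rY ] ∃[ rE ] (IsRank X rX × IsRank (∁ X) rY × IsRank ⊤ rE ×
      rX + rY < rE + k))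

  ThreeConnected : Set
  ThreeConnected = ∀ k → 1 ≤ k → k < 3 → ¬ Separation k

  Flat : Subset m → Set
  Flat F = ∀ e → e ∉ F → ∀ r₁ r₂ → IsRank F r₁ → IsRank (F ∪ ⁅ e ⁆) r₂ → r₁ < r₂

  ContractCircuit : Subset m → Subset m → Set
  ContractCircuit F D = Nonempty D × (∃[ C ] (Circ C × D ≡ C ─ F)) ×
    (∀ C' → Circ C' → Nonempty (C' ─ F) → C' ─ F ⊆ D → C' ─ F ≡ D)

  ContractionConnected : Subset m → Set
  ContractionConnected F = ∀ e f → e ∉ F → f ∉ F → e ≢ f →
    ∃[ D ] (ContractCircuit F D × e ∈ D × f ∈ D)

  Unbreakable : Set
  Unbreakable = Connected × (∀ F → Flat F → ContractionConnected F)

{-# OPTIONS --safe #-}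
module Submission where

-- Let Z be a cycle in L. Since every cycle in F meets Z, the matroid M / Z is the cycle matroid of G / V(Z).
-- Suppose that M is unbreakable and has a separation (X , Y) of order at most two. Then r(X) + r(Y) ≤ r(M) + 1,
-- and the same bound holds for the graphic ranks in G / V(Z). If neither X nor Y connects G / V(Z), then the
-- union of a spanning forest of X and one of Y has no leaf u: contracting all edges that cross neither {u} nor the
-- X-component of u would disconnect M. By the rank bound all degrees in that union are then 2, for every choice of
-- the forests, so every vertex of G / V(Z) has at most two neighbours. With a second cycle of L disjoint from Z and
-- two disjoint cycles of F this forces G / V(Z) to be a triangle with parallel edges, and X or Y connects it after
-- all. So, for each of two disjoint cycles Z₁, Z₂ of L, one of X, Y connects the quotient and the other side is a
-- single parallel class there. Comparing ranks leaves one case: Y = {y₁, y₂} with yᵢ on Zᵢ, and X is connected,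
-- spanning and balanced. Then let Φ be the set of edges of X that do not cross the cut of some edge x of a spanning
-- tree of X containing Z₁ - y₁ and Z₂ - y₂: this is a flat, and no circuit of M / Φ contains both y₂ and x.

open import Defs
open import Data.Nat using (ℕ; zero; suc; _+_; _*_; _≤_; _<_; z≤n; s≤s; s≤s⁻¹; _≤?_; _<?_) renaming (_≟_ to _≟ℕ_)
open import Data.Nat.Properties hiding (_≟_)
open import Algebra.Properties.CommutativeSemigroup +-commutativeSemigroup using (interchange)
open import Data.Nat.Induction using (<-wellFounded)
open import Induction.WellFounded using (Acc; acc)
open import Data.Bool using (Bool; true; false; if_then_else_; not; _∧_; _xor_)
import Data.Bool.Properties as Boolₚ
open import Data.Fin using (Fin; zero; suc; _≟_)
open import Data.Fin.Properties using (any?; all?)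
open import Data.Fin.Subset using (Subset; _∈_; _∉_; _⊆_; _⊂_; _∪_; _∩_; _─_; ∁; ⁅_⁆; ⊤; ∣_∣; Nonempty)
open import Data.Fin.Subset.Properties
open import Data.Vec using ([]; _∷_; lookup; tabulate; sum)
open import Data.Vec.Properties using ([]=⇒lookup; lookup⇒[]=; lookup∘tabulate)
open import Data.Product using (Σ; _×_; _,_; ∃-syntax; proj₁; proj₂)
open import Data.Sum using (_⊎_; inj₁; inj₂; [_,_]′)
open import Data.Empty using (⊥-elim) renaming (⊥ to False)
open import Function using (_∘_; id; case_of_)
open import Relation.Nullary using (¬_; Dec; yes; no; does; contradiction)
open import Relation.Nullary.Decidable using (¬?; _×-dec_; _⊎-dec_; _→-dec_; map′; decidable-stable; dec-true; dec-false)
open import Relation.Binary.PropositionalEquality using (_≡_; _≢_; refl; sym; trans; cong; cong₂; subst; subst₂; module ≡-Reasoning)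

-- Sums over Fin k

-- No walk is ever built. Connectivity is treated dually, by two-colourings of the vertices that no
-- edge crosses, and cycles and circuits are found by counting edges against vertices. Ranks are not
-- computed either: a lower bound is an independent set, an upper bound is a bound on all
-- independent sets. What shapes the proof is that a circuit may cross a cut exactly once, namely on
-- the path of a loose handcuff, so cuts need not give flats. If the cut does not split a cycle `Z`
-- of L, this cannot happen: both cycles of the handcuff are in F, hence meet `Z`, hence lie on the
-- same side, and the other side violates parity. This is why flats are built over a contracted
-- cycle of L. The last flat contains no such cycle; there the balance of X takes over, because a
-- loose handcuff needs two unbalanced cycles. A circuit of a contraction is a minimal nonempty
-- trace of a circuit. So to keep two elements apart it is enough to find, for each circuit through
-- both, another circuit with a smaller nonempty trace.

∑ : ∀ {k} → (Fin k → ℕ) → ℕ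
∑ f = sum (tabulate f)

∑-cong : ∀ {k} {f g : Fin k → ℕ} → (∀ i → f i ≡ g i) → ∑ f ≡ ∑ g
∑-cong {zero}  h = refl
∑-cong {suc k} h = cong₂ _+_ (h zero) (∑-cong (h ∘ suc))

∑-mono : ∀ {k} {f g : Fin k → ℕ} → (∀ i → f i ≤ g i) → ∑ f ≤ ∑ g
∑-mono {zero}  h = z≤n
∑-mono {suc k} h = +-mono-≤ (h zero) (∑-mono (h ∘ suc))

∑-zero : ∀ k → ∑ {k} (λ _ → 0) ≡ 0
∑-zero zero    = refl
∑-zero (suc k) = ∑-zero k

∑-+ : ∀ {k} (f g : Fin k → ℕ) → ∑ (λ i → f i + g i) ≡ ∑ f + ∑ g
∑-+ {zero}  f g = refl
∑-+ {suc k} f g =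
  trans (cong (f zero + g zero +_) (∑-+ (f ∘ suc) (g ∘ suc)))
        (interchange (f zero) (g zero) (∑ (f ∘ suc)) (∑ (g ∘ suc)))

∑-swap : ∀ {k l} (f : Fin k → Fin l → ℕ) → ∑ (λ i → ∑ (f i)) ≡ ∑ (λ j → ∑ (λ i → f i j))
∑-swap {zero}  {l} f = sym (∑-zero l)
∑-swap {suc k} f =
  trans (cong (∑ (f zero) +_) (∑-swap (f ∘ suc)))
        (sym (∑-+ (f zero) (λ j → ∑ (λ i → f (suc i) j))))

∑-≤-tight : ∀ {k} {f g : Fin k → ℕ} → (∀ i → g i ≤ f i) → ∑ f ≤ ∑ g → ∀ i → f i ≡ g i
∑-≤-tight {suc k} {f} {g} h le zero =
  ≤-antisym (+-cancelʳ-≤ (∑ (f ∘ suc)) _ _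
    (≤-trans le (+-monoʳ-≤ (g zero) (∑-mono (h ∘ suc))))) (h zero)
∑-≤-tight {suc k} {f} {g} h le (suc i) =
  ∑-≤-tight (h ∘ suc) (+-cancelˡ-≤ (f zero) _ _
    (≤-trans le (+-monoˡ-≤ (∑ (g ∘ suc)) (h zero)))) i

∑-excess : ∀ {k} {f g : Fin k → ℕ} → (∀ i → g i ≤ f i) → ∑ g < ∑ f → ∃[ i ] (g i < f i)
∑-excess {f = f} {g} h lt with any? (λ i → g i <? f i)
... | yes p = p
... | no ¬p = ⊥-elim (<⇒≱ lt (∑-mono (λ i → ≮⇒≥ (λ q → ¬p (i , q)))))

δ : ∀ {k} → Fin k → Fin k → ℕ
δ p v = if does (p ≟ v) then 1 else 0

δ-refl : ∀ {k} (p : Fin k) → δ p p ≡ 1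
δ-refl p rewrite dec-true (p ≟ p) refl = refl

δ-≢ : ∀ {k} {p v : Fin k} → p ≢ v → δ p v ≡ 0
δ-≢ {p = p} {v} p≢v rewrite dec-false (p ≟ v) p≢v = refl

∑-single : ∀ {k} (f : Fin k → ℕ) i → (∀ j → j ≢ i → f j ≡ 0) → ∑ f ≡ f i
∑-single {suc k} f zero    h =
  trans (cong (f zero +_) (trans (∑-cong (λ j → h (suc j) λ ())) (∑-zero k))) (+-identityʳ _)
∑-single {suc k} f (suc i) h =
  trans (cong (_+ ∑ (f ∘ suc)) (h zero λ ())) (∑-single (f ∘ suc) i (λ j ne → h (suc j) (λ { refl → ne refl })))

term≤∑ : ∀ {k} (f : Fin k → ℕ) i → f i ≤ ∑ f
term≤∑ {suc k} f zero    = m≤m+n _ _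
term≤∑ {suc k} f (suc i) = ≤-trans (term≤∑ (f ∘ suc) i) (m≤n+m _ _)

∑-δ : ∀ {k} (g : Fin k → ℕ) p → ∑ (λ v → g v * δ p v) ≡ g p
∑-δ g p = trans (∑-single _ p (λ v v≢p → trans (cong (g v *_) (δ-≢ (v≢p ∘ sym))) (*-zeroʳ (g v))))
                (trans (cong (g p *_) (δ-refl p)) (*-identityʳ (g p)))

∑-δ₁ : ∀ {k} (p : Fin k) → ∑ (δ p) ≡ 1
∑-δ₁ p = trans (∑-single (δ p) p (λ j ne → δ-≢ {p = p} {j} (ne ∘ sym))) (δ-refl p)

module _ {k} {f g : Fin k → ℕ} (h : ∀ i → g i ≤ f i) {i : Fin k} (lt : g i < f i) where

  bump : Fin k → ℕ
  bump j = g j + δ i j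

  bump-at : bump i ≡ suc (g i)
  bump-at = trans (cong (g i +_) (δ-refl i)) (+-comm (g i) 1)

  bump-off : ∀ j → j ≢ i → bump j ≡ g j
  bump-off j ne = trans (cong (g j +_) (δ-≢ {p = i} {j} (ne ∘ sym))) (+-identityʳ _)

  bump-≤ : ∀ j → bump j ≤ f j
  bump-≤ j with j ≟ i
  ... | yes refl = subst (_≤ f i) (sym bump-at) lt
  ... | no ne = subst (_≤ f j) (sym (bump-off j ne)) (h j)

  ∑-bump : ∑ bump ≡ suc (∑ g)
  ∑-bump = trans (∑-+ g (δ i)) (trans (cong (∑ g +_) (∑-δ₁ i)) (+-comm (∑ g) 1))

∑-excess₁ : ∀ {k} {f g : Fin k → ℕ} → (∀ i → g i ≤ f i) → ∑ f ≡ suc (∑ g) →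
            ∃[ i ] (f i ≡ suc (g i) × (∀ j → j ≢ i → f j ≡ g j))
∑-excess₁ h eq with ∑-excess h (≤-reflexive (sym eq))
... | i , lt = i , trans (tight i) (bump-at h lt) , λ j ne → trans (tight j) (bump-off h lt j ne)
  where
  tight = ∑-≤-tight (bump-≤ h lt) (≤-reflexive (trans eq (sym (∑-bump h lt))))

-- For degrees this is the dichotomy between one vertex of degree 4 (tight handcuffs) and two of
-- degree 3 (thetas and loose handcuffs).
∑-excess₂ : ∀ {k} {f g : Fin k → ℕ} → (∀ i → g i ≤ f i) → ∑ f ≡ 2 + ∑ g →
  (∃[ i ] (f i ≡ 2 + g i × (∀ j → j ≢ i → f j ≡ g j))) ⊎
  (∃[ i ] ∃[ j ] (i ≢ j × f i ≡ suc (g i) × f j ≡ suc (g j) × (∀ l → l ≢ i → l ≢ j → f l ≡ g l)))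
∑-excess₂ h eq with ∑-excess h (≤-trans (n≤1+n _) (≤-reflexive (sym eq)))
... | i , lt with ∑-excess₁ (bump-≤ h lt) (trans eq (cong suc (sym (∑-bump h lt))))
...   | j , fj , rest with j ≟ i
...     | yes refl = inj₁ (i , trans fj (cong suc (bump-at h lt)) , λ l ne → trans (rest l ne) (bump-off h lt l ne))
...     | no j≢i = inj₂ (i , j , j≢i ∘ sym , trans (rest i (j≢i ∘ sym)) (bump-at h lt) ,
                      trans fj (cong suc (bump-off h lt j j≢i)) , λ l ne ne' → trans (rest l ne') (bump-off h lt l ne))

-- Parity of sums

parity : ℕ → Bool
parity zero    = false
parity (suc n) = not (parity n)

parity-+ : ∀ a b → parity (a + b) ≡ parity a xor parity b
parity-+ zero    b = refl
parity-+ (suc a) b = trans (cong not (parity-+ a b)) (lem (parity a) (parity b))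
  where
  lem : ∀ x y → not (x xor y) ≡ not x xor y
  lem true  y = Boolₚ.not-involutive y
  lem false y = refl

parity-even-∑ : ∀ {k} {f : Fin k → ℕ} → (∀ i → parity (f i) ≡ false) → parity (∑ f) ≡ false
parity-even-∑ {zero}  h = refl
parity-even-∑ {suc k} {f} h = trans (parity-+ (f zero) _) (cong₂ _xor_ (h zero) (parity-even-∑ (h ∘ suc)))

parity-odd-∑ : ∀ {k} {f : Fin k → ℕ} i → parity (f i) ≡ true → (∀ j → j ≢ i → parity (f j) ≡ false) →
               parity (∑ f) ≡ true
parity-odd-∑ {suc k} {f} zero hi h =
  trans (parity-+ (f zero) _) (cong₂ _xor_ hi (parity-even-∑ (λ j → h (suc j) λ ())))
parity-odd-∑ {suc k} {f} (suc i) hi h =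
  trans (parity-+ (f zero) _)
    (cong₂ _xor_ (h zero λ ()) (parity-odd-∑ i hi (λ j ne → h (suc j) (λ { refl → ne refl }))))

-- Subsets

χ : ∀ {k} → Subset k → Fin k → ℕ
χ S e = if lookup S e then 1 else 0

∈⇒lookup : ∀ {k} {S : Subset k} {e} → e ∈ S → lookup S e ≡ true
∈⇒lookup = []=⇒lookup

lookup⇒∈ : ∀ {k} {S : Subset k} {e} → lookup S e ≡ true → e ∈ S
lookup⇒∈ = lookup⇒[]= _ _

∉⇒lookup : ∀ {k} {S : Subset k} {e} → e ∉ S → lookup S e ≡ false
∉⇒lookup {S = S} {e} ne with lookup S e in eq
... | true  = ⊥-elim (ne (lookup⇒∈ eq))
... | false = refl

χ-∈ : ∀ {k} {S : Subset k} {e} → e ∈ S → χ S e ≡ 1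
χ-∈ p rewrite ∈⇒lookup p = refl

χ-∉ : ∀ {k} {S : Subset k} {e} → e ∉ S → χ S e ≡ 0
χ-∉ p rewrite ∉⇒lookup p = refl

card : ∀ {k} (S : Subset k) → ∣ S ∣ ≡ ∑ (χ S)
card []          = refl
card (true ∷ S)  = cong suc (card S)
card (false ∷ S) = card S

Disjoint : ∀ {k} → Subset k → Subset k → Set
Disjoint A B = ∀ e → e ∈ A → e ∈ B → False

card-⊎ : ∀ {k} {S A B : Subset k} → (∀ {e} → e ∈ S → e ∈ A ⊎ e ∈ B) → A ⊆ S → B ⊆ S → Disjoint A B →
         ∣ S ∣ ≡ ∣ A ∣ + ∣ B ∣
card-⊎ {S = S} {A} {B} cov A⊆S B⊆S dis = trans (card S) (trans (∑-cong pt)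
  (trans (∑-+ (χ A) (χ B)) (sym (cong₂ _+_ (card A) (card B)))))
  where
  pt : ∀ e → χ S e ≡ χ A e + χ B e
  pt e with e ∈? A | e ∈? B
  ... | yes a | yes b = ⊥-elim (dis e a b)
  ... | yes a | no b = trans (χ-∈ (A⊆S a)) (sym (cong₂ _+_ (χ-∈ a) (χ-∉ b)))
  ... | no a | yes b = trans (χ-∈ (B⊆S b)) (sym (cong₂ _+_ (χ-∉ a) (χ-∈ b)))
  ... | no a | no b = trans (χ-∉ (λ s → [ a , b ]′ (cov s))) (sym (cong₂ _+_ (χ-∉ a) (χ-∉ b)))

∪ˡ : ∀ {k} {A B : Subset k} {e} → e ∈ A → e ∈ A ∪ B
∪ˡ p = x∈p∪q⁺ (inj₁ p)

∪ʳ : ∀ {k} {A B : Subset k} {e} → e ∈ B → e ∈ A ∪ B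
∪ʳ p = x∈p∪q⁺ (inj₂ p)

∪⁻ : ∀ {k} {A B : Subset k} {e} → e ∈ A ∪ B → e ∈ A ⊎ e ∈ B
∪⁻ = x∈p∪q⁻ _ _

∪-lub : ∀ {k} {A B S : Subset k} → A ⊆ S → B ⊆ S → A ∪ B ⊆ S
∪-lub a b p = [ a , b ]′ (∪⁻ p)

─⁺ : ∀ {k} {A B : Subset k} {e} → e ∈ A → e ∉ B → e ∈ A ─ B
─⁺ = x∈p∧x∉q⇒x∈p─q

─⁻ˡ : ∀ {k} {A B : Subset k} → A ─ B ⊆ A
─⁻ˡ = p─q⊆p _ _

─⁻ʳ : ∀ {k} {A B : Subset k} {e} → e ∈ A ─ B → e ∉ B
─⁻ʳ {A = a ∷ A} {true ∷ B}  {zero} () Data.Vec.here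
─⁻ʳ {A = a ∷ A} {b ∷ B} {suc e} (Data.Vec.there p) (Data.Vec.there q) = ─⁻ʳ p q

⁅⁆⁻ : ∀ {k} {e f : Fin k} → e ∈ ⁅ f ⁆ → e ≡ f
⁅⁆⁻ = x∈⁅y⁆⇒x≡y _

⁅⁆⊆ : ∀ {k} {e : Fin k} {S : Subset k} → e ∈ S → ⁅ e ⁆ ⊆ S
⁅⁆⊆ {S = S} p q = subst (_∈ S) (sym (⁅⁆⁻ q)) p

─-≢ : ∀ {k} {A : Subset k} {e f} → e ∈ A → e ≢ f → e ∈ A ─ ⁅ f ⁆
─-≢ p ne = ─⁺ p (ne ∘ ⁅⁆⁻)

─-∌ : ∀ {k} {A : Subset k} {e} → e ∉ A ─ ⁅ e ⁆
─-∌ p = ─⁻ʳ p (x∈⁅x⁆ _)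

split-─ : ∀ {k} {S A : Subset k} {e} → e ∈ S → e ∈ A ⊎ e ∈ S ─ A
split-─ {A = A} {e} p with e ∈? A
... | yes q = inj₁ q
... | no q = inj₂ (─⁺ p q)

card-─ : ∀ {k} {S : Subset k} {e} → e ∈ S → ∣ S ∣ ≡ suc ∣ S ─ ⁅ e ⁆ ∣
card-─ {S = S} {e} p = trans (card-⊎ {A = ⁅ e ⁆} {S ─ ⁅ e ⁆} split-─ (⁅⁆⊆ p) ─⁻ˡ (λ f a b → ─⁻ʳ b a))
                         (cong (_+ ∣ S ─ ⁅ e ⁆ ∣) (∣⁅x⁆∣≡1 e))

card-∪ : ∀ {k} {A B : Subset k} → Disjoint A B → ∣ A ∪ B ∣ ≡ ∣ A ∣ + ∣ B ∣
card-∪ dis = card-⊎ ∪⁻ ∪ˡ ∪ʳ dis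

card-+1 : ∀ {k} {S : Subset k} {e} → e ∉ S → ∣ S ∪ ⁅ e ⁆ ∣ ≡ suc ∣ S ∣
card-+1 {S = S} {e} ne = trans (card-∪ (λ f p q → ne (subst (_∈ S) (⁅⁆⁻ q) p)))
  (trans (cong (∣ S ∣ +_) (∣⁅x⁆∣≡1 e)) (+-comm _ 1))

nonempty⇒card : ∀ {k} {S : Subset k} → Nonempty S → 0 < ∣ S ∣
nonempty⇒card (e , p) = subst (0 <_) (sym (card-─ p)) (s≤s z≤n)

card⇒nonempty : ∀ {k} {S : Subset k} → 0 < ∣ S ∣ → Nonempty S
card⇒nonempty {k} {S} lt with nonempty? S
... | yes p = p
... | no np = ⊥-elim (<-irrefl refl (subst (0 <_) (trans (cong ∣_∣ (Empty-unique np)) (∣⊥∣≡0 k)) lt))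

⟪_⟫ : ∀ {k} → (Fin k → Bool) → Subset k
⟪ f ⟫ = tabulate f

⟪⟫⁺ : ∀ {k} {f : Fin k → Bool} {e} → f e ≡ true → e ∈ ⟪ f ⟫
⟪⟫⁺ {f = f} {e} p = lookup⇒∈ (trans (lookup∘tabulate f e) p)

⟪⟫⁻ : ∀ {k} {f : Fin k → Bool} {e} → e ∈ ⟪ f ⟫ → f e ≡ true
⟪⟫⁻ {f = f} {e} p = trans (sym (lookup∘tabulate f e)) (∈⇒lookup p)

abstract
  allSubset? : ∀ {k} {P : Subset k → Set} → (∀ S → Dec (P S)) → Dec (∀ S → P S)
  allSubset? P? with anySubset? (λ S → ¬? (P? S))
  ... | yes (S , np) = no (λ h → np (h S))
  ... | no none = yes (λ S → decidable-stable (P? S) (λ np → none (S , np)))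

abstract
  minimal : ∀ {k} {P : Subset k → Set} → (∀ S → Dec (P S)) → ∀ S → P S →
            ∃[ S' ] (S' ⊆ S × P S' × (∀ R → R ⊆ S' → P R → S' ⊆ R))
  minimal {k} {P} P? S p = go S p (<-wellFounded _)
    where
    go : ∀ S → P S → Acc _<_ ∣ S ∣ → ∃[ S' ] (S' ⊆ S × P S' × (∀ R → R ⊆ S' → P R → S' ⊆ R))
    go S p (acc rs) with anySubset? (λ R → (R ⊂? S) ×-dec P? R)
    ... | yes (R , R⊂S , pR) with go R pR (rs (p⊂q⇒∣p∣<∣q∣ R⊂S))
    ...   | S' , S'⊆R , pS' , mn = S' , proj₁ R⊂S ∘ S'⊆R , pS' , mn
    go S p (acc rs) | no none = S , id , p , mn
      where
      mn : ∀ R → R ⊆ S → P R → S ⊆ R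
      mn R R⊆S pR {e} e∈S with e ∈? R
      ... | yes e∈R = e∈R
      ... | no e∉R = ⊥-elim (none (R , (R⊆S , e , e∈S , e∉R) , pR))

abstract
  -- Maximality is tested against single added elements only. For spanning forests this suffices,
  -- because `Spanning` is checked edge by edge.
  maximal : ∀ {k} {P : Subset k → Set} → (∀ S → Dec (P S)) → ∀ X S → S ⊆ X → P S →
            ∃[ T ] (S ⊆ T × T ⊆ X × P T × (∀ e → e ∈ X → e ∉ T → ¬ P (T ∪ ⁅ e ⁆)))
  maximal {k} {P} P? X S S⊆X p = go S S⊆X p (<-wellFounded _)
    where
    go : ∀ S → S ⊆ X → P S → Acc _<_ ∣ ∁ S ∣ →
         ∃[ T ] (S ⊆ T × T ⊆ X × P T × (∀ e → e ∈ X → e ∉ T → ¬ P (T ∪ ⁅ e ⁆)))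
    go S S⊆X p (acc rs) with any? (λ e → (e ∈? X) ×-dec ¬? (e ∈? S) ×-dec P? (S ∪ ⁅ e ⁆))
    ... | no none = S , id , S⊆X , p , λ e x ne q → none (e , x , ne , q)
    ... | yes (e , x , ne , q) with go (S ∪ ⁅ e ⁆) (∪-lub S⊆X (⁅⁆⊆ x)) q (rs (p⊂q⇒∣p∣<∣q∣ sm))
      where
      sm : ∁ (S ∪ ⁅ e ⁆) ⊂ ∁ S
      sm = (λ f∈ → x∉p⇒x∈∁p (λ f∈S → x∈∁p⇒x∉p f∈ (∪ˡ f∈S))) ,
           e , x∉p⇒x∈∁p ne , λ e∈ → x∈∁p⇒x∉p e∈ (∪ʳ (x∈⁅x⁆ e))
    ...   | T , S⊆T , rest = T , S⊆T ∘ ∪ˡ , rest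

open Graph

-- Degrees and cuts

one : Bool → ℕ
one b = if b then 1 else 0

term : ∀ {n m} → Graph n m → Subset m → Fin n → Fin m → ℕ
term G S v e = if lookup S e then δ (end₁ G e) v + δ (end₂ G e) v else 0

-- The summand of deg mentions a private function, so it is named by unification.
deg-summand : ∀ {n m} (G : Graph n m) S v → Σ (Fin m → ℕ) λ f → deg G S v ≡ ∑ f
deg-summand G S v = _ , refl

summand≡term : ∀ {n m} (G : Graph n m) S v e → proj₁ (deg-summand G S v) e ≡ term G S v e
summand≡term G S v e with lookup S e | does (end₁ G e ≟ v) | does (end₂ G e ≟ v)
... | true  | true  | true  = refl
... | true  | true  | false = refl
... | true  | false | true  = refl
... | true  | false | false = refl
... | false | _     | _     = refl

deg-∑ : ∀ {n m} (G : Graph n m) S v → deg G S v ≡ ∑ (term G S v)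
deg-∑ G S v = ∑-cong (summand≡term G S v)

∑-two : ∀ {k} (f : Fin k → ℕ) {i j} → i ≢ j → f i + f j ≤ ∑ f
∑-two f {zero}  {zero}  ne = ⊥-elim (ne refl)
∑-two f {zero}  {suc j} ne = +-monoʳ-≤ (f zero) (term≤∑ (f ∘ suc) j)
∑-two f {suc i} {zero}  ne = subst (_≤ ∑ f) (+-comm (f zero) _) (+-monoʳ-≤ (f zero) (term≤∑ (f ∘ suc) i))
∑-two f {suc i} {suc j} ne = ≤-trans (∑-two (f ∘ suc) (ne ∘ cong suc)) (m≤n+m _ (f zero))

∑-strict : ∀ {k} {f g : Fin k → ℕ} i → (∀ j → f j ≤ g j) → f i < g i → ∑ f < ∑ g
∑-strict {f = f} {g} i h lt = ≰⇒> λ le → <-irrefl (sym (∑-≤-tight h le i)) lt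

sgn : ℕ → ℕ
sgn zero    = 0
sgn (suc _) = 1

sgn-mono : ∀ {a b} → a ≤ b → sgn a ≤ sgn b
sgn-mono z≤n     = z≤n
sgn-mono (s≤s _) = s≤s z≤n

sgn-pos : ∀ {a} → 0 < a → sgn a ≡ 1
sgn-pos (s≤s _) = refl

-- A two-colouring of the vertices. Quantifying over the cuts that a set does not cross replaces all
-- talk of paths and components.
Cut : ℕ → Set
Cut n = Fin n → Bool

module _ {n m : ℕ} (G : Graph n m) where

  isEnd? : ∀ v e → Dec (IsEnd G v e)
  isEnd? v e = (end₁ G e ≟ v) ⊎-dec (end₂ G e ≟ v)

  term-∈ : ∀ {S v e} → e ∈ S → term G S v e ≡ δ (end₁ G e) v + δ (end₂ G e) v
  term-∈ p rewrite ∈⇒lookup p = refl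

  term-∉ : ∀ {S v e} → e ∉ S → term G S v e ≡ 0
  term-∉ p rewrite ∉⇒lookup p = refl

  term-untouched : ∀ {S v e} → ¬ IsEnd G v e → term G S v e ≡ 0
  term-untouched {S} {v} {e} ne with e ∈? S
  ... | yes p = trans (term-∈ p) (cong₂ _+_ (δ-≢ (ne ∘ inj₁)) (δ-≢ (ne ∘ inj₂)))
  ... | no p = term-∉ p

  term-pos : ∀ {S v e} → e ∈ S → IsEnd G v e → 1 ≤ term G S v e
  term-pos {S} {v} {e} p t = subst (1 ≤_) (sym (term-∈ p)) (go t)
    where
    go : IsEnd G v e → 1 ≤ δ (end₁ G e) v + δ (end₂ G e) v
    go (inj₁ refl) = ≤-trans (≤-reflexive (sym (δ-refl (end₁ G e)))) (m≤m+n _ _)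
    go (inj₂ refl) = ≤-trans (≤-reflexive (sym (δ-refl (end₂ G e)))) (m≤n+m _ _)

  OnV-pos : ∀ {S v} → OnV G S v → 0 < deg G S v
  OnV-pos {S} {v} (e , p , t) =
    subst (0 <_) (sym (deg-∑ G S v)) (≤-trans (term-pos p t) (term≤∑ (term G S v) e))

  pos-OnV : ∀ {S v} → 0 < deg G S v → OnV G S v
  pos-OnV {S} {v} lt with any? (λ e → (e ∈? S) ×-dec isEnd? v e)
  ... | yes p = p
  ... | no none = ⊥-elim (<-irrefl (sym d0) lt)
    where
    t0 : ∀ e → term G S v e ≡ 0
    t0 e with e ∈? S
    ... | yes p = term-untouched {S} (λ t → none (e , p , t))
    ... | no p = term-∉ p
    d0 : deg G S v ≡ 0
    d0 = trans (deg-∑ G S v) (trans (∑-cong t0) (∑-zero m))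

  onV? : ∀ S v → Dec (OnV G S v)
  onV? S v = any? (λ e → (e ∈? S) ×-dec isEnd? v e)

  ¬OnV-zero : ∀ {S v} → ¬ OnV G S v → deg G S v ≡ 0
  ¬OnV-zero ¬p = n≤0⇒n≡0 (≮⇒≥ (¬p ∘ pos-OnV))

  OnV-mono : ∀ {S S' v} → S ⊆ S' → OnV G S v → OnV G S' v
  OnV-mono sub (e , p , t) = e , sub p , t

  term-mono : ∀ {S S' v} → S ⊆ S' → ∀ e → term G S v e ≤ term G S' v e
  term-mono {S} {S'} {v} sub e with e ∈? S
  ... | yes p = ≤-reflexive (trans (term-∈ p) (sym (term-∈ (sub p))))
  ... | no p = subst (_≤ term G S' v e) (sym (term-∉ p)) z≤n

  deg-mono : ∀ S S' → S ⊆ S' → ∀ v → deg G S v ≤ deg G S' v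
  deg-mono S S' sub v = subst₂ _≤_ (sym (deg-∑ G S v)) (sym (deg-∑ G S' v)) (∑-mono (term-mono sub))

  deg-⊎ : ∀ {S A B : Subset m} → (∀ {e} → e ∈ S → e ∈ A ⊎ e ∈ B) → A ⊆ S → B ⊆ S → Disjoint A B →
          ∀ v → deg G S v ≡ deg G A v + deg G B v
  deg-⊎ {S} {A} {B} cov A⊆S B⊆S dis v = trans (deg-∑ G S v) (trans (∑-cong pt)
    (trans (∑-+ (term G A v) (term G B v)) (sym (cong₂ _+_ (deg-∑ G A v) (deg-∑ G B v)))))
    where
    pt : ∀ e → term G S v e ≡ term G A v e + term G B v e
    pt e with e ∈? A | e ∈? B
    ... | yes a | yes b = ⊥-elim (dis e a b)
    ... | yes a | no b = trans (term-∈ (A⊆S a)) (sym (trans (cong₂ _+_ (term-∈ a) (term-∉ b)) (+-identityʳ _)))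
    ... | no a | yes b = trans (term-∈ (B⊆S b)) (sym (cong₂ _+_ (term-∉ a) (term-∈ b)))
    ... | no a | no b = trans (term-∉ (λ s → [ a , b ]′ (cov s))) (sym (cong₂ _+_ (term-∉ a) (term-∉ b)))

  deg-─ : ∀ {S A : Subset m} → A ⊆ S → ∀ v → deg G S v ≡ deg G A v + deg G (S ─ A) v
  deg-─ sub = deg-⊎ split-─ sub ─⁻ˡ (λ e a b → ─⁻ʳ b a)

  ends : Cut n → Fin m → ℕ
  ends c e = one (c (end₁ G e)) + one (c (end₂ G e))

  -- Weighted by a cut, the degree sum counts the edge ends on the true side; an edge contributes an
  -- odd number exactly when it crosses. The constant cut gives the usual formula.
  handshake : ∀ S c → ∑ (λ v → one (c v) * deg G S v) ≡ ∑ (λ e → if lookup S e then ends c e else 0)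
  handshake S c = begin
    ∑ (λ v → one (c v) * deg G S v)                ≡⟨ ∑-cong (λ v → cong (one (c v) *_) (deg-∑ G S v)) ⟩
    ∑ (λ v → one (c v) * ∑ (term G S v))           ≡⟨ ∑-cong (λ v → ∑-* (one (c v)) (term G S v)) ⟩
    ∑ (λ v → ∑ (λ e → one (c v) * term G S v e))   ≡⟨ ∑-swap (λ v e → one (c v) * term G S v e) ⟩
    ∑ (λ e → ∑ (λ v → one (c v) * term G S v e))   ≡⟨ ∑-cong inner ⟩
    ∑ (λ e → if lookup S e then ends c e else 0)   ∎
    where
    open ≡-Reasoning
    ∑-* : ∀ {k} a (f : Fin k → ℕ) → a * ∑ f ≡ ∑ (λ i → a * f i)
    ∑-* {zero}  a f = *-zeroʳ a
    ∑-* {suc k} a f = trans (*-distribˡ-+ a (f zero) _) (cong (a * f zero +_) (∑-* a (f ∘ suc)))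
    inner : ∀ e → ∑ (λ v → one (c v) * term G S v e) ≡ (if lookup S e then ends c e else 0)
    inner e with lookup S e
    ... | false = trans (∑-cong (λ v → *-zeroʳ (one (c v)))) (∑-zero n)
    ... | true = trans (∑-cong (λ v → *-distribˡ-+ (one (c v)) (δ (end₁ G e) v) (δ (end₂ G e) v)))
                   (trans (∑-+ (λ v → one (c v) * δ (end₁ G e) v) (λ v → one (c v) * δ (end₂ G e) v))
                     (cong₂ _+_ (∑-δ (one ∘ c) (end₁ G e)) (∑-δ (one ∘ c) (end₂ G e))))

  ∑-deg : ∀ S → ∑ (deg G S) ≡ ∣ S ∣ + ∣ S ∣
  ∑-deg S = begin
    ∑ (deg G S)                               ≡⟨ ∑-cong (λ v → sym (*-identityˡ (deg G S v))) ⟩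
    ∑ (λ v → 1 * deg G S v)                   ≡⟨ handshake S (λ _ → true) ⟩
    ∑ (λ e → if lookup S e then 2 else 0)     ≡⟨ ∑-cong two ⟩
    ∑ (λ e → χ S e + χ S e)                   ≡⟨ ∑-+ (χ S) (χ S) ⟩
    ∑ (χ S) + ∑ (χ S)                         ≡⟨ sym (cong₂ _+_ (card S) (card S)) ⟩
    ∣ S ∣ + ∣ S ∣                             ∎
    where
    open ≡-Reasoning
    two : ∀ e → (if lookup S e then 2 else 0) ≡ χ S e + χ S e
    two e with lookup S e
    ... | true = refl
    ... | false = refl

  Same : Cut n → Fin m → Set
  Same c e = c (end₁ G e) ≡ c (end₂ G e)

  same? : ∀ c e → Dec (Same c e)
  same? c e = c (end₁ G e) Boolₚ.≟ c (end₂ G e)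

  NoCross : Subset m → Cut n → Set
  NoCross S c = ∀ {e} → e ∈ S → Same c e

  -- The degree sum over the true side is even, and an uncrossed edge contributes 0 or 2 to it, so a
  -- lone crossing edge would make it odd. Evenness is asked on the true side only, so that the
  -- vertices of degree 3 of a loose handcuff may sit on the other side.
  crossing-parity : ∀ {S c e} → (∀ v → c v ≡ true → parity (deg G S v) ≡ false) →
                    e ∈ S → NoCross (S ─ ⁅ e ⁆) c → Same c e
  crossing-parity {S} {c} {e} even e∈S nc with same? c e
  ... | yes s = s
  ... | no ¬s = ⊥-elim (true≢false (trans (sym odd) (trans (cong parity (sym (handshake S c))) ev)))
    where
    true≢false : true ≢ false
    true≢false ()
    ev : parity (∑ (λ v → one (c v) * deg G S v)) ≡ false
    ev = parity-even-∑ λ v → lem v (c v) refl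
      where
      lem : ∀ v b → c v ≡ b → parity (one b * deg G S v) ≡ false
      lem v true  q = trans (cong parity (*-identityˡ (deg G S v))) (even v q)
      lem v false q = refl
    par2 : ∀ a b → a ≡ b → parity (one a + one b) ≡ false
    par2 true  .true  refl = refl
    par2 false .false refl = refl
    par1 : ∀ a b → a ≢ b → parity (one a + one b) ≡ true
    par1 true  true  ne = ⊥-elim (ne refl)
    par1 true  false ne = refl
    par1 false true  ne = refl
    par1 false false ne = ⊥-elim (ne refl)
    odd : parity (∑ (λ f → if lookup S f then ends c f else 0)) ≡ true
    odd = parity-odd-∑ e (trans (cong (λ b → parity (if b then ends c e else 0)) (∈⇒lookup e∈S)) (par1 _ _ ¬s)) others
      where
      others : ∀ f → f ≢ e → parity (if lookup S f then ends c f else 0) ≡ false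
      others f ne with lookup S f in eq
      ... | false = refl
      ... | true = par2 _ _ (nc (─-≢ (lookup⇒∈ eq) ne))

  -- The number of vertices met by `S`, written as a sum over all vertices so that it can be
  -- compared termwise with the degree sum.
  vcount : Subset m → ℕ
  vcount S = ∑ (λ v → sgn (deg G S v))

  vcount-mono : ∀ S S' → S ⊆ S' → vcount S ≤ vcount S'
  vcount-mono S S' sub = ∑-mono (λ v → sgn-mono (deg-mono S S' sub v))

  vcount-⊎ : ∀ {S A B} → A ⊆ S → B ⊆ S → (∀ v → OnV G A v → OnV G B v → False) → vcount A + vcount B ≤ vcount S
  vcount-⊎ {S} {A} {B} A⊆S B⊆S dis = subst (_≤ vcount S) (∑-+ (λ v → sgn (deg G A v)) (λ v → sgn (deg G B v))) (∑-mono pt)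
    where
    pt : ∀ v → sgn (deg G A v) + sgn (deg G B v) ≤ sgn (deg G S v)
    pt v with onV? A v | onV? B v
    ... | yes a | yes b = ⊥-elim (dis v a b)
    ... | _ | no b = subst (_≤ _) (sym (trans (cong (sgn (deg G A v) +_) (cong sgn (¬OnV-zero b))) (+-identityʳ _)))
                       (sgn-mono (deg-mono A S A⊆S v))
    ... | no a | yes _ = subst (λ z → sgn z + _ ≤ _) (sym (¬OnV-zero a)) (sgn-mono (deg-mono B S B⊆S v))

  deg-one : ∀ {S v} → deg G S v ≡ 1 →
    ∃[ e ] (e ∈ S × IsEnd G v e × end₁ G e ≢ end₂ G e × (∀ f → f ∈ S → f ≢ e → ¬ IsEnd G v f))
  deg-one {S} {v} d1 with ∑-excess₁ {f = term G S v} {g = λ _ → 0} (λ _ → z≤n)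
                            (trans (sym (deg-∑ G S v)) (trans d1 (cong suc (sym (∑-zero m)))))
  ... | e , te , rest = e , e∈S , isE , nl , λ f f∈S ne t → <-irrefl (sym (rest f ne)) (term-pos f∈S t)
    where
    e∈S : e ∈ S
    e∈S with e ∈? S
    ... | yes p = p
    ... | no p = contradiction (trans (sym (term-∉ p)) te) λ ()
    isE : IsEnd G v e
    isE with isEnd? v e
    ... | yes p = p
    ... | no p = contradiction (trans (sym (term-untouched {S} p)) te) λ ()
    nl : end₁ G e ≢ end₂ G e
    nl eq with isE
    ... | inj₁ refl = contradiction (trans (sym te) (trans (term-∈ e∈S)
                        (cong₂ _+_ (δ-refl v) (trans (cong (λ z → δ z v) (sym eq)) (δ-refl v))))) λ ()
    ... | inj₂ refl = contradiction (trans (sym te) (trans (term-∈ e∈S)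
                        (cong₂ _+_ (trans (cong (λ z → δ z v) eq) (δ-refl v)) (δ-refl v)))) λ ()

  leaf-edge : ∀ S {v} → deg G S v ≡ 1 → ∃[ e ] (e ∈ S × end₁ G e ≢ end₂ G e × vcount (S ─ ⁅ e ⁆) < vcount S)
  leaf-edge S {v} d1 with deg-one {S} d1
  ... | e , e∈S , _ , nl , uniq = e , e∈S , nl , ∑-strict v (λ w → sgn-mono (deg-mono (S ─ ⁅ e ⁆) S ─⁻ˡ w))
          (subst₂ _<_ (cong sgn (sym (¬OnV-zero v-gone))) (cong sgn (sym d1)) (s≤s z≤n))
    where
    v-gone : ¬ OnV G (S ─ ⁅ e ⁆) v
    v-gone (f , f∈ , t) = uniq f (─⁻ˡ f∈) (λ { refl → ─-∌ f∈ }) t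

  deg≢1⇒2≤ : ∀ d → d ≢ 1 → sgn d + sgn d ≤ d
  deg≢1⇒2≤ zero          ne = z≤n
  deg≢1⇒2≤ (suc zero)    ne = ⊥-elim (ne refl)
  deg≢1⇒2≤ (suc (suc d)) ne = s≤s (s≤s z≤n)

  double : ∀ (f : Fin n → ℕ) → ∑ (λ v → f v + f v) ≡ ∑ f + ∑ f
  double f = ∑-+ f f

  -- Parity absorbs the unit of slack, which is what an exceptional vertex costs in
  -- `no-leaves⇒cycle`.
  double-≤ : ∀ {a b} → a + a ≤ suc (b + b) → a ≤ b
  double-≤ {a} {b} le = ≮⇒≥ λ lt →
    <-irrefl refl (≤-trans (subst (_≤ a + a) (cong suc (+-suc b b)) (+-mono-≤ lt lt)) le)

  -- A minimal set with at least as many edges as vertices is a cycle.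
  abstract
    edges≥vertices⇒cycle : ∀ S → Nonempty S → vcount S ≤ ∣ S ∣ → ∃[ Z ] (Z ⊆ S × Cycle G Z)
    edges≥vertices⇒cycle S₀ ne₀ le₀ with minimal (λ R → nonempty? R ×-dec (vcount R ≤? ∣ R ∣)) S₀ (ne₀ , le₀)
    ... | S , S⊆S₀ , (ne , le) , mn = S , S⊆S₀ , ne , connected , degrees
      where
      full : ∀ {R e} → R ⊆ S → e ∈ S → e ∉ R → Nonempty R → vcount R ≤ ∣ R ∣ → False
      full {R} {e} sub e∈S e∉R neR leR = e∉R (mn R sub (neR , leR) e∈S)
      no-leaf : ∀ v → deg G S v ≢ 1
      no-leaf v d1 = let e , e∈S , nl , less = leaf-edge S d1 in
        full ─⁻ˡ e∈S ─-∌ (ne' e∈S nl) (s≤s⁻¹ (≤-trans less (≤-trans le (≤-reflexive (card-─ e∈S)))))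
        where
        -- The leaf edge is not a loop, so `S` meets at least two vertices and, by `le`, has a
        -- second edge.
        ne' : ∀ {e} → e ∈ S → end₁ G e ≢ end₂ G e → Nonempty (S ─ ⁅ e ⁆)
        ne' {e} e∈S nl = card⇒nonempty (s≤s⁻¹ (≤-trans two (≤-trans le (≤-reflexive (card-─ e∈S)))))
          where
          two : 2 ≤ vcount S
          two = subst (_≤ vcount S) (cong₂ _+_ (sgn-pos (OnV-pos (e , e∈S , inj₁ refl))) (sgn-pos (OnV-pos (e , e∈S , inj₂ refl))))
                  (∑-two (λ v → sgn (deg G S v)) nl)
      exact : ∣ S ∣ ≤ vcount S
      exact = ≮⇒≥ λ lt → case ne of λ { (e , e∈S) →
        let le' = s≤s⁻¹ (≤-trans lt (≤-reflexive (card-─ e∈S)))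
            pos = ≤-trans (≤-reflexive (sym (sgn-pos (OnV-pos (e , e∈S , inj₁ refl)))))
                          (term≤∑ (λ v → sgn (deg G S v)) (end₁ G e))
        in full ─⁻ˡ e∈S ─-∌ (card⇒nonempty (≤-trans pos le')) (≤-trans (vcount-mono (S ─ ⁅ e ⁆) S ─⁻ˡ) le') }
      tight : ∀ v → deg G S v ≡ sgn (deg G S v) + sgn (deg G S v)
      tight = ∑-≤-tight (λ v → deg≢1⇒2≤ _ (no-leaf v))
        (subst₂ _≤_ (sym (∑-deg S)) (sym (double (λ v → sgn (deg G S v)))) (+-mono-≤ exact exact))
      degrees : ∀ v → (deg G S v ≡ 0) ⊎ (deg G S v ≡ 2)
      degrees v = lem (deg G S v) (tight v)
        where
        lem : ∀ d → d ≡ sgn d + sgn d → (d ≡ 0) ⊎ (d ≡ 2)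
        lem zero    _  = inj₁ refl
        lem (suc d) eq = inj₂ eq
      connected : ConnectedES G S
      connected A B refl dis (a , a∈) (b , b∈) with any? (λ v → onV? A v ×-dec onV? B v)
      ... | yes p = p
      -- By minimality each part has fewer edges than vertices; since the parts share no vertex, so
      -- does `A ∪ B`.
      ... | no none with vcount A ≤? ∣ A ∣
      ...   | yes leA = ⊥-elim (full ∪ˡ (∪ʳ b∈) (λ q → dis b q b∈) (a , a∈) leA)
      ...   | no ¬leA = ⊥-elim (full ∪ʳ (∪ˡ a∈) (λ q → dis a a∈ q) (b , b∈)
                (≮⇒≥ λ lt → <-irrefl refl (begin-strict
                  ∣ A ∪ B ∣              ≡⟨ card-∪ dis ⟩
                  ∣ A ∣ + ∣ B ∣          <⟨ +-mono-< (≰⇒> ¬leA) lt ⟩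
                  vcount A + vcount B    ≤⟨ vcount-⊎ ∪ˡ ∪ʳ (λ v p q → none (v , p , q)) ⟩
                  vcount (A ∪ B)         ≤⟨ le ⟩
                  ∣ A ∪ B ∣              ∎)))
        where open ≤-Reasoning

  -- One exceptional vertex is allowed: by the handshake lemma its degree cannot spoil the count.
  abstract
    no-leaves⇒cycle : ∀ r S → Nonempty S → (∀ v → v ≢ r → deg G S v ≢ 1) → ∃[ Z ] (Z ⊆ S × Cycle G Z)
    no-leaves⇒cycle r S ne h = edges≥vertices⇒cycle S ne (double-≤ (begin
      vcount S + vcount S                                  ≡⟨ double (λ v → sgn (deg G S v)) ⟨
      ∑ (λ v → sgn (deg G S v) + sgn (deg G S v))          ≤⟨ ∑-mono pt ⟩
      ∑ (λ v → δ r v + deg G S v)                          ≡⟨ ∑-+ (δ r) (deg G S) ⟩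
      ∑ (δ r) + ∑ (deg G S)                                ≡⟨ cong₂ _+_ (∑-δ₁ r) (∑-deg S) ⟩
      suc (∣ S ∣ + ∣ S ∣)                                  ∎))
      where
      open ≤-Reasoning
      pt : ∀ v → sgn (deg G S v) + sgn (deg G S v) ≤ δ r v + deg G S v
      pt v with v ≟ r
      ... | no ne = ≤-trans (deg≢1⇒2≤ _ (h v ne)) (m≤n+m _ _)
      ... | yes refl = subst (λ z → sgn (deg G S v) + sgn (deg G S v) ≤ z + deg G S v) (sym (δ-refl v)) (lem (deg G S v))
        where
        lem : ∀ d → sgn d + sgn d ≤ suc d
        lem zero = z≤n
        lem (suc d) = s≤s (s≤s z≤n)

-- Cycles and forests

module _ {n m : ℕ} (G : Graph n m) where

  Split : Subset m → Set
  Split S = ∃[ A ] (A ⊆ S × Nonempty A × Nonempty (S ─ A) × (∀ v → OnV G A v → OnV G (S ─ A) v → False))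

  abstract
    split? : ∀ S → Split S ⊎ ConnectedES G S
    split? S with anySubset? (λ A → (A ⊆? S) ×-dec (nonempty? A ×-dec (nonempty? (S ─ A) ×-dec
                    all? (λ v → onV? G A v →-dec (onV? G (S ─ A) v →-dec no id)))))
    ... | yes p = inj₁ p
    ... | no none = inj₂ con
      where
      con : ConnectedES G S
      con A B eq dis neA (b , b∈) with any? (λ v → onV? G A v ×-dec onV? G B v)
      ... | yes p = p
      ... | no un = ⊥-elim (none (A , A⊆S , neA , (b , ─⁺ (B⊆S b∈) (λ a → dis b a b∈)) ,
                      λ { v onA (e , e∈ , t) → un (v , onA , e , inB e∈ , t) }))
        where
        A⊆S : A ⊆ S
        A⊆S {e} p = subst (e ∈_) eq (∪ˡ p)
        B⊆S : B ⊆ S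
        B⊆S {e} p = subst (e ∈_) eq (∪ʳ p)
        inB : ∀ {e} → e ∈ S ─ A → e ∈ B
        inB {e} p = [ (λ q → ⊥-elim (─⁻ʳ p q)) , id ]′ (∪⁻ (subst (e ∈_) (sym eq) (─⁻ˡ p)))

  abstract
    connected? : ∀ S → Dec (ConnectedES G S)
    connected? S with split? S
    ... | inj₂ con = yes con
    ... | inj₁ (A , A⊆S , neA , neB , un) = no λ con →
      let v , p , q = con A (S ─ A) (⊆-antisym (∪-lub A⊆S ─⁻ˡ) (x∈p∪q⁺ ∘ split-─)) (λ e a b → ─⁻ʳ b a) neA neB
      in un v p q

  abstract
    cycle? : ∀ S → Dec (Cycle G S)
    cycle? S = nonempty? S ×-dec (connected? S ×-dec all? (λ v → (deg G S v ≟ℕ 0) ⊎-dec (deg G S v ≟ℕ 2)))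

  Acyclic : Subset m → Set
  Acyclic T = ∀ Z → Z ⊆ T → ¬ Cycle G Z

  abstract
    acyclic? : ∀ T → Dec (Acyclic T)
    acyclic? T = allSubset? λ Z → (Z ⊆? T) →-dec ¬? (cycle? Z)

  cycle-even : ∀ {Z} → Cycle G Z → ∀ v → parity (deg G Z v) ≡ false
  cycle-even (_ , _ , d) v = [ cong parity , cong parity ]′ (d v)

  cycle-cut : ∀ {Z c e} → Cycle G Z → e ∈ Z → NoCross G (Z ─ ⁅ e ⁆) c → Same G c e
  cycle-cut {Z} {c} cy = crossing-parity G {Z} {c} (λ v _ → cycle-even cy v)

  cycle-deg : ∀ {Z v} → Cycle G Z → OnV G Z v → deg G Z v ≡ 2
  cycle-deg {Z} {v} (_ , _ , d) on with d v
  ... | inj₁ d0 = ⊥-elim (<-irrefl (sym d0) (OnV-pos G on))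
  ... | inj₂ d2 = d2

  cycle-card : ∀ {Z} → Cycle G Z → ∣ Z ∣ ≡ vcount G Z
  cycle-card {Z} (_ , _ , d) = ≤-antisym (half (≤-reflexive eq)) (half (≤-reflexive (sym eq)))
    where
    half : ∀ {a b} → a + a ≤ b + b → a ≤ b
    half le = double-≤ G (m≤n⇒m≤1+n le)
    lem : ∀ d → (d ≡ 0) ⊎ (d ≡ 2) → d ≡ sgn d + sgn d
    lem _ (inj₁ refl) = refl
    lem _ (inj₂ refl) = refl
    eq : ∣ Z ∣ + ∣ Z ∣ ≡ vcount G Z + vcount G Z
    eq = trans (sym (∑-deg G Z)) (trans (∑-cong (λ v → lem _ (d v))) (double G (λ v → sgn (deg G Z v))))

  -- If an edge of `Z` were missing, connectedness would give a vertex common to `R` and the rest,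
  -- where the degree 2 divides as 1 + 1: a leaf of `R`.
  leafless-in-cycle : ∀ {Z R} → Cycle G Z → R ⊆ Z → Nonempty R → (∀ v → deg G R v ≢ 1) → Z ⊆ R
  leafless-in-cycle {Z} {R} cy@(_ , con , d) R⊆Z ne h {e} e∈Z with e ∈? R
  ... | yes p = p
  ... | no e∉R with con R (Z ─ R) (⊆-antisym (∪-lub R⊆Z ─⁻ˡ) (x∈p∪q⁺ ∘ split-─))
                     (λ f p q → ─⁻ʳ q p) ne (e , ─⁺ e∈Z e∉R)
  ...   | v , onR , onQ = ⊥-elim (h v (lem (deg G R v) (deg G (Z ─ R) v) (OnV-pos G onR) (OnV-pos G onQ)
                            (trans (sym (deg-─ G R⊆Z v)) (cycle-deg cy (OnV-mono G R⊆Z onR)))))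
    where
    lem : ∀ a b → 0 < a → 0 < b → a + b ≡ 2 → a ≡ 1
    lem (suc zero)    b       _ _ _  = refl
    lem (suc (suc a)) (suc b) _ _ eq = contradiction (suc-injective (suc-injective eq)) (λ q → contradiction (trans (sym (+-suc a b)) q) λ ())

  cycle-leafless : ∀ {Z} → Cycle G Z → ∀ v → deg G Z v ≢ 1
  cycle-leafless (_ , _ , d) v d1 with d v
  ... | inj₁ d0 = contradiction (trans (sym d0) d1) λ ()
  ... | inj₂ d2 = contradiction (trans (sym d2) d1) λ ()

  cycle-minimal : ∀ {Z R} → Cycle G Z → Cycle G R → R ⊆ Z → R ≡ Z
  cycle-minimal cz cr@(ne , _) sub = ⊆-antisym sub (leafless-in-cycle cz sub ne (cycle-leafless cr))

  -- `ConnectedES` speaks of edge bipartitions. The edges of `S` on the true side and those on the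
  -- false side share no vertex, so one of the two classes is empty.
  one-sided : ∀ {S c v w} → ConnectedES G S → NoCross G S c → OnV G S v → OnV G S w → c v ≡ c w
  one-sided {S} {c} {v} {w} con nc onv onw = lem _ _ refl refl
    where
    A = ⟪ (λ e → lookup S e ∧ c (end₁ G e)) ⟫
    side : ∀ {e x} → e ∈ S → IsEnd G x e → c (end₁ G e) ≡ c x
    side p (inj₁ refl) = refl
    side p (inj₂ refl) = nc p
    A⁺ : ∀ {e x} → e ∈ S → IsEnd G x e → c x ≡ true → e ∈ A
    A⁺ {e} p t q = ⟪⟫⁺ (trans (cong (_∧ c (end₁ G e)) (∈⇒lookup p)) (trans (side p t) q))
    A⁻ : ∀ {e} → e ∈ A → e ∈ S × c (end₁ G e) ≡ true
    A⁻ {e} p with lookup S e in eq | ⟪⟫⁻ {f = λ e → lookup S e ∧ c (end₁ G e)} p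
    ... | true | q = lookup⇒∈ eq , q
    diff : ∀ {x y} → OnV G S x → OnV G S y → c x ≡ true → c y ≡ false → False
    diff {x} {y} (e , e∈ , te) (f , f∈ , tf) cx cy
      with con A (S ─ A) (⊆-antisym (∪-lub (proj₁ ∘ A⁻) ─⁻ˡ) (x∈p∪q⁺ ∘ split-─)) (λ g p q → ─⁻ʳ q p)
             (e , A⁺ e∈ te cx)
             (f , ─⁺ f∈ (λ p → contradiction (trans (sym (proj₂ (A⁻ p))) (trans (side f∈ tf) cy)) λ ()))
    ... | z , (g , g∈ , tg) , (h , h∈ , th) =
      ─⁻ʳ h∈ (A⁺ (─⁻ˡ h∈) th (trans (sym (side (proj₁ (A⁻ g∈)) tg)) (proj₂ (A⁻ g∈))))
    lem : ∀ a b → c v ≡ a → c w ≡ b → c v ≡ c w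
    lem true true p q = trans p (sym q)
    lem false false p q = trans p (sym q)
    lem true false p q = ⊥-elim (diff onv onw p q)
    lem false true p q = ⊥-elim (diff onw onv q p)

  -- Components and forests through cuts

  abstract
    noCross? : ∀ S c → Dec (NoCross G S c)
    noCross? S c = map′ (λ h {e} → h e) (λ h e → h {e}) (all? (λ e → (e ∈? S) →-dec same? G c e))

  NoCross-cong : ∀ {S c d} → (∀ v → c v ≡ d v) → NoCross G S c → NoCross G S d
  NoCross-cong eq nc {e} p = trans (sym (eq (end₁ G e))) (trans (nc p) (eq (end₂ G e)))

  abstract
    -- Cuts are enumerated as vertex subsets. Only cuts that are true at `u` are searched, because a
    -- cut and its complement are crossed by the same edges.
    separated? : ∀ S u w → (∃[ c ] (NoCross G S c × c u ≡ true × c w ≡ false)) ⊎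
                           (∀ c → NoCross G S c → c u ≡ c w)
    separated? S u w with anySubset? (λ U → noCross? S (lookup U) ×-dec ((lookup U u Boolₚ.≟ true) ×-dec (lookup U w Boolₚ.≟ false)))
    ... | yes (U , p) = inj₁ (lookup U , p)
    ... | no none = inj₂ λ c nc → lem c nc _ _ refl refl
      where
      bad : ∀ c → NoCross G S c → c u ≡ true → c w ≡ false → False
      bad c nc p q = none (⟪ c ⟫ , NoCross-cong (λ v → sym (lookup∘tabulate c v)) nc ,
                          trans (lookup∘tabulate c u) p , trans (lookup∘tabulate c w) q)
      lem : ∀ c → NoCross G S c → ∀ a b → c u ≡ a → c w ≡ b → c u ≡ c w
      lem c nc true true p q = trans p (sym q)
      lem c nc false false p q = trans p (sym q)
      lem c nc true false p q = ⊥-elim (bad c nc p q)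
      lem c nc false true p q = ⊥-elim (bad (not ∘ c) (cong not ∘ nc) (cong not p) (cong not q))

  -- Lying in the same component of `S`, by duality with cuts.
  Linked : Subset m → Fin n → Fin n → Set
  Linked S u w = ∀ c → NoCross G S c → c u ≡ c w

  abstract
    linked? : ∀ S u w → Dec (Linked S u w)
    linked? S u w with separated? S u w
    ... | inj₂ p = yes p
    ... | inj₁ (c , nc , p , q) = no (λ h → contradiction (trans (sym p) (trans (h c nc) q)) λ ())

  override : Cut n → Fin n → Bool → Cut n
  override c v b w = if does (w ≟ v) then b else c w

  override-at : ∀ c v b → override c v b v ≡ b
  override-at c v b rewrite dec-true (v ≟ v) refl = refl

  override-off : ∀ c v b {w} → w ≢ v → override c v b w ≡ c w
  override-off c v b {w} ne rewrite dec-false (w ≟ v) ne = refl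

  override-untouched : ∀ c v b {e} → ¬ IsEnd G v e → Same G c e → Same G (override c v b) e
  override-untouched c v b nt s =
    trans (override-off c v b (nt ∘ inj₁)) (trans s (sym (override-off c v b (nt ∘ inj₂))))

  -- x hangs the vertex v on q, so any cut can be moved off x by relabelling v.
  override-pendant : ∀ {S c v x q} → (IsEnd G v x × IsEnd G q x) → q ≢ v → (∀ f → f ∈ S → f ≢ x → ¬ IsEnd G v f) →
                     NoCross G (S ─ ⁅ x ⁆) c → NoCross G S (override c v (c q))
  override-pendant {S} {c} {v} {x} {q} (tv , tq) q≢v uniq nc {f} f∈S with f ≟ x
  ... | no ne = override-untouched c v (c q) (uniq f f∈S ne) (nc (─-≢ f∈S ne))
  ... | yes refl = lem tv tq
    where
    at : override c v (c q) v ≡ override c v (c q) q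
    at = trans (override-at c v (c q)) (sym (override-off c v (c q) q≢v))
    lem : IsEnd G v x → IsEnd G q x → Same G (override c v (c q)) x
    lem (inj₁ refl) (inj₁ p) = ⊥-elim (q≢v (sym p))
    lem (inj₁ refl) (inj₂ refl) = at
    lem (inj₂ refl) (inj₁ refl) = sym at
    lem (inj₂ refl) (inj₂ p) = ⊥-elim (q≢v (sym p))

  point : Fin n → Cut n
  point v w = does (w ≟ v)

  point-at : ∀ v → point v v ≡ true
  point-at v = dec-true (v ≟ v) refl

  point-off : ∀ {v w} → w ≢ v → point v w ≡ false
  point-off {v} {w} = dec-false (w ≟ v)

  point-untouched : ∀ {v e} → ¬ IsEnd G v e → Same G (point v) e
  point-untouched nt = trans (point-off (nt ∘ inj₁)) (sym (point-off (nt ∘ inj₂)))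

  otherEnd : ∀ {v e} → IsEnd G v e → end₁ G e ≢ end₂ G e → ∃[ q ] (IsEnd G q e × q ≢ v)
  otherEnd {e = e} (inj₁ refl) nl = end₂ G e , inj₂ refl , nl ∘ sym
  otherEnd {e = e} (inj₂ refl) nl = end₁ G e , inj₁ refl , nl

  same-ends : ∀ {c e p q} → Same G c e → IsEnd G p e → IsEnd G q e → c p ≡ c q
  same-ends s (inj₁ refl) (inj₁ refl) = refl
  same-ends s (inj₁ refl) (inj₂ refl) = s
  same-ends s (inj₂ refl) (inj₁ refl) = sym s
  same-ends s (inj₂ refl) (inj₂ refl) = refl

  -- In a minimal set linking the ends of e no vertex is a leaf, and a cycle avoiding e could be opened.
  abstract
    closing-cycle : ∀ S e → e ∉ S → Linked S (end₁ G e) (end₂ G e) → ∃[ Z ] (Cycle G Z × e ∈ Z × Z ⊆ S ∪ ⁅ e ⁆)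
    closing-cycle S₀ e e∉S₀ lk₀ with minimal (λ R → linked? R (end₁ G e) (end₂ G e)) S₀ lk₀
    ... | S , S⊆S₀ , lk , mn = finish (no-leaves⇒cycle G (end₁ G e) R (e , ∪ʳ (x∈⁅x⁆ e)) (λ v _ → leafless v))
      where
      R : Subset m
      R = S ∪ ⁅ e ⁆
      open-up : ∀ g → g ∈ S → ¬ Linked (S ─ ⁅ g ⁆) (end₁ G e) (end₂ G e)
      open-up g g∈S lk' = ─-∌ (mn (S ─ ⁅ g ⁆) ─⁻ˡ lk' g∈S)
      leafless : ∀ v → deg G R v ≢ 1
      leafless v d1 = go (deg-one G {R} d1)
        where
        go : ∃[ g ] (g ∈ R × IsEnd G v g × end₁ G g ≢ end₂ G g × (∀ f → f ∈ R → f ≢ g → ¬ IsEnd G v f)) → False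
        go (g , g∈R , t , nl , uniq) with ∪⁻ g∈R | otherEnd t nl
        ... | inj₂ g∈e | q , tq , q≢v with ⁅⁆⁻ g∈e
        ...   | refl = contradiction (trans (sym (point-at v)) (trans (same-ends {point v} {e} (lk (point v) nc) t tq) (point-off q≢v))) λ ()
          where
          nc : NoCross G S (point v)
          nc {f} f∈S = point-untouched (uniq f (∪ˡ f∈S) (λ { refl → e∉S₀ (S⊆S₀ f∈S) }))
        go (g , g∈R , t , nl , uniq) | inj₁ g∈S | q , tq , q≢v = open-up g g∈S λ c nc →
          trans (sym (override-off c v (c q) (nt ∘ inj₁)))
            (trans (lk (override c v (c q)) (override-pendant (t , tq) q≢v (λ f f∈ → uniq f (∪ˡ f∈)) nc))
              (override-off c v (c q) (nt ∘ inj₂)))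
          where
          nt : ¬ IsEnd G v e
          nt = uniq e (∪ʳ (x∈⁅x⁆ e)) (λ { refl → e∉S₀ (S⊆S₀ g∈S) })
      finish : ∃[ Z ] (Z ⊆ R × Cycle G Z) → ∃[ Z ] (Cycle G Z × e ∈ Z × Z ⊆ S₀ ∪ ⁅ e ⁆)
      finish (Z , Z⊆R , cy@((z , z∈Z) , _)) with e ∈? Z
      ... | yes e∈Z = Z , cy , e∈Z , ∪-lub (∪ˡ ∘ S⊆S₀) ∪ʳ ∘ Z⊆R
      ... | no e∉Z = ⊥-elim (open-up z (Z⊆S z∈Z) (λ c nc → lk c (nc' c nc)))
        where
        Z⊆S : Z ⊆ S
        Z⊆S f∈ with ∪⁻ (Z⊆R f∈)
        ... | inj₁ p = p
        ... | inj₂ p = ⊥-elim (e∉Z (subst (_∈ Z) (⁅⁆⁻ p) f∈))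
        nc' : ∀ c → NoCross G (S ─ ⁅ z ⁆) c → NoCross G S c
        nc' c nc {f} f∈S with f ≟ z
        ... | no ne = nc (─-≢ f∈S ne)
        ... | yes refl = cycle-cut {Z} {c} cy z∈Z (λ h∈ → nc (─-≢ (Z⊆S (─⁻ˡ h∈)) (λ { refl → ─-∌ h∈ })))

  -- For `T ⊆ X` this says that `T` and `X` have the same components.
  Spanning : Subset m → Subset m → Set
  Spanning T X = ∀ c → NoCross G T c → NoCross G X c

  abstract
    -- A maximal acyclic set spans: an edge whose ends are not linked by `T` closes no cycle with
    -- `T`, because the rest of that cycle would link them. The prescribed `S` makes room for a
    -- chosen star or chosen paths in the forest.
    spanning-forest : ∀ X S → S ⊆ X → Acyclic S → ∃[ T ] (S ⊆ T × T ⊆ X × Acyclic T × Spanning T X)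
    spanning-forest X S S⊆X ac with maximal acyclic? X S S⊆X ac
    ... | T , S⊆T , T⊆X , acT , mx = T , S⊆T , T⊆X , acT , span
      where
      span : Spanning T X
      span c nc {e} e∈X with e ∈? T
      ... | yes p = nc p
      ... | no e∉T with linked? T (end₁ G e) (end₂ G e)
      ...   | yes lk = lk c nc
      ...   | no ¬lk = ⊥-elim (mx e e∈X e∉T λ Z Z⊆ cy → case e ∈? Z of λ where
                (yes e∈Z) → ¬lk (λ d ncd → cycle-cut {Z} {d} cy e∈Z (λ f∈ → ncd (rest Z⊆ f∈)))
                (no e∉Z) → acT Z (λ f∈ → [ id , (λ q → ⊥-elim (e∉Z (subst (_∈ Z) (⁅⁆⁻ q) f∈))) ]′ (∪⁻ (Z⊆ f∈))) cy)
        where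
        rest : ∀ {Z f} → Z ⊆ T ∪ ⁅ e ⁆ → f ∈ Z ─ ⁅ e ⁆ → f ∈ T
        rest Z⊆ f∈ = [ id , (λ q → ⊥-elim (─⁻ʳ f∈ q)) ]′ (∪⁻ (Z⊆ (─⁻ˡ f∈)))

  -- No cycle crosses a cut exactly once, so a cut that `e` alone crosses keeps `e` off all cycles
  -- in `T`.
  acyclic-bridges : ∀ {T} → (∀ e → e ∈ T → ∃[ c ] (NoCross G (T ─ ⁅ e ⁆) c × ¬ Same G c e)) → Acyclic T
  acyclic-bridges h Z Z⊆T cy@((e , e∈Z) , _) with h e (Z⊆T e∈Z)
  ... | c , nc , ns = ns (cycle-cut {Z} {c} cy e∈Z (λ f∈ → nc (─⁺ (Z⊆T (─⁻ˡ f∈)) (─⁻ʳ f∈))))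

  -- Connectedness is relative to `W` because isolated vertices are allowed, and collapsing a vertex
  -- set creates further ones.
  Joined : Subset m → Subset n → Set
  Joined S W = ∀ c → NoCross G S c → ∀ {v w} → v ∈ W → w ∈ W → c v ≡ c w

  -- Grow `U` from a vertex of `W`: while some edge of `S` leaves `U`, its outer end joins `U` and
  -- the edge joins `R`, so each new vertex is paid for by a new edge. When no edge leaves `U`, the
  -- cut `U` shows that `W ⊆ U`.
  joined-card : ∀ S W → Joined S W → ∣ W ∣ ≤ suc ∣ S ∣
  joined-card S W jn with nonempty? W
  ... | no empty = subst (_≤ suc ∣ S ∣) (sym (trans (cong ∣_∣ (Empty-unique empty)) (∣⊥∣≡0 n))) z≤n
  ... | yes (r , r∈W) = go ⁅ r ⁆ S∅ (x∈⁅x⁆ r) (λ p → ⊥-elim (∉⊥ p)) (λ p → ⊥-elim (∉⊥ p))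
                          (≤-trans (≤-reflexive (∣⁅x⁆∣≡1 r)) (s≤s z≤n)) (<-wellFounded _)
    where
    S∅ : Subset m
    S∅ = Data.Fin.Subset.⊥
    go : ∀ U R → r ∈ U → R ⊆ S → (∀ {e} → e ∈ R → end₁ G e ∈ U × end₂ G e ∈ U) → ∣ U ∣ ≤ suc ∣ R ∣ →
         Acc _<_ ∣ ∁ U ∣ → ∣ W ∣ ≤ suc ∣ S ∣
    go U R r∈U R⊆S inU le (acc rs) with any? (λ e → (e ∈? S) ×-dec ¬? (same? G (lookup U) e))
    ... | no none = ≤-trans (p⊆q⇒∣p∣≤∣q∣ W⊆U) (≤-trans le (s≤s (p⊆q⇒∣p∣≤∣q∣ R⊆S)))
      where
      nc : NoCross G S (lookup U)
      nc {e} e∈S = decidable-stable (same? G (lookup U) e) (λ ns → none (e , e∈S , ns))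
      W⊆U : W ⊆ U
      W⊆U w∈W = lookup⇒∈ (trans (sym (jn (lookup U) nc r∈W w∈W)) (∈⇒lookup r∈U))
    ... | yes (e , e∈S , ns) = grow (end₁ G e ∈? U) (end₂ G e ∈? U)
      where
      e∉R : e ∉ R
      e∉R p = ns (trans (∈⇒lookup (proj₁ (inU p))) (sym (∈⇒lookup (proj₂ (inU p)))))
      step : ∀ w → w ∉ U → (∀ {v} → IsEnd G v e → v ∈ U ⊎ v ≡ w) → ∣ W ∣ ≤ suc ∣ S ∣
      step w w∉U cov = go (U ∪ ⁅ w ⁆) (R ∪ ⁅ e ⁆) (∪ˡ r∈U) (∪-lub R⊆S (⁅⁆⊆ e∈S)) inU'
        (subst₂ _≤_ (sym (card-+1 w∉U)) (cong suc (sym (card-+1 e∉R))) (s≤s le))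
        (rs (p⊂q⇒∣p∣<∣q∣ ((λ p → x∉p⇒x∈∁p (λ q → x∈∁p⇒x∉p p (∪ˡ q))) , w , x∉p⇒x∈∁p w∉U , λ p → x∈∁p⇒x∉p p (∪ʳ (x∈⁅x⁆ w)))))
        where
        into : ∀ {v} → IsEnd G v e → v ∈ U ∪ ⁅ w ⁆
        into t = [ ∪ˡ , (λ { refl → ∪ʳ (x∈⁅x⁆ _) }) ]′ (cov t)
        inU' : ∀ {f} → f ∈ R ∪ ⁅ e ⁆ → end₁ G f ∈ U ∪ ⁅ w ⁆ × end₂ G f ∈ U ∪ ⁅ w ⁆
        inU' p with ∪⁻ p
        ... | inj₁ q = ∪ˡ (proj₁ (inU q)) , ∪ˡ (proj₂ (inU q))
        ... | inj₂ q with ⁅⁆⁻ q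
        ...   | refl = into (inj₁ refl) , into (inj₂ refl)
      grow : Dec (end₁ G e ∈ U) → Dec (end₂ G e ∈ U) → ∣ W ∣ ≤ suc ∣ S ∣
      grow (yes p) (yes q) = ⊥-elim (ns (trans (∈⇒lookup p) (sym (∈⇒lookup q))))
      grow (no p) (no q) = ⊥-elim (ns (trans (∉⇒lookup p) (sym (∉⇒lookup q))))
      grow (yes p) (no q) = step (end₂ G e) q (λ { (inj₁ refl) → inj₁ p ; (inj₂ refl) → inj₂ refl })
      grow (no p) (yes q) = step (end₁ G e) p (λ { (inj₁ refl) → inj₂ refl ; (inj₂ refl) → inj₁ q })

-- Thetas and handcuffs

module _ {n m : ℕ} (G : Graph n m) where

  connected-rest : ∀ {S A} → ConnectedES G S → A ⊆ S → Nonempty A → Nonempty (S ─ A) →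
                   ∃[ v ] (OnV G A v × OnV G (S ─ A) v)
  connected-rest con A⊆S neA neB = con _ _ (⊆-antisym (∪-lub A⊆S ─⁻ˡ) (x∈p∪q⁺ ∘ split-─)) (λ e a b → ─⁻ʳ b a) neA neB

  OnV-split : ∀ {S A B v} → (∀ {e} → e ∈ S → e ∈ A ⊎ e ∈ B) → OnV G S v → OnV G A v ⊎ OnV G B v
  OnV-split cov (e , e∈ , t) with cov e∈
  ... | inj₁ p = inj₁ (e , p , t)
  ... | inj₂ p = inj₂ (e , p , t)

  -- A piece of `S ─ C` that shares no vertex with the other piece can be attached to the connected
  -- set `S` only through `C`.
  hooked : ∀ {S C A B} → ConnectedES G S → C ⊆ S → Nonempty C → A ∪ B ≡ S ─ C → Disjoint A B → Nonempty A →
           ¬ (∃[ v ] (OnV G A v × OnV G B v)) → ∃[ v ] (OnV G A v × OnV G C v)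
  hooked {S} {C} {A} {B} con C⊆S (x , x∈C) eq dis neA un =
    let v , onA , onR = connected-rest con (─⁻ˡ ∘ A⊆) neA (x , ─⁺ (C⊆S x∈C) (λ p → ─⁻ʳ (A⊆ p) x∈C))
    in [ (λ q → v , onA , q) , (λ q → ⊥-elim (un (v , onA , q))) ]′ (OnV-split cov onR)
    where
    A⊆ : A ⊆ S ─ C
    A⊆ {e} p = subst (e ∈_) eq (∪ˡ p)
    cov : ∀ {e} → e ∈ S ─ A → e ∈ C ⊎ e ∈ B
    cov {e} p with e ∈? C
    ... | yes q = inj₁ q
    ... | no q = inj₂ ([ (λ a → ⊥-elim (─⁻ʳ p a)) , id ]′ (∪⁻ (subst (e ∈_) (sym eq) (─⁺ (─⁻ˡ p) q))))

  onV-deg : ∀ {S v} → deg G S v ≡ 0 → ¬ OnV G S v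
  onV-deg d0 on = <-irrefl (sym d0) (OnV-pos G on)

  -- Away from `u` a vertex of `C` spends its whole degree on `C`, so `C` and the rest meet only at
  -- `u`. If the rest fell apart, each piece would still touch `C`, hence contain `u`.
  tight-handcuff : ∀ {S u C} → ConnectedES G S → deg G S u ≡ 4 →
    (∀ v → v ≢ u → (deg G S v ≡ 0) ⊎ (deg G S v ≡ 2)) → C ⊆ S → Cycle G C → TightHandcuff G C (S ─ C) S
  tight-handcuff {S} {u} {C} con du dv C⊆S cy@(neC , _ , dC) =
    cy , (neD , conD , degD) , (λ e p q → ─⁻ʳ q p) , ⊆-antisym (x∈p∪q⁺ ∘ split-─) (∪-lub C⊆S ─⁻ˡ) ,
    u , uC , uD , only
    where
    D = S ─ C
    sumd : ∀ v → deg G S v ≡ deg G C v + deg G D v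
    sumd = deg-─ G C⊆S
    arith : ∀ a s d → (s ≡ 0) ⊎ (s ≡ 2) → a ≡ 2 → s ≡ a + d → d ≡ 0
    arith _ _ zero _ _ _ = refl
    arith _ _ (suc d) (inj₁ refl) refl ()
    arith _ _ (suc d) (inj₂ refl) refl ()
    only : ∀ v → OnV G C v → OnV G D v → v ≡ u
    only v onC onD with v ≟ u
    ... | yes p = p
    ... | no ne = ⊥-elim (onV-deg (arith _ _ _ (dv v ne) (cycle-deg G cy onC) (sumd v)) onD)
    neD : Nonempty D
    neD with nonempty? D
    ... | yes p = p
    ... | no e = ⊥-elim (lem (dC u) (trans (sym du) (trans (sumd u) (trans (cong (deg G C u +_)
                   (¬OnV-zero G (λ { (f , f∈ , _) → e (f , f∈) }))) (+-identityʳ _)))))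
      where
      lem : ∀ {d} → (d ≡ 0) ⊎ (d ≡ 2) → 4 ≡ d → False
      lem (inj₁ refl) ()
      lem (inj₂ refl) ()
    meet = connected-rest con C⊆S neC neD
    uC : OnV G C u
    uC = subst (OnV G C) (only _ (proj₁ (proj₂ meet)) (proj₂ (proj₂ meet))) (proj₁ (proj₂ meet))
    uD : OnV G D u
    uD = subst (OnV G D) (only _ (proj₁ (proj₂ meet)) (proj₂ (proj₂ meet))) (proj₂ (proj₂ meet))
    degD : ∀ v → (deg G D v ≡ 0) ⊎ (deg G D v ≡ 2)
    degD v with v ≟ u
    ... | yes refl = inj₂ (+-cancelˡ-≡ 2 _ _ (trans (cong (_+ deg G D u) (sym (cycle-deg G cy uC))) (trans (sym (sumd u)) du)))
    ... | no ne = lem _ _ _ (dC v) (dv v ne) (sumd v)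
      where
      lem : ∀ a s d → (a ≡ 0) ⊎ (a ≡ 2) → (s ≡ 0) ⊎ (s ≡ 2) → s ≡ a + d → (d ≡ 0) ⊎ (d ≡ 2)
      lem _ _ d (inj₁ refl) (inj₁ p) q = inj₁ (trans (sym q) p)
      lem _ _ d (inj₁ refl) (inj₂ p) q = inj₂ (trans (sym q) p)
      lem _ _ d (inj₂ refl) p q = inj₁ (arith _ _ d p refl q)
    conD : ConnectedES G D
    conD A B eq dis neA neB with any? (λ v → onV? G A v ×-dec onV? G B v)
    ... | yes p = p
    ... | no un = u , at A B eq dis neA un , at B A (trans (∪-comm B A) eq) (λ e p q → dis e q p) neB (λ { (v , p , q) → un (v , q , p) })
      where
      at : ∀ A B → A ∪ B ≡ D → Disjoint A B → Nonempty A → ¬ (∃[ v ] (OnV G A v × OnV G B v)) → OnV G A u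
      at A B eq dis neA un with hooked con C⊆S neC eq dis neA un
      ... | v , onA , onC = subst (OnV G A) (only v onC (OnV-mono G (λ {e} p → subst (e ∈_) eq (∪ˡ p)) onA)) onA

  -- The path is what the two cycles leave over: degree 3 - 2 = 1 at `u` and `w`, and no contact
  -- with the cycles elsewhere. If it fell apart, each piece would contain `u` or `w`, and then
  -- exactly one of them, against parity.
  loose-handcuff : ∀ {S u w C₁ C₂} → ConnectedES G S → u ≢ w → deg G S u ≡ 3 → deg G S w ≡ 3 →
    (∀ v → v ≢ u → v ≢ w → (deg G S v ≡ 0) ⊎ (deg G S v ≡ 2)) → C₁ ⊆ S → C₂ ⊆ S → Cycle G C₁ → Cycle G C₂ →
    VertexDisjoint G C₁ C₂ → OnV G C₁ u → OnV G C₂ w → LooseHandcuff G C₁ C₂ S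
  loose-handcuff {S} {u} {w} {C₁} {C₂} con u≢w du dw dv sub₁ sub₂ cy₁@(ne₁ , _ , d₁) cy₂@(ne₂ , _ , d₂) vd u₁ w₂ =
    cy₁ , cy₂ , vd , P , u , w ,
    (u≢w , (proj₁ (pos-OnV G (subst (0 <_) (sym dPu) (s≤s z≤n))) , proj₁ (proj₂ (pos-OnV G (subst (0 <_) (sym dPu) (s≤s z≤n))))) ,
      conP , dPu , dPw , dPv) ,
    u₁ , w₂ , only₁ , only₂ , ⊆-antisym (x∈p∪q⁺ ∘ split-─) (∪-lub C⊆S ─⁻ˡ)
    where
    C = C₁ ∪ C₂
    P = S ─ C
    C⊆S : C ⊆ S
    C⊆S = ∪-lub sub₁ sub₂
    disj : Disjoint C₁ C₂
    disj e p q = vd _ (e , p , inj₁ refl) (e , q , inj₁ refl)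
    sumd : ∀ v → deg G S v ≡ (deg G C₁ v + deg G C₂ v) + deg G P v
    sumd v = trans (deg-─ G C⊆S v) (cong (_+ deg G P v) (deg-⊎ G {C} {C₁} {C₂} ∪⁻ ∪ˡ ∪ʳ disj v))
    dPu : deg G P u ≡ 1
    dPu = +-cancelˡ-≡ 2 _ _ (trans (cong (_+ deg G P u) (sym (cong₂ _+_ (cycle-deg G cy₁ u₁) (¬OnV-zero G (vd u u₁)))))
            (trans (sym (sumd u)) du))
    dPw : deg G P w ≡ 1
    dPw = +-cancelˡ-≡ 2 _ _ (trans (cong (_+ deg G P w) (sym (cong₂ _+_ (¬OnV-zero G (λ p → vd w p w₂)) (cycle-deg G cy₂ w₂))))
            (trans (sym (sumd w)) dw))
    arith₂ : ∀ b s d → (s ≡ 0) ⊎ (s ≡ 2) → s ≡ (2 + b) + d → d ≡ 0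
    arith₂ b _ zero    _           _ = refl
    arith₂ b _ (suc d) (inj₁ refl) ()
    arith₂ b _ (suc d) (inj₂ refl) q = contradiction (trans (suc-injective (suc-injective q)) (+-suc b d)) λ ()
    arith : ∀ a b s d → (a ≡ 2) ⊎ (b ≡ 2) → (s ≡ 0) ⊎ (s ≡ 2) → s ≡ (a + b) + d → d ≡ 0
    arith a b s d (inj₁ refl) h q = arith₂ b s d h q
    arith a b s d (inj₂ refl) h q = arith₂ a s d h (trans q (cong (_+ d) (+-comm a 2)))
    dPv : ∀ v → v ≢ u → v ≢ w → (deg G P v ≡ 0) ⊎ (deg G P v ≡ 2)
    dPv v neu new = lem _ _ _ _ (d₁ v) (d₂ v) (dv v neu new) (sumd v)
      where
      lem : ∀ a b s d → (a ≡ 0) ⊎ (a ≡ 2) → (b ≡ 0) ⊎ (b ≡ 2) → (s ≡ 0) ⊎ (s ≡ 2) → s ≡ (a + b) + d → (d ≡ 0) ⊎ (d ≡ 2)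
      lem a b s d (inj₂ p) _ h q = inj₁ (arith a b s d (inj₁ p) h q)
      lem a b s d (inj₁ _) (inj₂ p) h q = inj₁ (arith a b s d (inj₂ p) h q)
      lem _ _ _ d (inj₁ refl) (inj₁ refl) (inj₁ h) q = inj₁ (trans (sym q) h)
      lem _ _ _ d (inj₁ refl) (inj₁ refl) (inj₂ h) q = inj₂ (trans (sym q) h)
    only₁ : ∀ v → OnV G P v → OnV G C₁ v → v ≡ u
    only₁ v onP on₁ with v ≟ u | v ≟ w
    ... | yes p | _ = p
    ... | no _ | yes refl = ⊥-elim (vd v on₁ w₂)
    ... | no p | no q = ⊥-elim (onV-deg (arith _ _ _ _ (inj₁ (cycle-deg G cy₁ on₁)) (dv v p q) (sumd v)) onP)
    only₂ : ∀ v → OnV G P v → OnV G C₂ v → v ≡ w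
    only₂ v onP on₂ with v ≟ u | v ≟ w
    ... | _ | yes p = p
    ... | yes refl | no _ = ⊥-elim (vd v u₁ on₂)
    ... | no p | no q = ⊥-elim (onV-deg (arith _ _ _ _ (inj₂ (cycle-deg G cy₂ on₂)) (dv v p q) (sumd v)) onP)
    -- A part of the path containing u but not w would have exactly one vertex of odd degree.
    odd-part : ∀ A B → A ∪ B ≡ P → Disjoint A B → ¬ (∃[ v ] (OnV G A v × OnV G B v)) → OnV G A u → OnV G B w → False
    odd-part A B eq dis un uA wB = contradiction (trans (sym odd) (trans (cong parity (∑-deg G A)) even)) λ ()
      where
      even : parity (∣ A ∣ + ∣ A ∣) ≡ false
      even = trans (parity-+ ∣ A ∣ ∣ A ∣) (Boolₚ.xor-same (parity ∣ A ∣))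
      sumP : ∀ v → deg G P v ≡ deg G A v + deg G B v
      sumP = deg-⊎ G {P} {A} {B} (λ {e} p → ∪⁻ (subst (e ∈_) (sym eq) p)) (λ {e} p → subst (e ∈_) eq (∪ˡ p)) (λ {e} p → subst (e ∈_) eq (∪ʳ p)) dis
      alone : ∀ v → OnV G A v → deg G A v ≡ deg G P v
      alone v p = sym (trans (sumP v) (trans (cong (deg G A v +_) (¬OnV-zero G (λ q → un (v , p , q)))) (+-identityʳ _)))
      odd : parity (∑ (deg G A)) ≡ true
      odd = parity-odd-∑ u (cong parity (trans (alone u uA) dPu)) rest
        where
        rest : ∀ v → v ≢ u → parity (deg G A v) ≡ false
        rest v ne with onV? G A v | v ≟ w
        ... | no nA | _ = cong parity (¬OnV-zero G nA)
        ... | yes p | yes refl = ⊥-elim (un (v , p , wB))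
        ... | yes p | no q = [ (λ z → cong parity (trans (alone v p) z)) , (λ z → cong parity (trans (alone v p) z)) ]′ (dPv v ne q)
    conP : ConnectedES G P
    conP A B eq dis neA neB with any? (λ v → onV? G A v ×-dec onV? G B v)
    ... | yes p = p
    ... | no un = ⊥-elim (clash (hook A B eq dis neA un) (hook B A eq' dis' neB un'))
      where
      eq' = trans (∪-comm B A) eq
      dis' : Disjoint B A
      dis' e p q = dis e q p
      un' : ¬ (∃[ v ] (OnV G B v × OnV G A v))
      un' (v , p , q) = un (v , q , p)
      hook : ∀ A B → A ∪ B ≡ P → Disjoint A B → Nonempty A → ¬ (∃[ v ] (OnV G A v × OnV G B v)) → OnV G A u ⊎ OnV G A w
      hook A B eq dis neA un with hooked con C⊆S (proj₁ ne₁ , ∪ˡ (proj₂ ne₁)) eq dis neA un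
      ... | v , onA , onC with OnV-split ∪⁻ onC
      ...   | inj₁ on₁ = inj₁ (subst (OnV G A) (only₁ v (OnV-mono G (λ {e} p → subst (e ∈_) eq (∪ˡ p)) onA) on₁) onA)
      ...   | inj₂ on₂ = inj₂ (subst (OnV G A) (only₂ v (OnV-mono G (λ {e} p → subst (e ∈_) eq (∪ˡ p)) onA) on₂) onA)
      clash : OnV G A u ⊎ OnV G A w → OnV G B u ⊎ OnV G B w → False
      clash (inj₁ p) (inj₁ q) = un (u , p , q)
      clash (inj₂ p) (inj₂ q) = un (w , p , q)
      clash (inj₁ p) (inj₂ q) = odd-part A B eq dis un p q
      clash (inj₂ p) (inj₁ q) = odd-part B A eq' dis' un' q p

module _ {n m : ℕ} (G : Graph n m) (B L F : Subset m → Bool) (qb : QuasiBiased G B L F) where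
  open QuasiBiased qb

  -- Disjoint cycles cannot come one from L and one from F. Two cycles of L form a circuit without
  -- the path, two cycles of F with it.
  disjoint-unbalanced⇒circuit : ∀ {C₁ C₂ S} → LooseHandcuff G C₁ C₂ S → B C₁ ≡ false → B C₂ ≡ false →
                                ∃[ C ] (C ⊆ S × FrameCircuit G B L F C)
  disjoint-unbalanced⇒circuit {C₁} {C₂} {S} h@(cy₁ , cy₂ , vd , P , _ , _ , _ , _ , _ , _ , _ , S≡) b₁ b₂
    with covers C₁ cy₁ | covers C₂ cy₂
  ... | inj₁ p | _ = contradiction (trans (sym p) b₁) λ ()
  ... | inj₂ _ | inj₁ p = contradiction (trans (sym p) b₂) λ ()
  ... | inj₂ (inj₁ l₁) | inj₂ (inj₁ l₂) = C₁ ∪ C₂ , (λ {e} p → subst (e ∈_) (sym S≡) (∪ˡ p)) ,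
          inj₂ (inj₂ (inj₂ (inj₁ (C₁ , C₂ , l₁ , l₂ , cy₁ , cy₂ , vd , refl))))
  ... | inj₂ (inj₂ f₁) | inj₂ (inj₂ f₂) = S , id , inj₂ (inj₂ (inj₂ (inj₂ (C₁ , C₂ , h , f₁ , f₂))))
  ... | inj₂ (inj₁ l₁) | inj₂ (inj₂ f₂) = let v , p , q = L-meets-F C₁ C₂ l₁ f₂ in ⊥-elim (vd v p q)
  ... | inj₂ (inj₂ f₁) | inj₂ (inj₁ l₂) = let v , p , q = L-meets-F C₂ C₁ l₂ f₁ in ⊥-elim (vd v q p)

  -- A minimal set with more edges than vertices is a theta or a handcuff.
  module MinimalCircuit (S : Subset m) (lt : vcount G S < ∣ S ∣) (mn : ∀ R → R ⊆ S → vcount G R < ∣ R ∣ → S ⊆ R)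
           (unbalanced : ∀ C → C ⊆ S → B C ≡ false) where

    Result = ∃[ C ] (C ⊆ S × FrameCircuit G B L F C)

    ne : Nonempty S
    ne = card⇒nonempty (≤-trans (s≤s z≤n) lt)

    full : ∀ {R e} → R ⊆ S → e ∈ S → e ∉ R → ∣ R ∣ ≤ vcount G R
    full {R} {e} sub e∈S e∉R = ≮⇒≥ λ lt → e∉R (mn R sub lt e∈S)

    exact : ∣ S ∣ ≡ suc (vcount G S)
    exact = ≤-antisym (≤-trans (≤-reflexive (card-─ (proj₂ ne)))
                        (s≤s (≤-trans (full ─⁻ˡ (proj₂ ne) ─-∌) (vcount-mono G (S ─ ⁅ proj₁ ne ⁆) S ─⁻ˡ)))) lt

    no-leaf : ∀ v → deg G S v ≢ 1
    no-leaf v d1 = let e , e∈S , _ , less = leaf-edge G S d1 in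
      <-irrefl refl (≤-trans (s≤s (≤-trans (≤-reflexive (suc-injective (trans (sym exact) (card-─ e∈S)))) (full ─⁻ˡ e∈S ─-∌))) less)

    -- By minimality there is exactly one edge more than vertices. As no degree is 1, this leaves
    -- two units of degree above 2 per vertex, to be placed by `∑-excess₂`.
    total : ∑ (deg G S) ≡ 2 + ∑ (λ v → sgn (deg G S v) + sgn (deg G S v))
    total = trans (∑-deg G S) (trans (cong₂ _+_ exact exact) (cong suc (trans (+-suc _ _) (cong suc (sym (double G (λ v → sgn (deg G S v))))))))

    con : ConnectedES G S
    con A C refl dis (a , a∈) (c , c∈) = decidable-stable (any? (λ v → onV? G A v ×-dec onV? G C v))
          λ none → <-irrefl refl (begin-strict
            ∣ A ∪ C ∣                ≡⟨ card-∪ dis ⟩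
            ∣ A ∣ + ∣ C ∣            ≤⟨ +-mono-≤ (full ∪ˡ (∪ʳ c∈) (λ q → dis c q c∈)) (full ∪ʳ (∪ˡ a∈) (λ q → dis a a∈ q)) ⟩
            vcount G A + vcount G C  ≤⟨ vcount-⊎ G ∪ˡ ∪ʳ (λ v p q → none (v , p , q)) ⟩
            vcount G (A ∪ C)         <⟨ lt ⟩
            ∣ A ∪ C ∣                ∎)
      where open ≤-Reasoning

    even : ∀ d → d ≡ sgn d + sgn d → (d ≡ 0) ⊎ (d ≡ 2)
    even zero    _ = inj₁ refl
    even (suc d) e = inj₂ e

    four : ∀ d → d ≡ 2 + (sgn d + sgn d) → d ≡ 4
    four (suc d) e = e

    three : ∀ d → d ≡ suc (sgn d + sgn d) → d ≡ 1 ⊎ d ≡ 3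
    three (suc d) e = inj₂ e

    3∶ : ∀ v → deg G S v ≡ suc (sgn (deg G S v) + sgn (deg G S v)) → deg G S v ≡ 3
    3∶ v e = [ (λ d1 → ⊥-elim (no-leaf v d1)) , id ]′ (three _ e)

    -- Without `e` the two parts together have as many edges as `S` has vertices, and neither part
    -- has more edges than vertices. So each has at least as many edges as vertices and contains a
    -- cycle.
    minimal-with-bridge : ∀ {u w} → u ≢ w → deg G S u ≡ 3 → deg G S w ≡ 3 →
      (∀ v → v ≢ u → v ≢ w → (deg G S v ≡ 0) ⊎ (deg G S v ≡ 2)) → ∀ e → e ∈ S → Split G (S ─ ⁅ e ⁆) → Result
    minimal-with-bridge {u} {w} u≢w du dw dv e e∈S (A , A⊆ , neA , neC , un) =
      orient (cycle-in A D (─⁻ˡ ∘ A⊆) (─⁻ˡ ∘ ─⁻ˡ) neA (λ p → ─-∌ (─⁻ˡ p)) sumA un)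
             (cycle-in D A (─⁻ˡ ∘ ─⁻ˡ) (─⁻ˡ ∘ A⊆) neC (λ p → ─-∌ (A⊆ p)) sumD (λ v p q → un v q p))
      where
      D = S ─ ⁅ e ⁆ ─ A
      sumA : vcount G S ≡ ∣ A ∣ + ∣ D ∣
      sumA = trans (suc-injective (trans (sym exact) (card-─ e∈S))) (card-⊎ {A = A} {D} split-─ A⊆ ─⁻ˡ (λ f p q → ─⁻ʳ q p))
      sumD : vcount G S ≡ ∣ D ∣ + ∣ A ∣
      sumD = trans sumA (+-comm ∣ A ∣ ∣ D ∣)
      cycle-in : ∀ A D → A ⊆ S → D ⊆ S → Nonempty A → e ∉ D → vcount G S ≡ ∣ A ∣ + ∣ D ∣ →
                 (∀ v → OnV G A v → OnV G D v → False) → ∃[ Z ] (Z ⊆ A × Cycle G Z)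
      cycle-in A D A⊆S D⊆S neA e∉D eq un = edges≥vertices⇒cycle G A neA (+-cancelʳ-≤ (vcount G D) _ _ (begin
        vcount G A + vcount G D ≤⟨ vcount-⊎ G A⊆S D⊆S un ⟩
        vcount G S              ≡⟨ eq ⟩
        ∣ A ∣ + ∣ D ∣           ≤⟨ +-monoʳ-≤ ∣ A ∣ (full D⊆S e∈S e∉D) ⟩
        ∣ A ∣ + vcount G D      ∎))
        where open ≤-Reasoning
      -- A cycle exhausts the degree at a vertex of degree 2, so it is attached to the rest of `S`
      -- at `u` or `w`.
      branch : ∀ C C' → C ⊆ S → C' ⊆ S → Cycle G C → Cycle G C' → VertexDisjoint G C C' → OnV G C u ⊎ OnV G C w
      branch C C' sub sub' cy@(neC , _) ((c , c∈) , _) vd =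
        go (connected-rest G con sub neC (c , ─⁺ (sub' c∈) (λ p → vd _ (c , p , inj₁ refl) (c , c∈ , inj₁ refl))))
        where
        lem : ∀ a s d → (s ≡ 0) ⊎ (s ≡ 2) → a ≡ 2 → 0 < d → s ≡ a + d → False
        lem _ _ (suc d) (inj₁ refl) refl _ ()
        lem _ _ (suc d) (inj₂ refl) refl _ ()
        go' : ∀ v → OnV G C v → OnV G (S ─ C) v → Dec (v ≡ u) → Dec (v ≡ w) → OnV G C u ⊎ OnV G C w
        go' v onC onR (yes refl) _ = inj₁ onC
        go' v onC onR (no _) (yes refl) = inj₂ onC
        go' v onC onR (no p) (no q) = ⊥-elim (lem _ _ _ (dv v p q) (cycle-deg G cy onC) (OnV-pos G onR) (deg-─ G sub v))
        go : ∃[ v ] (OnV G C v × OnV G (S ─ C) v) → OnV G C u ⊎ OnV G C w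
        go (v , onC , onR) = go' v onC onR (v ≟ u) (v ≟ w)
      orient : ∃[ Z ] (Z ⊆ A × Cycle G Z) → ∃[ Z ] (Z ⊆ D × Cycle G Z) → Result
      orient (C₁ , s₁ , cy₁) (C₂ , s₂ , cy₂) = place (branch C₁ C₂ sub₁ sub₂ cy₁ cy₂ vd) (branch C₂ C₁ sub₂ sub₁ cy₂ cy₁ (λ v p q → vd v q p))
        where
        sub₁ : C₁ ⊆ S
        sub₁ = ─⁻ˡ ∘ A⊆ ∘ s₁
        sub₂ : C₂ ⊆ S
        sub₂ = ─⁻ˡ ∘ ─⁻ˡ ∘ s₂
        vd : VertexDisjoint G C₁ C₂
        vd v p q = un v (OnV-mono G s₁ p) (OnV-mono G s₂ q)
        place : OnV G C₁ u ⊎ OnV G C₁ w → OnV G C₂ u ⊎ OnV G C₂ w → Result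
        place (inj₁ p) (inj₁ q) = ⊥-elim (vd u p q)
        place (inj₂ p) (inj₂ q) = ⊥-elim (vd w p q)
        place (inj₁ p) (inj₂ q) = disjoint-unbalanced⇒circuit
          (loose-handcuff G con u≢w du dw dv sub₁ sub₂ cy₁ cy₂ vd p q)
          (unbalanced C₁ sub₁) (unbalanced C₂ sub₂)
        place (inj₂ p) (inj₁ q) = disjoint-unbalanced⇒circuit
          (loose-handcuff G con (u≢w ∘ sym) dw du (λ v a b → dv v b a) sub₁ sub₂ cy₁ cy₂ vd p q)
          (unbalanced C₁ sub₁) (unbalanced C₂ sub₂)

    minimal-circuit : Result
    minimal-circuit = shape (∑-excess₂ {f = deg G S} {g = λ v → sgn (deg G S v) + sgn (deg G S v)}
                              (λ v → deg≢1⇒2≤ G _ (no-leaf v)) total)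
      where
      Shape = (∃[ u ] (deg G S u ≡ 2 + (sgn (deg G S u) + sgn (deg G S u)) ×
                 (∀ v → v ≢ u → deg G S v ≡ sgn (deg G S v) + sgn (deg G S v)))) ⊎
              (∃[ u ] ∃[ w ] (u ≢ w × deg G S u ≡ suc (sgn (deg G S u) + sgn (deg G S u)) × deg G S w ≡ suc (sgn (deg G S w) + sgn (deg G S w)) ×
                 (∀ v → v ≢ u → v ≢ w → deg G S v ≡ sgn (deg G S v) + sgn (deg G S v))))
      tight : ∀ {u} → deg G S u ≡ 4 → (∀ v → v ≢ u → (deg G S v ≡ 0) ⊎ (deg G S v ≡ 2)) → ∃[ C ] (C ⊆ S × Cycle G C) → Result
      tight du dv (C , C⊆S , cy) = S , id , inj₂ (inj₂ (inj₁ (C , S ─ C ,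
            tight-handcuff G con du dv C⊆S cy , unbalanced C C⊆S , unbalanced (S ─ C) ─⁻ˡ)))
      bridge : ∀ {u w} → u ≢ w → deg G S u ≡ 3 → deg G S w ≡ 3 → (∀ v → v ≢ u → v ≢ w → (deg G S v ≡ 0) ⊎ (deg G S v ≡ 2)) →
               Dec (∃[ e ] (e ∈ S × ¬ ConnectedES G (S ─ ⁅ e ⁆))) → Result
      bridge u≢w du dw dv (no none) = S , id , inj₂ (inj₁ ((con ,
            (λ e e∈S → decidable-stable (connected? G (S ─ ⁅ e ⁆)) (λ nc → none (e , e∈S , nc))) ,
            _ , _ , u≢w , du , dw , dv) , λ C cy → unbalanced C))
      bridge u≢w du dw dv (yes (e , e∈S , nc)) =
        [ minimal-with-bridge u≢w du dw dv e e∈S , (λ c → ⊥-elim (nc c)) ]′ (split? G (S ─ ⁅ e ⁆))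
      shape : Shape → Result
      shape (inj₁ (u , du , dv)) = tight (four _ du) (λ v n → even _ (dv v n)) (edges≥vertices⇒cycle G S ne (<⇒≤ lt))
      shape (inj₂ (u , w , u≢w , du , dw , dv)) = bridge u≢w (3∶ u du) (3∶ w dw) (λ v p q → even _ (dv v p q))
        (any? (λ e → (e ∈? S) ×-dec ¬? (connected? G (S ─ ⁅ e ⁆))))

  abstract
    -- This bounds the rank by the number of vertices, and also yields the circuits that lift cycles
    -- of a quotient. A balanced cycle in the minimal set is a circuit at once, so the degree
    -- analysis may assume that there is none.
    edges>vertices⇒circuit : ∀ S → vcount G S < ∣ S ∣ → ∃[ C ] (C ⊆ S × FrameCircuit G B L F C)
    edges>vertices⇒circuit S₀ lt₀ = go (minimal (λ R → vcount G R <? ∣ R ∣) S₀ lt₀)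
      where
      go' : ∀ S → S ⊆ S₀ → vcount G S < ∣ S ∣ → (∀ R → R ⊆ S → vcount G R < ∣ R ∣ → S ⊆ R) →
            Dec (∃[ C ] (C ⊆ S × B C ≡ true)) → ∃[ C ] (C ⊆ S₀ × FrameCircuit G B L F C)
      go' S S⊆S₀ lt mn (yes (C , C⊆S , b)) = C , S⊆S₀ ∘ C⊆S , inj₁ (B-cycle C b , b)
      go' S S⊆S₀ lt mn (no unbal) = let C , sub , fc = MinimalCircuit.minimal-circuit S lt mn unbalanced in C , S⊆S₀ ∘ sub , fc
        where
        unbalanced : ∀ C → C ⊆ S → B C ≡ false
        unbalanced C sub = Boolₚ.¬-not (λ b → unbal (C , sub , b))
      go : ∃[ S ] (S ⊆ S₀ × vcount G S < ∣ S ∣ × (∀ R → R ⊆ S → vcount G R < ∣ R ∣ → S ⊆ R)) →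
           ∃[ C ] (C ⊆ S₀ × FrameCircuit G B L F C)
      go (S , S⊆S₀ , lt , mn) = go' S S⊆S₀ lt mn (anySubset? (λ C → (C ⊆? S) ×-dec (B C Boolₚ.≟ true)))

-- Collapsing a vertex set

vertices : ∀ {n m} → Graph n m → Subset m → Subset n
vertices G S = ⟪ (λ v → does (onV? G S v)) ⟫

module _ {n m : ℕ} (G : Graph n m) where

  vertices⁺ : ∀ {S v} → OnV G S v → v ∈ vertices G S
  vertices⁺ {S} {v} p = ⟪⟫⁺ (dec-true (onV? G S v) p)

  vertices⁻ : ∀ {S v} → v ∈ vertices G S → OnV G S v
  vertices⁻ {S} {v} p = lem (onV? G S v) (⟪⟫⁻ {f = λ v → does (onV? G S v)} p)
    where
    lem : ∀ {A : Set} (d : Dec A) → does d ≡ true → A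
    lem (yes a) _ = a

  card-vertices : ∀ S → ∣ vertices G S ∣ ≡ vcount G S
  card-vertices S = trans (card (vertices G S)) (∑-cong λ v → pt v (onV? G S v))
    where
    pt : ∀ v → Dec (OnV G S v) → χ (vertices G S) v ≡ sgn (deg G S v)
    pt v (yes p) = trans (χ-∈ (vertices⁺ p)) (sym (sgn-pos (OnV-pos G p)))
    pt v (no p) = trans (χ-∉ (p ∘ vertices⁻)) (cong sgn (sym (¬OnV-zero G p)))

  abstract
    loop-cycle : ∀ {S e} → e ∈ S → end₁ G e ≡ end₂ G e → ∃[ Z ] (Z ⊆ S × Cycle G Z)
    loop-cycle {S} {e} e∈S lp = let Z , sub , cy = no-leaves⇒cycle G (end₁ G e) ⁅ e ⁆ (e , x∈⁅x⁆ e) (λ v _ → leafless v)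
                                in Z , ⁅⁆⊆ e∈S ∘ sub , cy
      where
      leafless : ∀ v → deg G ⁅ e ⁆ v ≢ 1
      leafless v d1 = let f , f∈ , _ , nl , _ = deg-one G {⁅ e ⁆} d1 in nl (subst (λ g → end₁ G g ≡ end₂ G g) (sym (⁅⁆⁻ f∈)) lp)

  deg-singleton : ∀ {v e} → IsEnd G v e → end₁ G e ≢ end₂ G e → deg G ⁅ e ⁆ v ≡ 1
  deg-singleton {v} {e} t nl = trans (deg-∑ G ⁅ e ⁆ v) (trans (∑-single (term G ⁅ e ⁆ v) e (λ f ne → term-∉ G {⁅ e ⁆} (ne ∘ ⁅⁆⁻)))
    (trans (term-∈ G (x∈⁅x⁆ e)) (δδ t)))
    where
    δδ : IsEnd G v e → δ (end₁ G e) v + δ (end₂ G e) v ≡ 1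
    δδ (inj₁ refl) = cong₂ _+_ (δ-refl (end₁ G e)) (δ-≢ {p = end₂ G e} {end₁ G e} (nl ∘ sym))
    δδ (inj₂ refl) = cong₂ _+_ (δ-≢ {p = end₁ G e} {end₂ G e} nl) (δ-refl (end₂ G e))

  ends-of : ∀ {d q p e} → IsEnd G d e → IsEnd G q e → q ≢ d → IsEnd G p e → p ≡ d ⊎ p ≡ q
  ends-of (inj₁ refl) (inj₁ refl) ne _ = ⊥-elim (ne refl)
  ends-of (inj₂ refl) (inj₂ refl) ne _ = ⊥-elim (ne refl)
  ends-of (inj₁ refl) (inj₂ refl) ne (inj₁ refl) = inj₁ refl
  ends-of (inj₁ refl) (inj₂ refl) ne (inj₂ refl) = inj₂ refl
  ends-of (inj₂ refl) (inj₁ refl) ne (inj₁ refl) = inj₂ refl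
  ends-of (inj₂ refl) (inj₁ refl) ne (inj₂ refl) = inj₁ refl

  ends-same : ∀ {c d q e} → IsEnd G d e → IsEnd G q e → q ≢ d → c d ≡ c q → Same G c e
  ends-same (inj₁ refl) (inj₁ refl) ne _ = ⊥-elim (ne refl)
  ends-same (inj₂ refl) (inj₂ refl) ne _ = ⊥-elim (ne refl)
  ends-same (inj₁ refl) (inj₂ refl) ne eq = eq
  ends-same (inj₂ refl) (inj₁ refl) ne eq = sym eq

  crosses-point : ∀ {u e} → ¬ Same G (point G u) e → ∃[ q ] (IsEnd G u e × IsEnd G q e × q ≢ u)
  crosses-point {u} {e} ns = lem (end₁ G e ≟ u) (end₂ G e ≟ u)
    where
    lem : Dec (end₁ G e ≡ u) → Dec (end₂ G e ≡ u) → ∃[ q ] (IsEnd G u e × IsEnd G q e × q ≢ u)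
    lem (yes p) (yes q) = ⊥-elim (ns (cong (point G u) (trans p (sym q))))
    lem (yes p) (no q) = end₂ G e , inj₁ p , inj₂ refl , q
    lem (no p) (yes q) = end₁ G e , inj₂ q , inj₁ refl , p
    lem (no p) (no q) = ⊥-elim (ns (point-untouched G [ p , q ]′))

  point-crosses : ∀ {u q e} → IsEnd G u e → IsEnd G q e → q ≢ u → ¬ Same G (point G u) e
  point-crosses {u} {q} {e} tu tq ne s = contradiction (trans (sym (point-at G u)) (trans (same-ends G {point G u} {e} s tu tq) (point-off G ne))) λ ()

  cycle-two-edges : ∀ {Q d} → (∀ e → end₁ G e ≢ end₂ G e) → Cycle G Q → OnV G Q d →
    ∃[ g ] ∃[ h ] ∃[ p ] ∃[ q ] (g ≢ h × (g ∈ Q × IsEnd G d g × IsEnd G p g × p ≢ d) × (h ∈ Q × IsEnd G d h × IsEnd G q h × q ≢ d))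
  cycle-two-edges {Q} {d} nl cy on@(g , g∈ , tg) = go (pos-OnV G {Q ─ ⁅ g ⁆} (subst (0 <_) (sym d1) (s≤s z≤n))) (otherEnd G tg (nl g))
    where
    d1 : deg G (Q ─ ⁅ g ⁆) d ≡ 1
    d1 = +-cancelˡ-≡ 1 _ _ (trans (cong (_+ deg G (Q ─ ⁅ g ⁆) d) (sym (deg-singleton tg (nl g))))
           (trans (sym (deg-─ G {Q} {⁅ g ⁆} (⁅⁆⊆ g∈) d)) (cycle-deg G cy on)))
    go : OnV G (Q ─ ⁅ g ⁆) d → ∃[ p ] (IsEnd G p g × p ≢ d) → _
    go (h , h∈ , th) (p , tp , p≢d) = let q , tq , q≢d = otherEnd G th (nl h) in
      g , h , p , q , (λ { refl → ─-∌ h∈ }) , (g∈ , tg , tp , p≢d) , (─⁻ˡ h∈ , th , tq , q≢d)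

  -- Two parallel edges form a leafless subset of the cycle, hence all of it.
  digon-vertices : ∀ {Q d q g h} → Cycle G Q → g ∈ Q → h ∈ Q → g ≢ h → q ≢ d → IsEnd G d g → IsEnd G q g →
                   IsEnd G d h → IsEnd G q h → (∀ {e} → e ∈ Q → e ≡ g ⊎ e ≡ h) × (∀ {v} → OnV G Q v → v ≡ d ⊎ v ≡ q)
  digon-vertices {Q} {d} {q} {g} {h} cy g∈ h∈ g≢h q≢d dg qg dh qh = which , λ { (e , e∈ , t) → vert (which e∈) t }
    where
    R : Subset m
    R = ⁅ g ⁆ ∪ ⁅ h ⁆
    leafless : ∀ v → deg G R v ≢ 1
    leafless v d1 = go (deg-one G {R} d1)
      where
      go : ∃[ e ] (e ∈ R × IsEnd G v e × end₁ G e ≢ end₂ G e × (∀ f → f ∈ R → f ≢ e → ¬ IsEnd G v f)) → False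
      go (e , e∈ , t , _ , uniq) = [ (λ p → fromg (⁅⁆⁻ p)) , (λ p → fromh (⁅⁆⁻ p)) ]′ (∪⁻ e∈)
        where
        fromg : e ≡ g → False
        fromg refl = uniq h (∪ʳ (x∈⁅x⁆ h)) (g≢h ∘ sym) ([ (λ { refl → dh }) , (λ { refl → qh }) ]′ (ends-of dg qg q≢d t))
        fromh : e ≡ h → False
        fromh refl = uniq g (∪ˡ (x∈⁅x⁆ g)) g≢h ([ (λ { refl → dg }) , (λ { refl → qg }) ]′ (ends-of dh qh q≢d t))
    which : ∀ {e} → e ∈ Q → e ≡ g ⊎ e ≡ h
    which e∈ = [ inj₁ ∘ ⁅⁆⁻ , inj₂ ∘ ⁅⁆⁻ ]′ (∪⁻ (leafless-in-cycle G cy (∪-lub (⁅⁆⊆ g∈) (⁅⁆⊆ h∈)) (g , ∪ˡ (x∈⁅x⁆ g)) leafless e∈))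
    vert : ∀ {e v} → e ≡ g ⊎ e ≡ h → IsEnd G v e → v ≡ d ⊎ v ≡ q
    vert (inj₁ refl) t = ends-of dg qg q≢d t
    vert (inj₂ refl) t = ends-of dh qh q≢d t

  cycle-proper : ∀ {Z e} → Cycle G Z → e ∈ Z → Acyclic G (Z ─ ⁅ e ⁆)
  cycle-proper {Z} {e} cy e∈Z R sub cr = ─-∌ (sub (subst (e ∈_) (sym (cycle-minimal G cy cr (─⁻ˡ ∘ sub))) e∈Z))

module _ {n m : ℕ} (G : Graph n m) (U : Subset n) (r : Fin n) where

  proj : Fin n → Fin n
  proj v = if lookup U v then r else v

  -- Vertex and edge types stay the same, so edge sets of the graph and of the quotient need no
  -- translation. With `r` in `U`, the edges inside `U` become loops at `r`, and the other vertices
  -- of `U` become isolated.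
  collapse : Graph n m
  collapse = record { end₁ = proj ∘ end₁ G ; end₂ = proj ∘ end₂ G }

  proj-∈ : ∀ {v} → v ∈ U → proj v ≡ r
  proj-∈ p rewrite ∈⇒lookup p = refl

  proj-∉ : ∀ {v} → v ∉ U → proj v ≡ v
  proj-∉ p rewrite ∉⇒lookup p = refl

  collapse-isEnd : ∀ {v e} → v ≢ r → IsEnd collapse v e → IsEnd G v e
  collapse-isEnd {v} {e} v≢r = [ inj₁ ∘ back , inj₂ ∘ back ]′
    where
    back : ∀ {p} → proj p ≡ v → p ≡ v
    back {p} eq with p ∈? U
    ... | yes q = ⊥-elim (v≢r (trans (sym eq) (proj-∈ q)))
    ... | no q = trans (sym (proj-∉ q)) eq

  isEnd-collapse : ∀ {v e} → IsEnd G v e → IsEnd collapse (proj v) e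
  isEnd-collapse (inj₁ refl) = inj₁ refl
  isEnd-collapse (inj₂ refl) = inj₂ refl

  module _ (r∈U : r ∈ U) where

    deg-collapse : ∀ {S v} → v ∉ U → deg collapse S v ≡ deg G S v
    deg-collapse {S} {v} v∉U = trans (deg-∑ collapse S v) (trans (∑-cong pt) (sym (deg-∑ G S v)))
      where
      δ-eq : ∀ p → δ (proj p) v ≡ δ p v
      δ-eq p with p ∈? U
      ... | yes q = trans (cong (λ z → δ z v) (proj-∈ q)) (trans (δ-≢ {p = r} {v} (λ { refl → v∉U r∈U })) (sym (δ-≢ {p = p} {v} (λ { refl → v∉U q }))))
      ... | no q = cong (λ z → δ z v) (proj-∉ q)
      pt : ∀ e → term collapse S v e ≡ term G S v e
      pt e = cong (λ z → if lookup S e then z else 0) (cong₂ _+_ (δ-eq (end₁ G e)) (δ-eq (end₂ G e)))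

    collapse-gone : ∀ {v S} → v ∈ U → v ≢ r → ¬ OnV collapse S v
    collapse-gone {v} v∈U v≢r (e , _ , t) = [ lem , lem ]′ t
      where
      lem : ∀ {p} → proj p ≡ v → False
      lem {p} eq with p ∈? U
      ... | yes q = v≢r (trans (sym eq) (proj-∈ q))
      ... | no q = q (subst (_∈ U) (trans (sym eq) (proj-∉ q)) v∈U)

deg-cong : ∀ {n m} (G : Graph n m) S S' v → (∀ e → IsEnd G v e → (e ∈ S → e ∈ S') × (e ∈ S' → e ∈ S)) →
           deg G S v ≡ deg G S' v
deg-cong G S S' v h = trans (deg-∑ G S v) (trans (∑-cong (λ e → pt e (isEnd? G v e) (e ∈? S))) (sym (deg-∑ G S' v)))
  where
  pt : ∀ e → Dec (IsEnd G v e) → Dec (e ∈ S) → term G S v e ≡ term G S' v e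
  pt e (no nt) _ = trans (term-untouched G {S} nt) (sym (term-untouched G {S'} nt))
  pt e (yes t) (yes p) = trans (term-∈ G p) (sym (term-∈ G (proj₁ (h e t) p)))
  pt e (yes t) (no p) = trans (term-∉ G p) (sym (term-∉ G (p ∘ proj₂ (h e t))))

-- Circuits against cuts, and independent sets

module _ {n m : ℕ} (G : Graph n m) (B L F : Subset m → Bool) (qb : QuasiBiased G B L F) where
  open QuasiBiased qb

  FC : Subset m → Set
  FC = FrameCircuit G B L F

  L-unbalanced : ∀ {C} → L C ≡ true → B C ≡ false
  L-unbalanced {C} l = Boolₚ.¬-not (λ b → BL-disj C b l)

  -- The ends of the path of a loose handcuff lie on its cycles. Together with `no-leaves⇒cycle`
  -- this puts a cycle of the graph inside every circuit.
  circuit-leafless : ∀ {C} → FC C → ∀ v → deg G C v ≢ 1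
  circuit-leafless {C} fc v d1 = go fc (pos-OnV G {C} (subst (0 <_) (sym d1) (s≤s z≤n)))
    where
    big : ∀ Z → Z ⊆ C → deg G Z v ≡ 2 → False
    big Z sub d2 = contradiction (subst₂ _≤_ d2 d1 (deg-mono G Z C sub v)) λ { (s≤s ()) }
    on-cycle : ∀ Z → Z ⊆ C → Cycle G Z → OnV G Z v → False
    on-cycle Z sub cy on = big Z sub (cycle-deg G cy on)
    go : FC C → OnV G C v → False
    go (inj₁ (cy , _)) on = on-cycle C id cy on
    go (inj₂ (inj₁ ((_ , _ , u , w , _ , du , dw , dv) , _))) on = lem (v ≟ u) (v ≟ w)
      where
      lem : Dec (v ≡ u) → Dec (v ≡ w) → False
      lem (yes refl) _ = contradiction (trans (sym d1) du) λ ()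
      lem (no _) (yes refl) = contradiction (trans (sym d1) dw) λ ()
      lem (no p) (no q) = [ (λ z → contradiction (trans (sym d1) z) λ ()) , (λ z → contradiction (trans (sym d1) z) λ ()) ]′ (dv v p q)
    go (inj₂ (inj₂ (inj₁ (C₁ , C₂ , (cy₁ , cy₂ , _ , refl , _) , _)))) on =
      [ on-cycle C₁ ∪ˡ cy₁ , on-cycle C₂ ∪ʳ cy₂ ]′ (OnV-split G ∪⁻ on)
    go (inj₂ (inj₂ (inj₂ (inj₁ (C₁ , C₂ , _ , _ , cy₁ , cy₂ , _ , refl))))) on =
      [ on-cycle C₁ ∪ˡ cy₁ , on-cycle C₂ ∪ʳ cy₂ ]′ (OnV-split G ∪⁻ on)
    go (inj₂ (inj₂ (inj₂ (inj₂ (C₁ , C₂ , (cy₁ , cy₂ , _ , P , u , w , (_ , _ , _ , _ , _ , dP) , u₁ , w₂ , _ , _ , refl) , _))))) on =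
      [ (λ on' → [ on-cycle C₁ (∪ˡ ∘ ∪ˡ) cy₁ , on-cycle C₂ (∪ˡ ∘ ∪ʳ) cy₂ ]′ (OnV-split G ∪⁻ on')) , (λ onP → lem onP (v ≟ u) (v ≟ w)) ]′ (OnV-split G ∪⁻ on)
      where
      lem : OnV G P v → Dec (v ≡ u) → Dec (v ≡ w) → False
      lem onP (yes refl) _ = on-cycle C₁ (∪ˡ ∘ ∪ˡ) cy₁ u₁
      lem onP (no _) (yes refl) = on-cycle C₂ (∪ˡ ∘ ∪ʳ) cy₂ w₂
      lem onP (no p) (no q) = [ (λ d0 → onV-deg G d0 onP) , big P ∪ʳ ]′ (dP v p q)

  circuit-nonempty : ∀ {C} → FC C → Nonempty C
  circuit-nonempty (inj₁ ((ne , _) , _)) = ne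
  circuit-nonempty {C} (inj₂ (inj₁ ((_ , _ , u , _ , _ , du , _) , _))) =
    let e , e∈ , _ = pos-OnV G {C} (subst (0 <_) (sym du) (s≤s z≤n)) in e , e∈
  circuit-nonempty (inj₂ (inj₂ (inj₁ (C₁ , C₂ , (((e , e∈) , _) , _ , _ , refl , _) , _)))) = e , ∪ˡ e∈
  circuit-nonempty (inj₂ (inj₂ (inj₂ (inj₁ (C₁ , C₂ , _ , _ , ((e , e∈) , _) , _ , _ , refl))))) = e , ∪ˡ e∈
  circuit-nonempty (inj₂ (inj₂ (inj₂ (inj₂ (C₁ , C₂ , (((e , e∈) , _) , _ , _ , _ , _ , _ , _ , _ , _ , _ , _ , refl) , _))))) = e , ∪ˡ (∪ˡ e∈)

  even-union : ∀ {C₁ C₂} → Cycle G C₁ → Cycle G C₂ → Disjoint C₁ C₂ → ∀ v → parity (deg G (C₁ ∪ C₂) v) ≡ false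
  even-union {C₁} {C₂} cy₁ cy₂ dis v = trans (cong parity (deg-⊎ G {C₁ ∪ C₂} {C₁} {C₂} ∪⁻ ∪ˡ ∪ʳ dis v))
    (trans (parity-+ (deg G C₁ v) (deg G C₂ v)) (cong₂ _xor_ (cycle-even G {C₁} cy₁ v) (cycle-even G {C₂} cy₂ v)))

  -- Only an edge on the path of a loose handcuff can be a bridge of a circuit.
  single-crossing⇒loose : ∀ {C c e} → FC C → e ∈ C → NoCross G (C ─ ⁅ e ⁆) c → ¬ Same G c e →
    ∃[ C₁ ] ∃[ C₂ ] (LooseHandcuff G C₁ C₂ C × F C₁ ≡ true × F C₂ ≡ true)
  single-crossing⇒loose {C} {c} {e} fc e∈C nc ns = go fc
    where
    even-absurd : ∀ {A : Set} → (∀ v → parity (deg G C v) ≡ false) → A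
    even-absurd ev = ⊥-elim (ns (crossing-parity G {C} {c} (λ v _ → ev v) e∈C nc))
    go : FC C → ∃[ C₁ ] ∃[ C₂ ] (LooseHandcuff G C₁ C₂ C × F C₁ ≡ true × F C₂ ≡ true)
    go (inj₁ (cy , _)) = even-absurd (cycle-even G {C} cy)
    -- A theta stays connected without `e`, and both ends of `e` are still covered, since an
    -- uncovered one would be a leaf.
    go (inj₂ (inj₁ ((_ , con , _) , _))) = ⊥-elim (ns (one-sided G {C ─ ⁅ e ⁆} {c} (con e e∈C) nc (second (inj₁ refl)) (second (inj₂ refl))))
      where
      second : ∀ {v} → IsEnd G v e → OnV G (C ─ ⁅ e ⁆) v
      second {v} t = decidable-stable (onV? G (C ─ ⁅ e ⁆) v) λ none →
        circuit-leafless fc v (trans (deg-cong G C ⁅ e ⁆ v (λ f tf →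
            (λ f∈ → decidable-stable (f ∈? ⁅ e ⁆) (λ nf → none (f , ─⁺ f∈ nf , tf))) , ⁅⁆⊆ e∈C))
          (deg-singleton G t (λ eq → ns (cong c eq))))
    go (inj₂ (inj₂ (inj₁ (C₁ , C₂ , (cy₁ , cy₂ , dis , refl , _) , _)))) = even-absurd (even-union cy₁ cy₂ dis)
    go (inj₂ (inj₂ (inj₂ (inj₁ (C₁ , C₂ , _ , _ , cy₁ , cy₂ , vd , refl))))) =
      even-absurd (even-union cy₁ cy₂ (λ f p q → vd _ (f , p , inj₁ refl) (f , q , inj₁ refl)))
    go (inj₂ (inj₂ (inj₂ (inj₂ loose)))) = loose

  -- A lone crossing edge lies on the path of a loose handcuff. Its two cycles are in F, so both
  -- meet `Z` and lie on the side of `Z`; on the other side all degrees are then even, against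
  -- `crossing-parity`.
  circuit-crosses-twice : ∀ {C Z c e} → FC C → L Z ≡ true → NoCross G Z c → e ∈ C → NoCross G (C ─ ⁅ e ⁆) c → Same G c e
  circuit-crosses-twice {C} {Z} {c} {e} fc lZ ncZ e∈C nc = decidable-stable (same? G c e) λ ns →
    go ns (single-crossing⇒loose {C} {c} {e} fc e∈C nc ns)
    where
    go : ¬ Same G c e → ∃[ C₁ ] ∃[ C₂ ] (LooseHandcuff G C₁ C₂ C × F C₁ ≡ true × F C₂ ≡ true) → False
    go ns (C₁ , C₂ , (cy₁ , cy₂ , vd , P , u , w , (_ , _ , _ , _ , _ , dP) , u₁ , w₂ , _ , _ , refl) , f₁ , f₂) = side (c v₁) refl
      where
      uncrossed : ∀ D → D ⊆ C → Cycle G D → NoCross G D c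
      uncrossed D sub cy {f} f∈D = lem (f ≟ e)
        where
        rest : ∀ {g} → g ∈ D → g ≢ e → Same G c g
        rest g∈D ne = nc (─-≢ (sub g∈D) ne)
        lem : Dec (f ≡ e) → Same G c f
        lem (no ne) = rest f∈D ne
        lem (yes refl) = cycle-cut G {D} {c} cy f∈D (λ g∈ → rest (─⁻ˡ g∈) (λ { refl → ─-∌ g∈ }))
      nc₁ : NoCross G C₁ c
      nc₁ = uncrossed C₁ (∪ˡ ∘ ∪ˡ) cy₁
      nc₂ : NoCross G C₂ c
      nc₂ = uncrossed C₂ (∪ˡ ∘ ∪ʳ) cy₂
      m₁ = L-meets-F Z C₁ lZ f₁
      m₂ = L-meets-F Z C₂ lZ f₂
      v₁ = proj₁ m₁
      conZ = proj₁ (proj₂ (L-cycle Z lZ))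
      side₁ : ∀ {v} → OnV G C₁ v → c v ≡ c v₁
      side₁ on = one-sided G {C₁} {c} (proj₁ (proj₂ cy₁)) nc₁ on (proj₂ (proj₂ m₁))
      side₂ : ∀ {v} → OnV G C₂ v → c v ≡ c v₁
      side₂ on = trans (one-sided G {C₂} {c} (proj₁ (proj₂ cy₂)) nc₂ on (proj₂ (proj₂ m₂)))
                       (one-sided G {Z} {c} conZ ncZ (proj₁ (proj₂ m₂)) (proj₁ (proj₂ m₁)))
      even : ∀ v → c v ≢ c v₁ → parity (deg G C v) ≡ false
      even v ne = trans (cong parity (deg-cong G C P v λ f t →
                    (λ f∈ → [ (λ q → ⊥-elim ([ (λ p → n₁ (f , p , t)) , (λ p → n₂ (f , p , t)) ]′ (∪⁻ q))) , id ]′ (∪⁻ f∈)) , ∪ʳ))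
                    ([ cong parity , cong parity ]′ (dP v (λ { refl → n₁ u₁ }) (λ { refl → n₂ w₂ })))
        where
        n₁ : ¬ OnV G C₁ v
        n₁ on = ne (side₁ on)
        n₂ : ¬ OnV G C₂ v
        n₂ on = ne (side₂ on)
      -- The cut is complemented if necessary, so that its true side is the one without the two
      -- cycles.
      side : ∀ b → c v₁ ≡ b → False
      side false eq = ns (crossing-parity G {C} {c} (λ v q → even v (λ z → contradiction (trans (sym q) (trans z eq)) λ ())) e∈C nc)
      side true eq = ns (Boolₚ.not-injective (crossing-parity G {C} {not ∘ c}
        (λ v q → even v (λ z → contradiction (trans (sym q) (cong not (trans z eq))) λ ())) e∈C (cong not ∘ nc)))

  -- Theta graphs and handcuffs that are not unions of disjoint cycles have a vertex of degree at least 3.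
  circuit-max-degree-2 : ∀ {C} → FC C → (∀ v → deg G C v ≤ 2) → B C ≡ true ⊎ (∃[ D ] (D ⊆ C × L D ≡ true × D ≢ C))
  circuit-max-degree-2 {C} fc small = go fc
    where
    crowded : ∀ C₁ D v → C₁ ⊆ C → D ⊆ C → Disjoint C₁ D → deg G C₁ v ≡ 2 → OnV G D v → False
    crowded C₁ D v s₁ s₂ dis d2 on = <⇒≱ (≤-trans (+-monoʳ-≤ 2 (OnV-pos G on))
      (≤-reflexive (trans (cong (_+ deg G D v) (sym d2)) (sym (deg-⊎ G {C₁ ∪ D} {C₁} {D} ∪⁻ ∪ˡ ∪ʳ dis v)))))
      (≤-trans (deg-mono G (C₁ ∪ D) C (∪-lub s₁ s₂) v) (small v))
    go : FC C → B C ≡ true ⊎ (∃[ D ] (D ⊆ C × L D ≡ true × D ≢ C))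
    go (inj₁ (_ , b)) = inj₁ b
    go (inj₂ (inj₁ ((_ , _ , u , _ , _ , du , _) , _))) = contradiction (subst (_≤ 2) du (small u)) λ { (s≤s (s≤s ())) }
    go (inj₂ (inj₂ (inj₁ (C₁ , C₂ , (cy₁ , cy₂ , dis , refl , u , u₁ , u₂ , _) , _)))) =
      ⊥-elim (crowded C₁ C₂ u ∪ˡ ∪ʳ dis (cycle-deg G cy₁ u₁) u₂)
    go (inj₂ (inj₂ (inj₂ (inj₁ (C₁ , C₂ , l₁ , _ , cy₁ , ((e , e∈) , _) , vd , refl))))) =
      inj₂ (C₁ , ∪ˡ , l₁ , λ eq → vd _ (e , subst (e ∈_) (sym eq) (∪ʳ e∈) , inj₁ refl) (e , e∈ , inj₁ refl))
    go (inj₂ (inj₂ (inj₂ (inj₂ (C₁ , C₂ , (cy₁ , cy₂ , vd , P , u , w , (u≢w , _ , _ , du , _) , u₁ , w₂ , only₁ , _ , refl) , _))))) =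
      ⊥-elim (crowded C₁ P u (∪ˡ ∘ ∪ˡ) ∪ʳ dis (cycle-deg G cy₁ u₁) (pos-OnV G {P} (subst (0 <_) (sym du) (s≤s z≤n))))
      where
      dis : Disjoint C₁ P
      dis e p q = contradiction (≤-trans (≤-reflexive (sym (trans (term-∈ G q) (cong₂ _+_ (trans (cong (λ z → δ z u) e₁) (δ-refl u)) (trans (cong (λ z → δ z u) e₂) (δ-refl u))))))
                  (≤-trans (term≤∑ (term G P u) e) (≤-reflexive (trans (sym (deg-∑ G P u)) du)))) λ { (s≤s ()) }
        where
        e₁ = only₁ _ (e , q , inj₁ refl) (e , p , inj₁ refl)
        e₂ = only₁ _ (e , q , inj₂ refl) (e , p , inj₂ refl)

  Independent : Subset m → Set
  Independent = Indep FC

  cycle-deg≤2 : ∀ {Z} → Cycle G Z → ∀ v → deg G Z v ≤ 2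
  cycle-deg≤2 (_ , _ , d) v = [ (λ z → subst (_≤ 2) (sym z) z≤n) , ≤-reflexive ]′ (d v)

  -- A circuit inside `Z` is leafless, so it is `Z` itself. With degrees at most 2 it would be
  -- balanced or contain a smaller cycle.
  unbalanced-indep : ∀ {Z} → Cycle G Z → B Z ≡ false → Independent Z
  unbalanced-indep {Z} cy b C fc sub = go (circuit-max-degree-2 {C} fc (λ v → ≤-trans (deg-mono G C Z sub v) (cycle-deg≤2 {Z} cy v)))
    where
    C≡Z : C ≡ Z
    C≡Z = ⊆-antisym sub (leafless-in-cycle G cy sub (circuit-nonempty fc) (circuit-leafless fc))
    go : B C ≡ true ⊎ (∃[ D ] (D ⊆ C × L D ≡ true × D ≢ C)) → False
    go (inj₁ bC) = contradiction (trans (sym bC) (trans (cong B C≡Z) b)) λ ()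
    go (inj₂ (D , D⊆C , l , ne)) = ne (trans (cycle-minimal G cy (L-cycle D l) (sub ∘ D⊆C)) (sym C≡Z))

  cycle-in-union : ∀ {Z C₁ C₂} → Cycle G C₁ → Cycle G C₂ → VertexDisjoint G C₁ C₂ → Cycle G Z → Z ⊆ C₁ ∪ C₂ → Z ≡ C₁ ⊎ Z ≡ C₂
  cycle-in-union {Z} {C₁} {C₂} cy₁ cy₂ vd cy@((e , e∈) , con , _) sub = go (∪⁻ (sub e∈))
    where
    all-in : ∀ C₁ C₂ → Z ⊆ C₁ ∪ C₂ → Cycle G C₁ → VertexDisjoint G C₁ C₂ → e ∈ C₁ → Z ≡ C₁
    all-in C₁ C₂ sub cy₁ vd e∈C₁ = cycle-minimal G cy₁ cy inC
      where
      inC : Z ⊆ C₁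
      inC {f} f∈ = decidable-stable (f ∈? C₁) λ nf →
        let v , p , q = connected-rest G {Z} {Z ∩ C₁} con (p∩q⊆p Z C₁) (e , x∈p∩q⁺ (e∈ , e∈C₁)) (f , ─⁺ f∈ (nf ∘ proj₂ ∘ x∈p∩q⁻ Z C₁))
        in vd v (OnV-mono G (p∩q⊆q Z C₁) p) (OnV-mono G (λ g∈ → [ (λ z → ⊥-elim (─⁻ʳ g∈ (x∈p∩q⁺ (─⁻ˡ g∈ , z)))) , id ]′ (∪⁻ (sub (─⁻ˡ g∈)))) q)
    go : e ∈ C₁ ⊎ e ∈ C₂ → Z ≡ C₁ ⊎ Z ≡ C₂
    go (inj₁ p) = inj₁ (all-in C₁ C₂ sub cy₁ vd p)
    go (inj₂ p) = inj₂ (all-in C₂ C₁ (∪-lub ∪ʳ ∪ˡ ∘ sub) cy₂ (λ v a b → vd v b a) p)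

  -- All degrees are at most 2, so a circuit inside would contain a cycle of B or of L, while the
  -- only cycles of the union are `F₁` and `F₂`.
  disjoint-F-indep : ∀ {F₁ F₂} → F F₁ ≡ true → F F₂ ≡ true → VertexDisjoint G F₁ F₂ → Independent (F₁ ∪ F₂)
  disjoint-F-indep {F₁} {F₂} f₁ f₂ vd C fc sub = go (circuit-max-degree-2 {C} fc small)
    where
    cy₁ = F-cycle F₁ f₁
    cy₂ = F-cycle F₂ f₂
    small : ∀ v → deg G C v ≤ 2
    small v = ≤-trans (deg-mono G C (F₁ ∪ F₂) sub v) (≤-trans (≤-reflexive
      (deg-⊎ G {F₁ ∪ F₂} {F₁} {F₂} ∪⁻ ∪ˡ ∪ʳ (λ f p q → vd _ (f , p , inj₁ refl) (f , q , inj₁ refl)) v)) (lem (onV? G F₁ v)))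
      where
      lem : Dec (OnV G F₁ v) → deg G F₁ v + deg G F₂ v ≤ 2
      lem (yes p) = subst (λ z → deg G F₁ v + z ≤ 2) (sym (¬OnV-zero G (vd v p))) (subst (_≤ 2) (sym (+-identityʳ _)) (cycle-deg≤2 {F₁} cy₁ v))
      lem (no p) = subst (λ z → z + deg G F₂ v ≤ 2) (sym (¬OnV-zero G p)) (cycle-deg≤2 {F₂} cy₂ v)
    go : B C ≡ true ⊎ (∃[ D ] (D ⊆ C × L D ≡ true × D ≢ C)) → False
    go (inj₁ b) = [ (λ { refl → BF-disj C b f₁ }) , (λ { refl → BF-disj C b f₂ }) ]′ (cycle-in-union cy₁ cy₂ vd (B-cycle C b) sub)
    go (inj₂ (D , D⊆C , l , _)) = [ (λ { refl → LF-disj D l f₁ }) , (λ { refl → LF-disj D l f₂ }) ]′ (cycle-in-union cy₁ cy₂ vd (L-cycle D l) (sub ∘ D⊆C))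

  acyclic-indep : ∀ {T} → Acyclic G T → Independent T
  acyclic-indep ac C fc sub = let e , e∈ = circuit-nonempty fc
                                  Z , Z⊆C , cy = no-leaves⇒cycle G (end₁ G e) C (e , e∈) (λ v _ → circuit-leafless fc v)
                              in ac Z (sub ∘ Z⊆C) cy

  -- Outside U a circuit looks the same in G and in G / U, so what it leaves there has no leaf except r.
  extend-indep : ∀ {U r I T} → r ∈ U → (∀ {e} → e ∈ I → end₁ G e ∈ U × end₂ G e ∈ U) → Independent I →
                 Acyclic (collapse G U r) T → Independent (I ∪ T)
  extend-indep {U} {r} {I} {T} r∈U inU ind ac C fc sub = go (nonempty? (C ─ I))
    where
    G' = collapse G U r
    leafless : ∀ v → v ≢ r → deg G' (C ─ I) v ≢ 1
    leafless v v≢r d1 = lem (v ∈? U)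
      where
      lem : Dec (v ∈ U) → False
      lem (yes p) = contradiction (trans (sym (¬OnV-zero G' (collapse-gone G U r r∈U {v} {C ─ I} p v≢r))) d1) λ ()
      lem (no p) = circuit-leafless fc v (trans (deg-cong G C (C ─ I) v (λ e t → (λ e∈ → ─⁺ e∈ (λ q → p (touch q t))) , ─⁻ˡ))
                     (trans (sym (deg-collapse G U r r∈U {C ─ I} p)) d1))
        where
        touch : ∀ {e} → e ∈ I → IsEnd G v e → v ∈ U
        touch q (inj₁ refl) = proj₁ (inU q)
        touch q (inj₂ refl) = proj₂ (inU q)
    go : Dec (Nonempty (C ─ I)) → False
    go (no empty) = ind C fc (λ {e} e∈ → decidable-stable (e ∈? I) (λ ne → empty (e , ─⁺ e∈ ne)))
    go (yes ne) = let Z , Z⊆ , cy = no-leaves⇒cycle G' r (C ─ I) ne leafless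
                  in ac Z (λ z∈ → [ (λ q → ⊥-elim (─⁻ʳ (Z⊆ z∈) q)) , id ]′ (∪⁻ (sub (─⁻ˡ (Z⊆ z∈))))) cy

  -- Edges inside `U` are loops of the quotient, and a forest contains no loop.
  extend-disjoint : ∀ {U r I T} → (∀ {e} → e ∈ I → end₁ G e ∈ U × end₂ G e ∈ U) →
                    Acyclic (collapse G U r) T → Disjoint I T
  extend-disjoint {U} {r} inU ac e p q =
    let Z , Z⊆ , cy = loop-cycle (collapse G U r) {e = e} q (trans (proj-∈ G U r (proj₁ (inU p))) (sym (proj-∈ G U r (proj₂ (inU p)))))
    in ac Z Z⊆ cy

-- Contracting a cycle of L

module _ {n m : ℕ} (G : Graph n m) (B L F : Subset m → Bool) (qb : QuasiBiased G B L F) where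
  open QuasiBiased qb

  private
    Circuit : Subset m → Set
    Circuit = FrameCircuit G B L F

    Ind : Subset m → Set
    Ind = Indep Circuit

  -- Ranks in `Flat` are given by a relation; the hypothesis is applied to the independent set that
  -- attains the rank of `X`.
  flat⁺ : ∀ {X} → (∀ e → e ∉ X → ∀ I → I ⊆ X → Ind I → ∃[ J ] (J ⊆ X ∪ ⁅ e ⁆ × Ind J × ∣ I ∣ < ∣ J ∣)) → Flat Circuit X
  flat⁺ h e e∉X r₁ r₂ ((I , I⊆X , indI , refl) , _) (_ , mx) =
    let J , J⊆ , indJ , lt = h e e∉X I I⊆X indI in ≤-trans lt (mx J J⊆ indJ)

  module Contract (Z : Subset m) (lZ : L Z ≡ true) where

    cyZ : Cycle G Z
    cyZ = L-cycle Z lZ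

    U : Subset n
    U = vertices G Z

    inU : ∀ {e} → e ∈ Z → end₁ G e ∈ U × end₂ G e ∈ U
    inU {e} p = vertices⁺ G (e , p , inj₁ refl) , vertices⁺ G (e , p , inj₂ refl)

    r : Fin n
    r = end₁ G (proj₁ (proj₁ cyZ))

    r∈U : r ∈ U
    r∈U = proj₁ (inU (proj₂ (proj₁ cyZ)))

    π : Fin n → Fin n
    π = proj G U r

    G/Z : Graph n m
    G/Z = collapse G U r

    π-∈ : ∀ {v} → v ∈ U → π v ≡ r
    π-∈ = proj-∈ G U r

    π-∉ : ∀ {v} → v ∉ U → π v ≡ v
    π-∉ = proj-∉ G U r

    isEnd/Z : ∀ {v e} → v ∉ U → IsEnd G v e → IsEnd G/Z v e
    isEnd/Z {e = e} v∉U t = subst (λ z → IsEnd G/Z z e) (π-∉ v∉U) (isEnd-collapse G U r t)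

    Z-loops : ∀ c → NoCross G/Z Z c
    Z-loops c p = cong c (trans (π-∈ (proj₁ (inU p))) (sym (π-∈ (proj₂ (inU p)))))

    indZ : Ind Z
    indZ = unbalanced-indep G B L F qb cyZ (L-unbalanced G B L F qb lZ)

    -- A cycle of the quotient that avoids `r` is a cycle of the graph disjoint from `Z`. It cannot
    -- be in F; if it is in L, it forms a circuit together with `Z`.
    off-Z⇒circuit : ∀ {Q} → Cycle G/Z Q → ¬ OnV G/Z Q r → ∃[ C ] (Circuit C × C ⊆ Z ∪ Q × Q ⊆ C)
    off-Z⇒circuit {Q} (neQ , conQ , dQ) offr = go (covers Q cyQ)
      where
      offU : ∀ {v} → v ∈ U → ¬ OnV G Q v
      offU v∈U (e , e∈ , t) = offr (e , e∈ , subst (λ z → IsEnd G/Z z e) (π-∈ v∈U) (isEnd-collapse G U r t))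
      cyQ : Cycle G Q
      cyQ = neQ , (λ A D eq dis neA neD → let v , onA , onD = conQ A D eq dis neA neD in
                    v , back (λ {e} p → subst (e ∈_) eq (∪ˡ p)) onA , back (λ {e} p → subst (e ∈_) eq (∪ʳ p)) onD) ,
            λ v → degs v (v ∈? U)
        where
        back : ∀ {A v} → A ⊆ Q → OnV G/Z A v → OnV G A v
        back sub (e , e∈ , t) = e , e∈ , collapse-isEnd G U r (λ { refl → offr (e , sub e∈ , t) }) t
        degs : ∀ v → Dec (v ∈ U) → (deg G Q v ≡ 0) ⊎ (deg G Q v ≡ 2)
        degs v (yes p) = inj₁ (¬OnV-zero G (offU p))
        degs v (no p) = [ (λ z → inj₁ (trans (sym (deg-collapse G U r r∈U {Q} p)) z)) , (λ z → inj₂ (trans (sym (deg-collapse G U r r∈U {Q} p)) z)) ]′ (dQ v)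
      vd : VertexDisjoint G Z Q
      vd v onZ onQ = offU (vertices⁺ G onZ) onQ
      go : (B Q ≡ true) ⊎ (L Q ≡ true) ⊎ (F Q ≡ true) → ∃[ C ] (Circuit C × C ⊆ Z ∪ Q × Q ⊆ C)
      go (inj₁ b) = Q , inj₁ (cyQ , b) , ∪ʳ , id
      go (inj₂ (inj₁ l)) = Z ∪ Q , inj₂ (inj₂ (inj₂ (inj₁ (Z , Q , lZ , l , cyZ , cyQ , vd , refl)))) , id , ∪ʳ
      go (inj₂ (inj₂ f)) = let v , p , q = L-meets-F Z Q lZ f in ⊥-elim (vd v p q)

    -- M / Z is the cycle matroid of G / Z.
    lift-cycle : ∀ {Q a} → Cycle G/Z Q → a ∈ Q → end₁ G/Z a ≢ end₂ G/Z a → ∃[ C ] (Circuit C × C ⊆ Z ∪ Q × a ∈ C)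
    lift-cycle {Q} {a} cyQ a∈Q nl = go (onV? G/Z Q r)
      where
      disj : Disjoint Z Q
      disj e p q = let R , R⊆e , cyR = loop-cycle G/Z {⁅ e ⁆} (x∈⁅x⁆ e) (trans (π-∈ (proj₁ (inU p))) (sym (π-∈ (proj₂ (inU p)))))
                       R≡Q = cycle-minimal G/Z cyQ cyR (⁅⁆⊆ q ∘ R⊆e)
                       a≡e = ⁅⁆⁻ (R⊆e (subst (a ∈_) (sym R≡Q) a∈Q))
                   in nl (trans (π-∈ (proj₁ (inU (subst (_∈ Z) (sym a≡e) p)))) (sym (π-∈ (proj₂ (inU (subst (_∈ Z) (sym a≡e) p))))))
      -- The vertex `r` of `Q` is counted again among the vertices of `Z`, so `Z ∪ Q` has at least
      -- one edge more than vertices.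
      small : OnV G/Z Q r → suc (vcount G (Z ∪ Q)) ≤ vcount G Z + vcount G/Z Q
      small onr = begin
        suc (vcount G (Z ∪ Q))                                      ≡⟨ cong (_+ vcount G (Z ∪ Q)) (∑-δ₁ r) ⟨
        ∑ (δ r) + ∑ (λ v → sgn (deg G (Z ∪ Q) v))                   ≡⟨ ∑-+ (δ r) (λ v → sgn (deg G (Z ∪ Q) v)) ⟨
        ∑ (λ v → δ r v + sgn (deg G (Z ∪ Q) v))                     ≤⟨ ∑-mono (λ v → pt v (v ∈? U) (v ≟ r)) ⟩
        ∑ (λ v → sgn (deg G/Z Q v) + sgn (deg G Z v))               ≡⟨ ∑-+ (λ v → sgn (deg G/Z Q v)) (λ v → sgn (deg G Z v)) ⟩
        vcount G/Z Q + vcount G Z                                   ≡⟨ +-comm (vcount G/Z Q) (vcount G Z) ⟩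
        vcount G Z + vcount G/Z Q                                   ∎
        where
        open ≤-Reasoning
        sgn≤1 : ∀ d → sgn d ≤ 1
        sgn≤1 zero = z≤n
        sgn≤1 (suc d) = s≤s z≤n
        pt : ∀ v → Dec (v ∈ U) → Dec (v ≡ r) → δ r v + sgn (deg G (Z ∪ Q) v) ≤ sgn (deg G/Z Q v) + sgn (deg G Z v)
        pt v (yes p) (yes refl) = +-mono-≤ (≤-reflexive (trans (δ-refl r) (sym (sgn-pos (OnV-pos G/Z onr)))))
                                    (≤-trans (sgn≤1 _) (≤-reflexive (sym (sgn-pos (OnV-pos G (vertices⁻ G p))))))
        pt v (yes p) (no v≢r) = ≤-trans (≤-trans (≤-reflexive (cong (_+ sgn (deg G (Z ∪ Q) v)) (δ-≢ {p = r} {v} (v≢r ∘ sym)))) (≤-trans (sgn≤1 _)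
                                    (≤-reflexive (sym (sgn-pos (OnV-pos G (vertices⁻ G p))))))) (m≤n+m _ _)
        pt v (no p) _ = ≤-trans (≤-reflexive (cong₂ _+_ (δ-≢ {p = r} {v} (λ { refl → p r∈U }))
                          (cong sgn (trans (deg-cong G (Z ∪ Q) Q v (λ e t → (λ e∈ → [ (λ z → ⊥-elim (p (vertices⁺ G (e , z , t)))) , id ]′ (∪⁻ e∈)) , ∪ʳ))
                            (sym (deg-collapse G U r r∈U {Q} p)))))) (m≤m+n _ _)
      go : Dec (OnV G/Z Q r) → ∃[ C ] (Circuit C × C ⊆ Z ∪ Q × a ∈ C)
      go (no off) = let C , fc , sub , Q⊆C = off-Z⇒circuit cyQ off in C , fc , sub , Q⊆C a∈Q
      go (yes onr) = let C , sub , fc = edges>vertices⇒circuit G B L F qb (Z ∪ Q)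
                           (≤-trans (small onr) (≤-reflexive (trans (cong₂ _+_ (sym (cycle-card G cyZ)) (sym (cycle-card G/Z cyQ))) (sym (card-∪ disj)))))
                     -- Without `a` the circuit would lie in `Z` plus the forest `Q ─ ⁅ a ⁆`, which
                     -- is independent.
                     in C , fc , sub , decidable-stable (a ∈? C) λ a∉C →
                          extend-indep G B L F qb {U} {r} {Z} {Q ─ ⁅ a ⁆} r∈U inU indZ (cycle-proper G/Z cyQ a∈Q) C fc
                            (λ {e} e∈ → [ ∪ˡ , (λ q → ∪ʳ (─-≢ q (λ { refl → a∉C e∈ }))) ]′ (∪⁻ (sub e∈)))

    -- A circuit through `e` and otherwise inside `X` would cross the given cut once. As `Z ⊆ X`,
    -- the cut does not split `Z`, and `circuit-crosses-twice` applies.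
    cut-flat : ∀ {X} → Z ⊆ X → (∀ e → e ∉ X → ∃[ c ] (NoCross G X c × ¬ Same G c e)) → Flat Circuit X
    cut-flat {X} Z⊆X h = flat⁺ λ e e∉X I I⊆X indI → let c , nc , ns = h e e∉X in
      I ∪ ⁅ e ⁆ , ∪-lub (∪ˡ ∘ I⊆X) ∪ʳ , (λ C fc sub → bridge c nc ns I⊆X indI C fc sub (e ∈? C)) , ≤-reflexive (sym (card-+1 (e∉X ∘ I⊆X)))
      where
      bridge : ∀ {e I} c → NoCross G X c → ¬ Same G c e → I ⊆ X → Ind I → ∀ C → Circuit C → C ⊆ I ∪ ⁅ e ⁆ → Dec (e ∈ C) → False
      bridge {e} c nc ns I⊆X indI C fc sub (no e∉C) =
        indI C fc (λ {f} f∈ → [ id , (λ q → ⊥-elim (e∉C (subst (_∈ C) (⁅⁆⁻ q) f∈))) ]′ (∪⁻ (sub f∈)))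
      bridge {e} c nc ns I⊆X indI C fc sub (yes e∈C) = ns (circuit-crosses-twice G B L F qb {C} {Z} {c} fc lZ (nc ∘ Z⊆X) e∈C
        (λ f∈ → nc (I⊆X ([ id , (λ q → ⊥-elim (─⁻ʳ f∈ q)) ]′ (∪⁻ (sub (─⁻ˡ f∈)))))))

    uncrossed : Cut n → Cut n → Subset m
    uncrossed c d = ⟪ (λ e → does (same? G/Z c e) ∧ does (same? G/Z d e)) ⟫

    uncrossed⁺ : ∀ {c d e} → Same G/Z c e → Same G/Z d e → e ∈ uncrossed c d
    uncrossed⁺ {c} {d} {e} p q = ⟪⟫⁺ (cong₂ _∧_ (dec-true (same? G/Z c e) p) (dec-true (same? G/Z d e) q))

    uncrossed⁻ : ∀ {c d e} → e ∈ uncrossed c d → Same G/Z c e × Same G/Z d e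
    uncrossed⁻ {c} {d} {e} p = lem (same? G/Z c e) (same? G/Z d e) (⟪⟫⁻ {f = λ e → does (same? G/Z c e) ∧ does (same? G/Z d e)} p)
      where
      lem : ∀ {P Q : Set} (a : Dec P) (b : Dec Q) → does a ∧ does b ≡ true → P × Q
      lem (yes a) (yes b) _ = a , b

    -- u hangs on the connected rest of K, and K ≠ V: the contraction of all edges crossing neither {u} nor K splits.
    breakable : (∀ X → Flat Circuit X → ContractionConnected Circuit X) → ∀ u K →
      (∀ e → ¬ Same G/Z (point G u) e → Same G/Z K e) →
      ∀ a → ¬ Same G/Z (point G u) a → ∀ b → ¬ Same G/Z K b →
      (∀ a₁ a₂ → ¬ Same G/Z (point G u) a₁ → ¬ Same G/Z (point G u) a₂ →
         ∀ c → NoCross G/Z (uncrossed (point G u) K) c → Same G/Z c a₂ → Same G/Z c a₁) → False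
    breakable ub u K h₁ a ua b Kb h₄ = go (ub X flat a b (λ p → ua (proj₁ (uncrossed⁻ {p₀} {K} p))) (λ p → Kb (proj₂ (uncrossed⁻ {p₀} {K} p))) (λ { refl → Kb (h₁ a ua) }))
      where
      p₀ = point G u
      X = uncrossed p₀ K
      Z⊆X : Z ⊆ X
      Z⊆X p = uncrossed⁺ {p₀} {K} (Z-loops p₀ p) (Z-loops K p)
      flat : Flat Circuit X
      flat = cut-flat Z⊆X λ e e∉X → sep e e∉X (same? G/Z p₀ e) (same? G/Z K e)
        where
        sep : ∀ e → e ∉ X → Dec (Same G/Z p₀ e) → Dec (Same G/Z K e) → ∃[ c ] (NoCross G X c × ¬ Same G c e)
        sep e e∉X (no p) _ = p₀ ∘ π , (λ q → proj₁ (uncrossed⁻ {p₀} {K} q)) , p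
        sep e e∉X (yes _) (no p) = K ∘ π , (λ q → proj₂ (uncrossed⁻ {p₀} {K} q)) , p
        sep e e∉X (yes p) (yes q) = ⊥-elim (e∉X (uncrossed⁺ {p₀} {K} p q))
      go : ∃[ D ] (ContractCircuit Circuit X D × a ∈ D × b ∈ D) → False
      go (D , (_ , (C , fc , refl) , mn) , a∈D , b∈D) = second (any? (λ a₂ → (a₂ ∈? C) ×-dec (¬? (a₂ ≟ a) ×-dec ¬? (same? G/Z p₀ a₂))))
        where
        second : Dec (∃[ a₂ ] (a₂ ∈ C × a₂ ≢ a × ¬ Same G/Z p₀ a₂)) → False
        second (no none) = ua (circuit-crosses-twice G B L F qb {C} {Z} {p₀ ∘ π} fc lZ (Z-loops p₀) (─⁻ˡ a∈D)
          (λ {f} f∈ → decidable-stable (same? G/Z p₀ f) (λ ns → none (f , ─⁻ˡ f∈ , (λ { refl → ─-∌ f∈ }) , ns))))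
        -- By `h₄` the set `X` with `a` and `a₂` contains a cycle of the quotient through `a`. It
        -- lifts to a circuit whose trace outside `X` lies within `a` and `a₂`, hence inside that of
        -- `C`. By minimality it contains `b`, yet `b` crosses `K` and none of its edges does.
        second (yes (a₂ , a₂∈C , a₂≢a , ua₂)) = lifted (closing-cycle G/Z (X ∪ ⁅ a₂ ⁆) a
            (λ p → [ (λ q → ua (proj₁ (uncrossed⁻ {p₀} {K} q))) , (λ q → a₂≢a (sym (⁅⁆⁻ q))) ]′ (∪⁻ p))
            (λ c nc → h₄ a a₂ ua ua₂ c (nc ∘ ∪ˡ) (nc (∪ʳ (x∈⁅x⁆ a₂)))))
          where
          lifted : ∃[ Q ] (Cycle G/Z Q × a ∈ Q × Q ⊆ (X ∪ ⁅ a₂ ⁆) ∪ ⁅ a ⁆) → False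
          lifted (Q , cyQ , a∈Q , Q⊆) = clash (lift-cycle cyQ a∈Q (λ eq → ua (cong p₀ eq)))
            where
            clash : ∃[ C' ] (Circuit C' × C' ⊆ Z ∪ Q × a ∈ C') → False
            clash (C' , fc' , sub , a∈C') = Kb (bK (Q-part b∈C'))
              where
              Q-part : ∀ {e} → e ∈ C' → e ∈ X ⊎ (e ≡ a₂ ⊎ e ≡ a)
              Q-part e∈ = [ inj₁ ∘ Z⊆X , (λ q → [ (λ p → [ inj₁ , inj₂ ∘ inj₁ ∘ ⁅⁆⁻ ]′ (∪⁻ p)) , inj₂ ∘ inj₂ ∘ ⁅⁆⁻ ]′ (∪⁻ (Q⊆ q))) ]′ (∪⁻ (sub e∈))
              place : ∀ {e} → e ∉ X → e ∈ X ⊎ (e ≡ a₂ ⊎ e ≡ a) → e ∈ C ─ X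
              place ne (inj₁ x) = ⊥-elim (ne x)
              place ne (inj₂ (inj₁ refl)) = ─⁺ a₂∈C ne
              place ne (inj₂ (inj₂ refl)) = a∈D
              C'─X⊆ : C' ─ X ⊆ C ─ X
              C'─X⊆ e∈ = place (─⁻ʳ e∈) (Q-part (─⁻ˡ e∈))
              b∈C' : b ∈ C'
              b∈C' = ─⁻ˡ (subst (b ∈_) (sym (mn C' fc' (a , ─⁺ a∈C' (─⁻ʳ a∈D)) C'─X⊆)) b∈D)
              bK : b ∈ X ⊎ (b ≡ a₂ ⊎ b ≡ a) → Same G/Z K b
              bK (inj₁ x) = proj₂ (uncrossed⁻ {p₀} {K} x)
              bK (inj₂ (inj₁ refl)) = h₁ a₂ ua₂
              bK (inj₂ (inj₂ refl)) = h₁ a ua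

-- The quotient and the two sides of a separation

-- ∣ vertices G ⊤ ∣ is the rank of M: bound says r(X) + r(Y) ≤ r(M) + 1, boundX and boundY that no side spans M.
record Setting {n m : ℕ} (G : Graph n m) (B L F : Subset m → Bool) : Set where
  field
    qb : QuasiBiased G B L F
    Z₁ Z₂ F₁ F₂ X Y : Subset m
    l₁ : L Z₁ ≡ true
    l₂ : L Z₂ ≡ true
    f₁ : F F₁ ≡ true
    f₂ : F F₂ ≡ true
    dZ : VertexDisjoint G Z₁ Z₂
    dF : VertexDisjoint G F₁ F₂
    loopless : ∀ e → end₁ G e ≢ end₂ G e
    joined : Joined G ⊤ (vertices G ⊤)
    pairs : ∀ a b → Indep (FrameCircuit G B L F) (⁅ a ⁆ ∪ ⁅ b ⁆)
    ub : ∀ S → Flat (FrameCircuit G B L F) S → ContractionConnected (FrameCircuit G B L F) S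
    cover : ∀ e → e ∈ X ⊎ e ∈ Y
    disj : Disjoint X Y
    bound : ∀ {I J} → I ⊆ X → J ⊆ Y → Indep (FrameCircuit G B L F) I → Indep (FrameCircuit G B L F) J →
            ∣ I ∣ + ∣ J ∣ ≤ suc ∣ vertices G ⊤ ∣
    boundX : ∀ {I} → I ⊆ X → Indep (FrameCircuit G B L F) I → ∣ I ∣ < ∣ vertices G ⊤ ∣
    boundY : ∀ {J} → J ⊆ Y → Indep (FrameCircuit G B L F) J → ∣ J ∣ < ∣ vertices G ⊤ ∣

swapXY : ∀ {n m} {G : Graph n m} {B L F} → Setting G B L F → Setting G B L F
swapXY K = record
  { Setting K hiding (X; Y; cover; disj; bound; boundX; boundY)
  ; X = Y ; Y = X ; cover = λ e → [ inj₂ , inj₁ ]′ (cover e) ; disj = λ e p q → disj e q p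
  ; bound = λ {I} {J} p q i j → ≤-trans (≤-reflexive (+-comm ∣ I ∣ ∣ J ∣)) (bound q p j i)
  ; boundX = boundY ; boundY = boundX }
  where open Setting K

swapZ : ∀ {n m} {G : Graph n m} {B L F} → Setting G B L F → Setting G B L F
swapZ K = record { Setting K hiding (Z₁; Z₂; l₁; l₂; dZ) ; Z₁ = Z₂ ; Z₂ = Z₁ ; l₁ = l₂ ; l₂ = l₁ ; dZ = λ v p q → dZ v q p }
  where open Setting K

does-⇔ : ∀ {P Q : Set} (p : Dec P) (q : Dec Q) → (P → Q) → (Q → P) → does p ≡ does q
does-⇔ (yes a) (yes b) f g = refl
does-⇔ (yes a) (no b)  f g = ⊥-elim (b (f a))
does-⇔ (no a)  (yes b) f g = ⊥-elim (a (g b))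
does-⇔ (no a)  (no b)  f g = refl

true-dec : ∀ {P : Set} (p : Dec P) → does p ≡ true → P
true-dec (yes a) _ = a

module Quotient {n m : ℕ} {G : Graph n m} {B L F : Subset m → Bool} (K : Setting G B L F) where
  open Setting K
  open QuasiBiased qb
  open Contract G B L F qb Z₁ l₁ public

  Circuit : Subset m → Set
  Circuit = FrameCircuit G B L F

  Ind : Subset m → Set
  Ind = Indep Circuit

  V : Subset n
  V = vertices G ⊤

  -- The vertices of the quotient that matter, with `r` standing for all of `U`.
  W : Subset n
  W = (V ─ U) ∪ ⁅ r ⁆

  U⊆V : U ⊆ V
  U⊆V p = vertices⁺ G (OnV-mono G (λ _ → ∈⊤) (vertices⁻ G p))

  toV : ∀ {S v} → OnV G S v → v ∈ V
  toV on = vertices⁺ G (OnV-mono G (λ _ → ∈⊤) on)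

  W-fixed : ∀ {v} → v ∈ W → v ∈ V × π v ≡ v
  W-fixed p = [ (λ q → ─⁻ˡ q , π-∉ (─⁻ʳ q)) , (λ q → subst (λ z → z ∈ V × π z ≡ z) (sym (⁅⁆⁻ q)) (U⊆V r∈U , π-∈ r∈U)) ]′ (∪⁻ p)

  r∈W : r ∈ W
  r∈W = ∪ʳ (x∈⁅x⁆ r)

  ∉U⇒∈W : ∀ {v} → v ∈ V → v ∉ U → v ∈ W
  ∉U⇒∈W p q = ∪ˡ (─⁺ p q)

  card-U : ∣ U ∣ ≡ ∣ Z₁ ∣
  card-U = trans (card-vertices G Z₁) (sym (cycle-card G cyZ))

  card-W : ∣ W ∣ + ∣ Z₁ ∣ ≡ suc ∣ V ∣
  card-W = begin
    ∣ W ∣ + ∣ Z₁ ∣              ≡⟨ cong₂ _+_ (card-+1 {S = V ─ U} (λ p → ─⁻ʳ p r∈U)) (sym card-U) ⟩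
    suc (∣ V ─ U ∣ + ∣ U ∣)     ≡⟨ cong suc (+-comm ∣ V ─ U ∣ ∣ U ∣) ⟩
    suc (∣ U ∣ + ∣ V ─ U ∣)     ≡⟨ cong suc (card-⊎ {A = U} {V ─ U} split-─ U⊆V ─⁻ˡ (λ e p q → ─⁻ʳ q p)) ⟨
    suc ∣ V ∣                   ∎
    where open ≡-Reasoning

  joined/Z : Joined G/Z ⊤ W
  joined/Z c nc p q = trans (cong c (sym (proj₂ (W-fixed p)))) (trans
    (joined (c ∘ π) nc (proj₁ (W-fixed p)) (proj₁ (W-fixed q))) (cong c (proj₂ (W-fixed q))))

  forest-indep : ∀ {T} → Acyclic G/Z T → Ind (Z₁ ∪ T)
  forest-indep = extend-indep G B L F qb r∈U inU indZ

  forest-disjoint : ∀ {T} → Acyclic G/Z T → Disjoint Z₁ T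
  forest-disjoint = extend-disjoint G B L F qb inU

  -- Distribute `Z₁` over the two sides: `S ∪ (Z₁ ∩ X)` and `T ∪ (Z₁ ∩ Y)` are independent, and
  -- subtracting the edges of `Z₁` turns the bound `suc ∣ V ∣` into `∣ W ∣` by `card-W`.
  forest-bound : ∀ {S T} → S ⊆ X → T ⊆ Y → Acyclic G/Z S → Acyclic G/Z T → ∣ S ∣ + ∣ T ∣ ≤ ∣ W ∣
  forest-bound {S} {T} S⊆X T⊆Y acS acT = +-cancelʳ-≤ ∣ Z₁ ∣ _ _ (begin
    (∣ S ∣ + ∣ T ∣) + ∣ Z₁ ∣                          ≡⟨ cong ((∣ S ∣ + ∣ T ∣) +_) splitZ ⟩
    (∣ S ∣ + ∣ T ∣) + (∣ Z₁ ∩ X ∣ + ∣ Z₁ ∩ Y ∣)       ≡⟨ interchange (∣ S ∣) (∣ T ∣) (∣ Z₁ ∩ X ∣) (∣ Z₁ ∩ Y ∣) ⟩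
    (∣ S ∣ + ∣ Z₁ ∩ X ∣) + (∣ T ∣ + ∣ Z₁ ∩ Y ∣)       ≡⟨ cong₂ _+_ (sym (card-∪ (apart acS))) (sym (card-∪ (apart acT))) ⟩
    ∣ S ∪ (Z₁ ∩ X) ∣ + ∣ T ∪ (Z₁ ∩ Y) ∣               ≤⟨ bound (∪-lub S⊆X (p∩q⊆q Z₁ X)) (∪-lub T⊆Y (p∩q⊆q Z₁ Y)) (ind acS) (ind acT) ⟩
    suc ∣ V ∣                                         ≡⟨ card-W ⟨
    ∣ W ∣ + ∣ Z₁ ∣                                    ∎)
    where
    open ≤-Reasoning
    splitZ : ∣ Z₁ ∣ ≡ ∣ Z₁ ∩ X ∣ + ∣ Z₁ ∩ Y ∣
    splitZ = card-⊎ (λ {e} p → [ (λ q → inj₁ (x∈p∩q⁺ (p , q))) , (λ q → inj₂ (x∈p∩q⁺ (p , q))) ]′ (cover e))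
               (p∩q⊆p Z₁ X) (p∩q⊆p Z₁ Y) (λ e p q → disj e (p∩q⊆q Z₁ X p) (p∩q⊆q Z₁ Y q))
    apart : ∀ {R D} → Acyclic G/Z R → Disjoint R (Z₁ ∩ D)
    apart {D = D} ac e p q = forest-disjoint ac e (p∩q⊆p Z₁ D q) p
    ind : ∀ {R D} → Acyclic G/Z R → Ind (R ∪ (Z₁ ∩ D))
    ind {D = D} ac C fc sub = forest-indep ac C fc (λ e∈ → [ ∪ʳ , (λ q → ∪ˡ (p∩q⊆p Z₁ D q)) ]′ (∪⁻ (sub e∈)))

  -- `P` and `Q` are the two sides in either order, and `kk` is the `S`-component of `u`. As `T`
  -- misses `u`, every edge that leaves `u` lies in `P`, so it stays inside that component.
  leaf-break : ∀ {P Q S T u} → (∀ e → e ∈ P ⊎ e ∈ Q) → S ⊆ P → Spanning G/Z S P → Spanning G/Z T Q → u ∈ W →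
               deg G/Z S u ≡ 1 → ¬ OnV G/Z T u → ¬ Joined G/Z P W → False
  leaf-break {P} {Q} {S} {T} {u} cov S⊆P spS spT u∈W d1 offT ¬jn = start (deg-one G/Z {S} d1)
    where
    kk : Cut n
    kk w = does (linked? G/Z S u w)
    kk⁻ : ∀ {w} → kk w ≡ true → Linked G/Z S u w
    kk⁻ {w} = true-dec (linked? G/Z S u w)
    kk-u : kk u ≡ true
    kk-u = dec-true (linked? G/Z S u u) (λ c nc → refl)
    kk-nc : NoCross G/Z S kk
    kk-nc {e} e∈ = does-⇔ (linked? G/Z S u _) (linked? G/Z S u _) (λ lk c nc → trans (lk c nc) (nc e∈)) (λ lk c nc → trans (lk c nc) (sym (nc e∈)))
    h₁ : ∀ e → ¬ Same G/Z (point G u) e → Same G/Z kk e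
    h₁ e ns = [ spS kk kk-nc , (λ e∈Q → ⊥-elim (ns (spT (point G u) (λ {f} f∈ → point-untouched G/Z (λ t → offT (f , f∈ , t))) e∈Q))) ]′ (cov e)
    start : ∃[ x ] (x ∈ S × IsEnd G/Z u x × end₁ G/Z x ≢ end₂ G/Z x × (∀ f → f ∈ S → f ≢ x → ¬ IsEnd G/Z u f)) → False
    start (x , x∈S , tu , nl , uniq) = go (otherEnd G/Z tu nl) (any? (λ b → ¬? (same? G/Z kk b)))
      where
      go : ∃[ q ] (IsEnd G/Z q x × q ≢ u) → Dec (∃[ b ] ¬ Same G/Z kk b) → False
      go _ (no none) = ¬jn λ c nc p q → trans (sym (lnk p c (nc ∘ S⊆P))) (lnk q c (nc ∘ S⊆P))
        where
        lnk : ∀ {w} → w ∈ W → Linked G/Z S u w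
        lnk p = kk⁻ (trans (joined/Z kk (λ {b} _ → decidable-stable (same? G/Z kk b) (λ ns → none (b , ns))) p u∈W) kk-u)
      go (q , tq , q≢u) (yes (b , Kb)) = breakable ub u kk h₁ x (point-crosses G/Z tu tq q≢u) b Kb h₄
        where
        h₄ : ∀ a₁ a₂ → ¬ Same G/Z (point G u) a₁ → ¬ Same G/Z (point G u) a₂ →
             ∀ c → NoCross G/Z (uncrossed (point G u) kk) c → Same G/Z c a₂ → Same G/Z c a₁
        h₄ a₁ a₂ n₁ n₂ c nc s₂ = fin (crosses-point G/Z n₁) (crosses-point G/Z n₂)
          where
          -- With `u` recoloured like its only `S`-neighbour `q`, no edge of `S` is crossed. So the
          -- whole component has the colour of `q`, in particular the far end of every edge at `u`.
          c* : Cut n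
          c* = override G/Z c u (c q)
          nc* : NoCross G/Z S c*
          nc* = override-pendant G/Z {S} {c} (tu , tq) q≢u uniq (λ {f} f∈ → nc (uncrossed⁺ {point G u} {kk}
                  (point-untouched G/Z (uniq f (─⁻ˡ f∈) (λ { refl → ─-∌ f∈ }))) (kk-nc (─⁻ˡ f∈))))
          hub : ∀ {p a} → ¬ Same G/Z (point G u) a → IsEnd G/Z u a → IsEnd G/Z p a → p ≢ u → c q ≡ c p
          hub {p} {a} ns tu' tp p≢u = trans (sym (override-at G/Z c u (c q)))
            (trans (kk⁻ (trans (sym (same-ends G/Z {kk} {a} (h₁ a ns) tu' tp)) kk-u) c* nc*) (override-off G/Z c u (c q) p≢u))
          fin : ∃[ p ] (IsEnd G/Z u a₁ × IsEnd G/Z p a₁ × p ≢ u) → ∃[ p ] (IsEnd G/Z u a₂ × IsEnd G/Z p a₂ × p ≢ u) → Same G/Z c a₁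
          fin (p₁ , tu₁ , tp₁ , ne₁) (p₂ , tu₂ , tp₂ , ne₂) = ends-same G/Z {c} tu₁ tp₁ ne₁
            (trans (same-ends G/Z {c} {a₂} s₂ tu₂ tp₂) (trans (sym (hub n₂ tu₂ tp₂ ne₂)) (hub n₁ tu₁ tp₁ ne₁)))

  -- Neither side connects the quotient

  module NotJoined (¬jX : ¬ Joined G/Z X W) (¬jY : ¬ Joined G/Z Y W) where

    -- If both degrees were 0, `u` would be the only vertex of the quotient, and any edge set joins
    -- a single vertex. Total degree 1 is excluded by `leaf-break`.
    degrees≥2 : ∀ {S T u} → S ⊆ X → T ⊆ Y → Spanning G/Z S X → Spanning G/Z T Y → u ∈ W → 2 ≤ deg G/Z S u + deg G/Z T u
    degrees≥2 {S} {T} {u} S⊆X T⊆Y spS spT u∈W = ≮⇒≥ λ lt → lem _ _ refl refl lt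
      where
      off : ∀ {R} → deg G/Z R u ≡ 0 → ¬ OnV G/Z R u
      off {R} = onV-deg G/Z {R}
      nc : ∀ {R} → ¬ OnV G/Z R u → NoCross G/Z R (point G u)
      nc ¬on {f} f∈ = point-untouched G/Z (λ t → ¬on (f , f∈ , t))
      all-u : ¬ OnV G/Z S u → ¬ OnV G/Z T u → ∀ {w} → w ∈ W → w ≡ u
      all-u a b {w} w∈W = true-dec (w ≟ u) (trans (joined/Z (point G u)
        (λ {e} _ → [ spS (point G u) (nc a) , spT (point G u) (nc b) ]′ (cover e)) w∈W u∈W) (point-at G u))
      lem : ∀ a b → deg G/Z S u ≡ a → deg G/Z T u ≡ b → deg G/Z S u + deg G/Z T u < 2 → False
      lem zero zero p q _ = ¬jX λ c _ a b → trans (cong c (all-u (off p) (off q) a)) (cong c (sym (all-u (off p) (off q) b)))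
      lem (suc zero) zero p q _ = leaf-break cover S⊆X spS spT u∈W p (off q) ¬jX
      lem zero (suc zero) p q _ = leaf-break (λ e → [ inj₂ , inj₁ ]′ (cover e)) T⊆Y spT spS u∈W q (off p) ¬jY
      lem (suc (suc a)) b p q lt = <⇒≱ lt (≤-trans (subst (2 ≤_) (sym p) (s≤s (s≤s z≤n))) (m≤m+n _ _))
      lem (suc zero) (suc b) p q lt = <⇒≱ lt (subst₂ (λ x y → 2 ≤ x + y) (sym p) (sym q) (s≤s (s≤s z≤n)))
      lem zero (suc (suc b)) p q lt = <⇒≱ lt (≤-trans (subst (2 ≤_) (sym q) (s≤s (s≤s z≤n))) (m≤n+m _ _))

    degrees≤2 : ∀ {S T} → S ⊆ X → T ⊆ Y → Acyclic G/Z S → Acyclic G/Z T → Spanning G/Z S X → Spanning G/Z T Y →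
                ∀ u → deg G/Z S u + deg G/Z T u ≤ 2
    degrees≤2 {S} {T} S⊆X T⊆Y acS acT spS spT u = ≤-trans (≤-reflexive (tight u)) (χχ u)
      where
      χχ : ∀ u → χ W u + χ W u ≤ 2
      χχ u with lookup W u
      ... | true = ≤-refl
      ... | false = z≤n
      low : ∀ v → χ W v + χ W v ≤ deg G/Z S v + deg G/Z T v
      low v = go (v ∈? W)
        where
        go : Dec (v ∈ W) → χ W v + χ W v ≤ deg G/Z S v + deg G/Z T v
        go (yes p) = ≤-trans (χχ v) (degrees≥2 S⊆X T⊆Y spS spT p)
        go (no p) = subst (λ z → z + z ≤ deg G/Z S v + deg G/Z T v) (sym (χ-∉ p)) z≤n
      -- The degrees add up to twice the number of forest edges, at most `∣ W ∣ + ∣ W ∣`, which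
      -- leaves nothing above 2 at each vertex of `W`.
      tight : ∀ v → deg G/Z S v + deg G/Z T v ≡ χ W v + χ W v
      tight = ∑-≤-tight low (begin
        ∑ (λ v → deg G/Z S v + deg G/Z T v)        ≡⟨ ∑-+ (deg G/Z S) (deg G/Z T) ⟩
        ∑ (deg G/Z S) + ∑ (deg G/Z T)              ≡⟨ cong₂ _+_ (∑-deg G/Z S) (∑-deg G/Z T) ⟩
        (∣ S ∣ + ∣ S ∣) + (∣ T ∣ + ∣ T ∣)          ≡⟨ interchange (∣ S ∣) (∣ S ∣) (∣ T ∣) (∣ T ∣) ⟩
        (∣ S ∣ + ∣ T ∣) + (∣ S ∣ + ∣ T ∣)          ≤⟨ +-mono-≤ (forest-bound S⊆X T⊆Y acS acT) (forest-bound S⊆X T⊆Y acS acT) ⟩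
        ∣ W ∣ + ∣ W ∣                              ≡⟨ cong₂ _+_ (card W) (card W) ⟩
        ∑ (χ W) + ∑ (χ W)                          ≡⟨ ∑-+ (χ W) (χ W) ⟨
        ∑ (λ v → χ W v + χ W v)                    ∎)
        where open ≤-Reasoning

    -- The star of e₁, e₂, e₃ extends to spanning forests of X and Y, where d has degree at most 2.
    two-neighbours : ∀ {d q₁ q₂ q₃ e₁ e₂ e₃} → q₁ ≢ d → q₂ ≢ d → q₃ ≢ d → q₁ ≢ q₂ → q₁ ≢ q₃ → q₂ ≢ q₃ →
      IsEnd G/Z d e₁ × IsEnd G/Z q₁ e₁ → IsEnd G/Z d e₂ × IsEnd G/Z q₂ e₂ → IsEnd G/Z d e₃ × IsEnd G/Z q₃ e₃ → False
    two-neighbours {d} {q₁} {q₂} {q₃} {e₁} {e₂} {e₃} n₁ n₂ n₃ n₁₂ n₁₃ n₂₃ (d₁ , t₁) (d₂ , t₂) (d₃ , t₃) =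
      fin (spanning-forest G/Z X (S ∩ X) (p∩q⊆q S X) (λ R R⊆ → acS R (p∩q⊆p S X ∘ R⊆)))
          (spanning-forest G/Z Y (S ∩ Y) (p∩q⊆q S Y) (λ R R⊆ → acS R (p∩q⊆p S Y ∘ R⊆)))
      where
      S : Subset m
      S = (⁅ e₁ ⁆ ∪ ⁅ e₂ ⁆) ∪ ⁅ e₃ ⁆
      S⁻ : ∀ {e} → e ∈ S → e ≡ e₁ ⊎ (e ≡ e₂ ⊎ e ≡ e₃)
      S⁻ p = [ (λ q → [ inj₁ ∘ ⁅⁆⁻ , inj₂ ∘ inj₁ ∘ ⁅⁆⁻ ]′ (∪⁻ q)) , inj₂ ∘ inj₂ ∘ ⁅⁆⁻ ]′ (∪⁻ p)
      miss : ∀ {q p e} → IsEnd G/Z d e → IsEnd G/Z p e → p ≢ d → q ≢ d → q ≢ p → ¬ IsEnd G/Z q e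
      miss a b pd qd qp t = [ qd , qp ]′ (ends-of G/Z a b pd t)
      dif : ∀ {q p e f} → IsEnd G/Z q e → IsEnd G/Z d f → IsEnd G/Z p f → p ≢ d → q ≢ d → q ≢ p → e ≢ f
      dif t a b pd qd qp refl = miss a b pd qd qp t
      card-S : ∣ S ∣ ≡ 3
      card-S = trans (card-+1 (λ p → [ (λ q → dif t₃ d₁ t₁ n₁ n₃ (n₁₃ ∘ sym) (⁅⁆⁻ q)) , (λ q → dif t₃ d₂ t₂ n₂ n₃ (n₂₃ ∘ sym) (⁅⁆⁻ q)) ]′ (∪⁻ p)))
                 (cong suc (trans (card-+1 (λ q → dif t₂ d₁ t₁ n₁ n₂ (n₁₂ ∘ sym) (⁅⁆⁻ q))) (cong suc (∣⁅x⁆∣≡1 e₁))))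
      acS : Acyclic G/Z S
      acS = acyclic-bridges G/Z λ e e∈ → bridge e (S⁻ e∈)
        where
        Bridge : Fin m → Set
        Bridge e = ∃[ c ] (NoCross G/Z (S ─ ⁅ e ⁆) c × ¬ Same G/Z c e)
        tip : ∀ {q e} → q ≢ d → IsEnd G/Z d e → IsEnd G/Z q e → (∀ f → f ≢ e → f ≡ e₁ ⊎ (f ≡ e₂ ⊎ f ≡ e₃) → ¬ IsEnd G/Z q f) → Bridge e
        tip {q} {e} q≢d td tq h = point G q , (λ {f} f∈ → point-untouched G/Z (h f (λ { refl → ─-∌ f∈ }) (S⁻ (─⁻ˡ f∈)))) , point-crosses G/Z tq td (q≢d ∘ sym)
        bridge : ∀ e → e ≡ e₁ ⊎ (e ≡ e₂ ⊎ e ≡ e₃) → Bridge e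
        bridge e (inj₁ refl) = tip n₁ d₁ t₁ λ f ne → [ ⊥-elim ∘ ne , [ (λ { refl → miss d₂ t₂ n₂ n₁ n₁₂ }) , (λ { refl → miss d₃ t₃ n₃ n₁ n₁₃ }) ]′ ]′
        bridge e (inj₂ (inj₁ refl)) = tip n₂ d₂ t₂ λ f ne → [ (λ { refl → miss d₁ t₁ n₁ n₂ (n₁₂ ∘ sym) }) , [ ⊥-elim ∘ ne , (λ { refl → miss d₃ t₃ n₃ n₂ n₂₃ }) ]′ ]′
        bridge e (inj₂ (inj₂ refl)) = tip n₃ d₃ t₃ λ f ne → [ (λ { refl → miss d₁ t₁ n₁ n₃ (n₁₃ ∘ sym) }) , [ (λ { refl → miss d₂ t₂ n₂ n₃ (n₂₃ ∘ sym) }) , ⊥-elim ∘ ne ]′ ]′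
      touch : ∀ {e} → e ∈ S → IsEnd G/Z d e
      touch p = [ (λ { refl → d₁ }) , [ (λ { refl → d₂ }) , (λ { refl → d₃ }) ]′ ]′ (S⁻ p)
      deg-S : 3 ≤ deg G/Z S d
      deg-S = subst₂ _≤_ (trans (sym (card S)) card-S) (sym (deg-∑ G/Z S d)) (∑-mono (λ e → pt e (e ∈? S)))
        where
        pt : ∀ e → Dec (e ∈ S) → χ S e ≤ term G/Z S d e
        pt e (yes p) = subst (_≤ term G/Z S d e) (sym (χ-∈ p)) (term-pos G/Z p (touch p))
        pt e (no p) = subst (_≤ term G/Z S d e) (sym (χ-∉ p)) z≤n
      fin : ∃[ T ] (S ∩ X ⊆ T × T ⊆ X × Acyclic G/Z T × Spanning G/Z T X) →
            ∃[ T ] (S ∩ Y ⊆ T × T ⊆ Y × Acyclic G/Z T × Spanning G/Z T Y) → False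
      fin (P , S⊆P , P⊆X , acP , spP) (Q , S⊆Q , Q⊆Y , acQ , spQ) = <⇒≱ (begin-strict
        2                                           <⟨ deg-S ⟩
        deg G/Z S d                                 ≡⟨ deg-⊎ G/Z {S} {S ∩ X} {S ∩ Y} (λ {e} p → [ (λ q → inj₁ (x∈p∩q⁺ (p , q))) , (λ q → inj₂ (x∈p∩q⁺ (p , q))) ]′ (cover e))
                                                         (p∩q⊆p S X) (p∩q⊆p S Y) (λ e p q → disj e (p∩q⊆q S X p) (p∩q⊆q S Y q)) d ⟩
        deg G/Z (S ∩ X) d + deg G/Z (S ∩ Y) d       ≤⟨ +-mono-≤ (deg-mono G/Z (S ∩ X) P S⊆P d) (deg-mono G/Z (S ∩ Y) Q S⊆Q d) ⟩
        deg G/Z P d + deg G/Z Q d                   ∎) (degrees≤2 P⊆X Q⊆Y acP acQ spP spQ d)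
        where open ≤-Reasoning

    off-U : ∀ {v} → OnV G Z₂ v → v ∉ U
    off-U on p = dZ _ (vertices⁻ G p) on

    -- Induction along the connected quotient: a property that no edge leaves is an uncrossed cut.
    closed-set : ∀ {P : Fin n → Set} → (∀ v → Dec (P v)) →
      (∀ {p q e} → IsEnd G/Z p e → IsEnd G/Z q e → P p → ¬ P q → False) → ∀ {v w} → v ∈ W → w ∈ W → P v → P w
    closed-set {P} P? esc {v} {w} v∈W w∈W pv = true-dec (P? w) (trans (sym (joined/Z (λ x → does (P? x)) nc v∈W w∈W)) (dec-true (P? v) pv))
      where
      nc : NoCross G/Z ⊤ (λ x → does (P? x))
      nc {e} _ = does-⇔ (P? _) (P? _) (λ pp → decidable-stable (P? _) (esc (inj₁ refl) (inj₂ refl) pp))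
                                      (λ pp → decidable-stable (P? _) (esc (inj₂ refl) (inj₁ refl) pp))

    Digon : Set
    Digon = ∃[ g ] ∃[ h ] (g ∈ Z₂ × h ∈ Z₂ × g ≢ h × IsEnd G (end₁ G g) h × IsEnd G (end₂ G g) h)

    -- Otherwise each vertex of `Z₂` already has two distinct neighbours on `Z₂`, so no edge leaves
    -- `Z₂`, while the quotient is connected and `r` is off `Z₂`.
    Z₂-digon : Digon
    Z₂-digon = decidable-stable (any? λ g → any? λ h → (g ∈? Z₂) ×-dec ((h ∈? Z₂) ×-dec (¬? (g ≟ h) ×-dec
                 (isEnd? G (end₁ G g) h ×-dec isEnd? G (end₂ G g) h)))) absurd
      where
      cy₂ = L-cycle Z₂ l₂
      absurd : ¬ Digon → False
      absurd none = off-U (closed-set (onV? G Z₂) esc (∉U⇒∈W (toV on₀) (off-U on₀)) r∈W on₀) r∈U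
        where
        on₀ : OnV G Z₂ (end₁ G (proj₁ (proj₁ cy₂)))
        on₀ = _ , proj₂ (proj₁ cy₂) , inj₁ refl
        esc : ∀ {p q e} → IsEnd G/Z p e → IsEnd G/Z q e → OnV G Z₂ p → ¬ OnV G Z₂ q → False
        esc {p} {q} {e} tp tq onp offq = go (cycle-two-edges G loopless cy₂ onp)
          where
          go : ∃[ g ] ∃[ h ] ∃[ a ] ∃[ b ] (g ≢ h × (g ∈ Z₂ × IsEnd G p g × IsEnd G a g × a ≢ p) × (h ∈ Z₂ × IsEnd G p h × IsEnd G b h × b ≢ p)) → False
          go (g , h , a , b , g≢h , (g∈ , pg , ag , a≢p) , (h∈ , ph , bh , b≢p)) =
            two-neighbours a≢p b≢p (λ { refl → offq onp }) a≢b (λ { refl → offq ona }) (λ { refl → offq onb })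
              (isEnd/Z (off-U onp) pg , isEnd/Z (off-U ona) ag) (isEnd/Z (off-U onp) ph , isEnd/Z (off-U onb) bh) (tp , tq)
            where
            ona : OnV G Z₂ a
            ona = g , g∈ , ag
            onb : OnV G Z₂ b
            onb = h , h∈ , bh
            a≢b : a ≢ b
            a≢b refl = none (g , h , g∈ , h∈ , g≢h , both (inj₁ refl) , both (inj₂ refl))
              where
              both : ∀ {v} → IsEnd G v g → IsEnd G v h
              both t = [ (λ { refl → ph }) , (λ { refl → bh }) ]′ (ends-of G pg ag a≢p t)

    -- At v the cycle D cannot use w, so both its edges lead to the same vertex of G / Z, which must be r.
    arm : ∀ {D v w g} → F D ≡ true → OnV G D v → ¬ OnV G D w → v ∉ U → w ∉ U → v ≢ w → IsEnd G v g → IsEnd G w g →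
          ∃[ e ] (IsEnd G/Z v e × IsEnd G/Z r e)
    arm {D} {v} {w} {g} fD onD offw v∉U w∉U v≢w vg wg = go (cycle-two-edges G loopless cyD onD)
      where
      cyD = F-cycle D fD
      Goal = ∃[ e ] (IsEnd G/Z v e × IsEnd G/Z r e)
      π≢ : ∀ {p x} → x ∉ U → p ≢ x → π p ≢ x
      π≢ {p} x∉U p≢x eq = lem (p ∈? U)
        where
        lem : Dec (p ∈ U) → False
        lem (yes q) = x∉U (subst (_∈ U) (trans (sym (π-∈ q)) eq) r∈U)
        lem (no q) = p≢x (trans (sym (π-∉ q)) eq)
      go : ∃[ e ] ∃[ f ] ∃[ p ] ∃[ q ] (e ≢ f × (e ∈ D × IsEnd G v e × IsEnd G p e × p ≢ v) × (f ∈ D × IsEnd G v f × IsEnd G q f × q ≢ v)) → Goal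
      go (e , f , p , q , e≢f , (e∈ , ve , pe , p≢v) , (f∈ , vf , qf , q≢v)) = pick (p ∈? U)
        where
        πp≡πq : π p ≡ π q
        πp≡πq = decidable-stable (π p ≟ π q) λ ne → two-neighbours (v≢w ∘ sym) (π≢ v∉U p≢v) (π≢ v∉U q≢v)
          (π≢ w∉U (λ { refl → offw (e , e∈ , pe) }) ∘ sym) (π≢ w∉U (λ { refl → offw (f , f∈ , qf) }) ∘ sym) ne
          (isEnd/Z v∉U vg , isEnd/Z w∉U wg) (isEnd/Z v∉U ve , isEnd-collapse G U r pe) (isEnd/Z v∉U vf , isEnd-collapse G U r qf)
        pick : Dec (p ∈ U) → Goal
        pick (yes p∈U) = e , isEnd/Z v∉U ve , subst (λ z → IsEnd G/Z z e) (π-∈ p∈U) (isEnd-collapse G U r pe)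
        -- Here `q` equals `p`, so `D` is a 2-cycle on `v` and `p`, both off `Z₁`; but a cycle of F
        -- meets `Z₁`.
        pick (no p∉U) = ⊥-elim (meet (L-meets-F Z₁ D l₁ fD))
          where
          q≡p : q ≡ p
          q≡p = decidable-stable (q ≟ p) λ ne → π≢ p∉U ne (trans (sym πp≡πq) (π-∉ p∉U))
          only : ∀ {x} → OnV G D x → x ≡ v ⊎ x ≡ p
          only = proj₂ (digon-vertices G cyD e∈ f∈ e≢f p≢v ve pe vf (subst (λ z → IsEnd G z f) q≡p qf))
          meet : ∃[ x ] (OnV G Z₁ x × OnV G D x) → False
          meet (x , onZ , onD) = [ (λ { refl → v∉U (vertices⁺ G onZ) }) , (λ { refl → p∉U (vertices⁺ G onZ) }) ]′ (only onD)

    -- Each corner has its two neighbours among the other corners, so `W` consists of the three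
    -- corners. Two of the three edges lie on the same side, which then connects the quotient.
    triangle : ∀ {v w g e₁ e₂} → v ≢ w → v ∈ W → v ≢ r → w ≢ r → IsEnd G/Z v g × IsEnd G/Z w g →
               IsEnd G/Z v e₁ × IsEnd G/Z r e₁ → IsEnd G/Z w e₂ × IsEnd G/Z r e₂ → False
    triangle {v} {w} {g} {e₁} {e₂} v≢w v∈W v≢r w≢r (vg , wg) (v₁ , r₁) (w₂ , r₂) = colour (cover g) (cover e₁) (cover e₂)
      where
      P : Fin n → Set
      P x = (x ≡ v) ⊎ ((x ≡ w) ⊎ (x ≡ r))
      esc : ∀ {p q e} → IsEnd G/Z p e → IsEnd G/Z q e → P p → ¬ P q → False
      esc tp tq (inj₁ refl) nq = two-neighbours (v≢w ∘ sym) (v≢r ∘ sym) (nq ∘ inj₁) w≢r (λ { refl → nq (inj₂ (inj₁ refl)) })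
        (λ { refl → nq (inj₂ (inj₂ refl)) }) (vg , wg) (v₁ , r₁) (tp , tq)
      esc tp tq (inj₂ (inj₁ refl)) nq = two-neighbours v≢w (w≢r ∘ sym) (nq ∘ inj₂ ∘ inj₁) v≢r (λ { refl → nq (inj₁ refl) })
        (λ { refl → nq (inj₂ (inj₂ refl)) }) (wg , vg) (w₂ , r₂) (tp , tq)
      esc tp tq (inj₂ (inj₂ refl)) nq = two-neighbours v≢r w≢r (nq ∘ inj₂ ∘ inj₂) v≢w (λ { refl → nq (inj₁ refl) })
        (λ { refl → nq (inj₂ (inj₁ refl)) }) (r₁ , v₁) (r₂ , w₂) (tp , tq)
      inP : ∀ {x} → x ∈ W → P x
      inP x∈W = closed-set (λ x → (x ≟ v) ⊎-dec ((x ≟ w) ⊎-dec (x ≟ r))) esc v∈W x∈W (inj₁ refl)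
      join : ∀ S → (∀ c → NoCross G/Z S c → c v ≡ c r × c w ≡ c r) → Joined G/Z S W
      join S h c nc p q = trans (at p) (sym (at q))
        where
        at : ∀ {x} → x ∈ W → c x ≡ c r
        at x∈W = [ (λ { refl → proj₁ (h c nc) }) , [ (λ { refl → proj₂ (h c nc) }) , (λ { refl → refl }) ]′ ]′ (inP x∈W)
      eqg : ∀ {S} → g ∈ S → ∀ c → NoCross G/Z S c → c v ≡ c w
      eqg p c nc = same-ends G/Z {c} {g} (nc p) vg wg
      eq₁ : ∀ {S} → e₁ ∈ S → ∀ c → NoCross G/Z S c → c v ≡ c r
      eq₁ p c nc = same-ends G/Z {c} {e₁} (nc p) v₁ r₁
      eq₂ : ∀ {S} → e₂ ∈ S → ∀ c → NoCross G/Z S c → c w ≡ c r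
      eq₂ p c nc = same-ends G/Z {c} {e₂} (nc p) w₂ r₂
      j12 : ∀ S → e₁ ∈ S → e₂ ∈ S → Joined G/Z S W
      j12 S p q = join S (λ c nc → eq₁ p c nc , eq₂ q c nc)
      jg1 : ∀ S → g ∈ S → e₁ ∈ S → Joined G/Z S W
      jg1 S p q = join S (λ c nc → eq₁ q c nc , trans (sym (eqg p c nc)) (eq₁ q c nc))
      jg2 : ∀ S → g ∈ S → e₂ ∈ S → Joined G/Z S W
      jg2 S p q = join S (λ c nc → trans (eqg p c nc) (eq₂ q c nc) , eq₂ q c nc)
      colour : g ∈ X ⊎ g ∈ Y → e₁ ∈ X ⊎ e₁ ∈ Y → e₂ ∈ X ⊎ e₂ ∈ Y → False
      colour _ (inj₁ p) (inj₁ q) = ¬jX (j12 X p q)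
      colour _ (inj₂ p) (inj₂ q) = ¬jY (j12 Y p q)
      colour (inj₁ p) (inj₁ q) (inj₂ _) = ¬jX (jg1 X p q)
      colour (inj₂ p) (inj₂ q) (inj₁ _) = ¬jY (jg1 Y p q)
      colour (inj₁ p) (inj₂ _) (inj₁ q) = ¬jX (jg2 X p q)
      colour (inj₂ p) (inj₁ _) (inj₂ q) = ¬jY (jg2 Y p q)

    -- `F₁` and `F₂` meet `Z₂` in different vertices, which are therefore the two vertices of the
    -- digon; `arm` joins each of them to `r`.
    absurd : False
    absurd = go Z₂-digon (L-meets-F Z₂ F₁ l₂ f₁) (L-meets-F Z₂ F₂ l₂ f₂)
      where
      go : Digon → ∃[ v ] (OnV G Z₂ v × OnV G F₁ v) → ∃[ w ] (OnV G Z₂ w × OnV G F₂ w) → False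
      go (g , h , g∈ , h∈ , g≢h , t₁ , t₂) (v , vZ , vF) (w , wZ , wF) =
        fin (arm f₁ vF (λ p → dF w p wF) (off-U vZ) (off-U wZ) v≢w (endg vZ) (endg wZ))
            (arm f₂ wF (λ p → dF v vF p) (off-U wZ) (off-U vZ) (v≢w ∘ sym) (endg wZ) (endg vZ))
        where
        v≢w : v ≢ w
        v≢w refl = dF v vF wF
        endg : ∀ {x} → OnV G Z₂ x → IsEnd G x g
        endg on = [ inj₁ ∘ sym , inj₂ ∘ sym ]′ (proj₂ (digon-vertices G (L-cycle Z₂ l₂) g∈ h∈ g≢h (loopless g ∘ sym) (inj₁ refl) (inj₂ refl) t₁ t₂) on)
        ≢r : ∀ {x} → OnV G Z₂ x → x ≢ r
        ≢r on refl = off-U on r∈U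
        fin : ∃[ e ] (IsEnd G/Z v e × IsEnd G/Z r e) → ∃[ e ] (IsEnd G/Z w e × IsEnd G/Z r e) → False
        fin (e₁ , a) (e₂ , b) = triangle v≢w (∉U⇒∈W (toV vZ) (off-U vZ)) (≢r vZ) (≢r wZ)
          (isEnd/Z (off-U vZ) (endg vZ) , isEnd/Z (off-U wZ) (endg wZ)) a b

  -- If X connects G / Z then a spanning forest of X leaves room for at most one edge of Y.
  one-class : Joined G/Z X W → ∀ {y₁ y₂} → y₁ ∈ Y → y₂ ∈ Y → end₁ G/Z y₁ ≢ end₂ G/Z y₁ → end₁ G/Z y₂ ≢ end₂ G/Z y₂ →
              IsEnd G/Z (end₁ G/Z y₁) y₂ × IsEnd G/Z (end₂ G/Z y₁) y₂
  one-class jX {y₁} {y₂} y₁∈ y₂∈ nl₁ nl₂ = decidable-stable (isEnd? G/Z _ y₂ ×-dec isEnd? G/Z _ y₂) λ ¬par →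
    fin ¬par (spanning-forest G/Z X Data.Fin.Subset.⊥ (λ p → ⊥-elim (∉⊥ p)) (λ { R R⊆ ((e , e∈) , _) → ∉⊥ (R⊆ e∈) }))
    where
    S : Subset m
    S = ⁅ y₁ ⁆ ∪ ⁅ y₂ ⁆
    fin : ¬ (IsEnd G/Z (end₁ G/Z y₁) y₂ × IsEnd G/Z (end₂ G/Z y₁) y₂) → ∃[ T ] (Data.Fin.Subset.⊥ ⊆ T × T ⊆ X × Acyclic G/Z T × Spanning G/Z T X) → False
    fin ¬par (T , _ , T⊆X , acT , spT) = <⇒≱ (begin-strict
      ∣ W ∣             ≤⟨ joined-card G/Z T W (λ c nc → jX c (spT c nc)) ⟩
      suc ∣ T ∣         <⟨ ≤-reflexive (trans (+-comm 2 ∣ T ∣) (cong (∣ T ∣ +_) (sym card-S))) ⟩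
      ∣ T ∣ + ∣ S ∣     ∎) (forest-bound T⊆X (∪-lub (⁅⁆⊆ y₁∈) (⁅⁆⊆ y₂∈)) acT acS)
      where
      open ≤-Reasoning
      y₁≢y₂ : y₂ ≢ y₁
      y₁≢y₂ refl = ¬par (inj₁ refl , inj₂ refl)
      card-S : ∣ S ∣ ≡ 2
      card-S = trans (card-+1 (y₁≢y₂ ∘ ⁅⁆⁻)) (cong suc (∣⁅x⁆∣≡1 y₁))
      S⁻ : ∀ {e} → e ∈ S → e ≡ y₁ ⊎ e ≡ y₂
      S⁻ p = [ inj₁ ∘ ⁅⁆⁻ , inj₂ ∘ ⁅⁆⁻ ]′ (∪⁻ p)
      -- The cut around such an end of y₁ is crossed by y₁ only.
      tip : ∃[ p ] (IsEnd G/Z p y₁ × ¬ IsEnd G/Z p y₂)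
      tip with isEnd? G/Z (end₁ G/Z y₁) y₂ | isEnd? G/Z (end₂ G/Z y₁) y₂
      ... | no a | _ = _ , inj₁ refl , a
      ... | yes _ | no b = _ , inj₂ refl , b
      ... | yes a | yes b = ⊥-elim (¬par (a , b))
      acS : Acyclic G/Z S
      acS R R⊆ cyR = go (y₁ ∈? R)
        where
        nc : ∀ c → Same G/Z c y₂ → NoCross G/Z (R ─ ⁅ y₁ ⁆) c
        nc c s {f} f∈ = [ (λ { refl → ⊥-elim (─-∌ f∈) }) , (λ { refl → s }) ]′ (S⁻ (R⊆ (─⁻ˡ f∈)))
        go : Dec (y₁ ∈ R) → False
        go (yes p) = let q , tq , ¬t = tip
                         q' , tq' , ne = otherEnd G/Z tq nl₁
                     in point-crosses G/Z tq tq' ne (cycle-cut G/Z {R} {point G q} cyR p (nc (point G q) (point-untouched G/Z ¬t)))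
        go (no p) = point-crosses G/Z (inj₁ refl) (inj₂ refl) (nl₂ ∘ sym) (cycle-cut G/Z {R} {point G (end₁ G/Z y₂)} cyR y₂∈R
                      (λ {f} f∈ → ⊥-elim ([ (λ { refl → p (─⁻ˡ f∈) }) , (λ { refl → ─-∌ f∈ }) ]′ (S⁻ (R⊆ (─⁻ˡ f∈))))))
          where
          y₂∈R : y₂ ∈ R
          y₂∈R = let e , e∈ = proj₁ cyR in [ (λ { refl → ⊥-elim (p e∈) }) , (λ { refl → e∈ }) ]′ (S⁻ (R⊆ e∈))

-- A side that connects the quotient

∅ : ∀ {k} → Subset k
∅ = Data.Fin.Subset.⊥

forest : ∀ {n m} (G : Graph n m) X → ∃[ T ] (T ⊆ X × Acyclic G T × Spanning G T X)
forest G X = let T , _ , rest = spanning-forest G X ∅ (λ p → ⊥-elim (∉⊥ p)) (λ { R R⊆ ((e , e∈) , _) → ∉⊥ (R⊆ e∈) }) in T , rest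

acyclic-edge : ∀ {n m} (G : Graph n m) {e} → end₁ G e ≢ end₂ G e → Acyclic G ⁅ e ⁆
acyclic-edge G {e} nl = acyclic-bridges G λ f f∈ → bridge f (⁅⁆⁻ f∈)
  where
  bridge : ∀ f → f ≡ e → ∃[ c ] (NoCross G (⁅ e ⁆ ─ ⁅ f ⁆) c × ¬ Same G c f)
  bridge f refl = point G (end₁ G e) , (λ p → ⊥-elim (─⁻ʳ p (─⁻ˡ p))) , point-crosses G (inj₁ refl) (inj₂ refl) (nl ∘ sym)

acyclic-card : ∀ {n m} (G : Graph n m) {S} → Nonempty S → Acyclic G S → ∣ S ∣ < vcount G S
acyclic-card G {S} ne ac = ≰⇒> λ le → let Z , sub , cy = edges≥vertices⇒cycle G S ne le in ac Z sub cy

module Endgame {n m : ℕ} {G : Graph n m} {B L F : Subset m → Bool} (K : Setting G B L F) where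
  open Setting K
  open QuasiBiased qb
  open Quotient K

  Par : Fin m → Fin m → Set
  Par a b = IsEnd G (end₁ G a) b × IsEnd G (end₂ G a) b

  Connects : Subset m → Set
  Connects S = ∀ c → NoCross G S c → ∀ {v w} → v ∈ V → w ∈ V → c v ≡ c w

  on-V : ∀ {v e} → IsEnd G v e → v ∈ V
  on-V {e = e} t = vertices⁺ G (e , ∈⊤ , t)

  -- A cut that is constant on `U` factors through the quotient, so connectedness of the quotient
  -- controls it in the graph.
  spans : ∀ {S} → Joined G/Z S W → ∀ c → NoCross G S c → (∀ {v} → v ∈ U → c v ≡ c r) → ∀ {v w} → v ∈ V → w ∈ V → c v ≡ c w
  spans {S} jn c nc cU p q = trans (sym (cπ _)) (trans (jn c (λ {e} e∈ → trans (cπ _) (trans (nc e∈) (sym (cπ _)))) (πW p) (πW q)) (cπ _))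
    where
    cπ : ∀ v → c (π v) ≡ c v
    cπ v = lem (v ∈? U)
      where
      lem : Dec (v ∈ U) → c (π v) ≡ c v
      lem (yes a) = trans (cong c (π-∈ a)) (sym (cU a))
      lem (no a) = cong c (π-∉ a)
    πW : ∀ {v} → v ∈ V → π v ∈ W
    πW {v} v∈V = lem (v ∈? U)
      where
      lem : Dec (v ∈ U) → π v ∈ W
      lem (yes a) = subst (_∈ W) (sym (π-∈ a)) r∈W
      lem (no a) = subst (_∈ W) (sym (π-∉ a)) (∉U⇒∈W v∈V a)

  Z-constant : ∀ c → NoCross G Z₁ c → ∀ {v} → v ∈ U → c v ≡ c r
  Z-constant c nc p = one-sided G {Z₁} {c} (proj₁ (proj₂ cyZ)) nc (vertices⁻ G p) (vertices⁻ G r∈U)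

  connects : ∀ {y} → Joined G/Z X W → y ∈ Z₁ → Z₁ ─ ⁅ y ⁆ ⊆ X → Connects X
  connects {y} jX y∈Z sub c nc = spans jX c nc (Z-constant c ncZ)
    where
    ncZ : NoCross G Z₁ c
    ncZ {e} e∈ = lem (e ≟ y)
      where
      lem : Dec (e ≡ y) → Same G c e
      lem (no ne) = nc (sub (─-≢ e∈ ne))
      lem (yes refl) = cycle-cut G {Z₁} {c} cyZ y∈Z (nc ∘ sub)

  -- An independent subset of X spanning its vertex set would grow to a basis of M inside X.
  full-rank : ∀ {I A s} → I ⊆ X → Ind I → (∀ {e} → e ∈ I → end₁ G e ∈ A × end₂ G e ∈ A) → s ∈ A → A ⊆ V → ∣ A ∣ ≤ ∣ I ∣ →
              (∀ c → NoCross G X c → (∀ {v} → v ∈ A → c v ≡ c s) → ∀ {v w} → v ∈ V → w ∈ V → c v ≡ c w) → False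
  full-rank {I} {A} {s} I⊆X ind inA s∈A A⊆V le sp = go (forest G/A X)
    where
    G/A = collapse G A s
    go : ∃[ T ] (T ⊆ X × Acyclic G/A T × Spanning G/A T X) → False
    go (T , T⊆X , acT , spT) = <⇒≱ (boundX (∪-lub I⊆X T⊆X) (extend-indep G B L F qb s∈A inA ind acT)) (begin
      ∣ V ∣                    ≡⟨ card-⊎ {A = A} {V ─ A} split-─ A⊆V ─⁻ˡ (λ e p q → ─⁻ʳ q p) ⟩
      ∣ A ∣ + ∣ V ─ A ∣        ≤⟨ +-mono-≤ le (s≤s⁻¹ (subst (_≤ suc ∣ T ∣) (card-+1 {S = V ─ A} (λ p → ─⁻ʳ p s∈A)) (joined-card G/A T ((V ─ A) ∪ ⁅ s ⁆) jn))) ⟩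
      ∣ I ∣ + ∣ T ∣            ≡⟨ card-∪ (extend-disjoint G B L F qb inA acT) ⟨
      ∣ I ∪ T ∣                ∎)
      where
      open ≤-Reasoning
      fixed : ∀ {v} → v ∈ (V ─ A) ∪ ⁅ s ⁆ → v ∈ V × proj G A s v ≡ v
      fixed p = [ (λ q → ─⁻ˡ q , proj-∉ G A s (─⁻ʳ q)) , (λ q → subst (λ z → z ∈ V × proj G A s z ≡ z) (sym (⁅⁆⁻ q)) (A⊆V s∈A , proj-∈ G A s s∈A)) ]′ (∪⁻ p)
      jn : Joined G/A T ((V ─ A) ∪ ⁅ s ⁆)
      jn c nc p q = trans (cong c (sym (proj₂ (fixed p)))) (trans
        (sp (c ∘ proj G A s) (spT c nc) (λ v∈A → cong c (trans (proj-∈ G A s v∈A) (sym (proj-∈ G A s s∈A)))) (proj₁ (fixed p)) (proj₁ (fixed q)))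
        (cong c (proj₂ (fixed q))))

  -- An unbalanced cycle is independent with as many edges as vertices, so it can serve as the set
  -- `I` of `full-rank`.
  unbalanced-full-rank : ∀ {Q} → Q ⊆ X → Cycle G Q → B Q ≡ false →
    (∀ c → NoCross G X c → (∀ {v w} → OnV G Q v → OnV G Q w → c v ≡ c w) → ∀ {v w} → v ∈ V → w ∈ V → c v ≡ c w) → False
  unbalanced-full-rank {Q} Q⊆X cy@((e , e∈) , _) b sp =
    full-rank Q⊆X (unbalanced-indep G B L F qb cy b) (λ {f} f∈ → vertices⁺ G (f , f∈ , inj₁ refl) , vertices⁺ G (f , f∈ , inj₂ refl))
      (vertices⁺ G (e , e∈ , inj₁ refl)) (toV ∘ vertices⁻ G)
      (≤-reflexive (trans (card-vertices G Q) (sym (cycle-card G cy))))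
      (λ c nc h → sp c nc (λ p q → trans (h (vertices⁺ G p)) (sym (h (vertices⁺ G q)))))

  -- Otherwise `Z₁` is an unbalanced cycle inside X, and X would have full rank.
  Z-meets-Y : Joined G/Z X W → ∃[ y ] (y ∈ Z₁ × y ∈ Y)
  Z-meets-Y jX = decidable-stable (any? (λ e → (e ∈? Z₁) ×-dec (e ∈? Y))) λ none →
    unbalanced-full-rank (λ {e} p → [ id , (λ q → ⊥-elim (none (e , p , q))) ]′ (cover e)) cyZ (L-unbalanced G B L F qb l₁)
      (λ c nc h → spans jX c nc (λ p → h (vertices⁻ G p) (vertices⁻ G r∈U)))

  nonloop : ∀ {e v} → IsEnd G v e → v ∉ U → end₁ G/Z e ≢ end₂ G/Z e
  nonloop {e} t v∉U eq = lem t
    where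
    sep : ∀ {p q} → p ∉ U → p ≢ q → π p ≢ π q
    sep {p} {q} p∉U ne eq = go (q ∈? U)
      where
      go : Dec (q ∈ U) → False
      go (yes a) = p∉U (subst (_∈ U) (sym (trans (sym (π-∉ p∉U)) (trans eq (π-∈ a)))) r∈U)
      go (no a) = ne (trans (sym (π-∉ p∉U)) (trans eq (π-∉ a)))
    lem : IsEnd G _ e → False
    lem (inj₁ refl) = sep v∉U (loopless e) eq
    lem (inj₂ refl) = sep v∉U (loopless e ∘ sym) (sym eq)

  parallel : Joined G/Z X W → ∀ {y e v} → y ∈ Y → e ∈ Y → end₁ G y ∉ U → end₂ G y ∉ U → IsEnd G v e → v ∉ U → Par y e
  parallel jX {y} {e} y∈ e∈ n₁ n₂ t v∉U = up n₁ (proj₁ par) , up n₂ (proj₂ par)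
    where
    par = one-class jX y∈ e∈ (nonloop {y} (inj₁ refl) n₁) (nonloop {e} t v∉U)
    up : ∀ {p} → p ∉ U → IsEnd G/Z (π p) e → IsEnd G p e
    up {p} p∉U t = collapse-isEnd G U r (λ { refl → p∉U r∈U }) (subst (λ z → IsEnd G/Z z e) (π-∉ p∉U) t)

  par-end : ∀ {a b v} → Par a b → IsEnd G v a → IsEnd G v b
  par-end (p , q) (inj₁ refl) = p
  par-end (p , q) (inj₂ refl) = q

  -- The bound on X holds once Y has rank 3; then X does not connect G, so Z₁ has a second edge in Y.
  Z-digon : Joined G/Z X W → (∀ {I} → I ⊆ X → Ind I → suc ∣ I ∣ < ∣ V ∣) → ∀ {y} → y ∈ Z₁ → y ∈ Y →
            (∀ {e} → e ∈ Z₁ → e ∈ Y → Par y e) → ∀ {v} → OnV G Z₁ v → IsEnd G v y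
  Z-digon jX small {y} y∈Z y∈Y cls = second (any? (λ e → (e ∈? Z₁) ×-dec ((e ∈? Y) ×-dec ¬? (e ≟ y))))
    where
    second : Dec (∃[ e ] (e ∈ Z₁ × e ∈ Y × e ≢ y)) → ∀ {v} → OnV G Z₁ v → IsEnd G v y
    second (yes (e , e∈Z , e∈Y , ne)) on = [ inj₁ ∘ sym , inj₂ ∘ sym ]′
      (proj₂ (digon-vertices G cyZ y∈Z e∈Z (ne ∘ sym) (loopless y ∘ sym) (inj₁ refl) (inj₂ refl) (proj₁ (cls e∈Z e∈Y)) (proj₂ (cls e∈Z e∈Y))) on)
    second (no none) = ⊥-elim (go (forest G X))
      where
      con : Connects X
      con = connects jX y∈Z (λ {e} p → [ id , (λ q → ⊥-elim (none (e , ─⁻ˡ p , q , λ { refl → ─-∌ p }))) ]′ (cover e))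
      go : ∃[ T ] (T ⊆ X × Acyclic G T × Spanning G T X) → False
      go (T , T⊆X , acT , spT) = <⇒≱ (small T⊆X (acyclic-indep G B L F qb acT)) (joined-card G T V (λ c nc → con c (spT c nc)))

  balanced-in-X : Connects X → ∀ {Q} → Q ⊆ X → Cycle G Q → B Q ≡ true
  balanced-in-X con {Q} Q⊆X cy = decidable-stable (B Q Boolₚ.≟ true) λ nb → unbalanced-full-rank Q⊆X cy (Boolₚ.¬-not nb) (λ c nc _ → con c nc)

  -- The witness is `Z₁` with a forest `T` of `S` in the quotient. Adding `x` to `T` joins `W`, so
  -- `∣ W ∣` is at most `∣ T ∣ + 2`; `card-W` turns this into a rank of at least `∣ V ∣ - 1`.
  enlarge : ∀ {S x y} → y ∈ Z₁ → Z₁ ─ ⁅ y ⁆ ⊆ S → x ∉ S → Connects (S ∪ ⁅ x ⁆) →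
            ∃[ J ] (J ⊆ S ∪ ⁅ y ⁆ × Ind J × ∣ V ∣ ≤ suc ∣ J ∣)
  enlarge {S} {x} {y} y∈Z sub x∉S con = go (forest G/Z S)
    where
    go : ∃[ T ] (T ⊆ S × Acyclic G/Z T × Spanning G/Z T S) → ∃[ J ] (J ⊆ S ∪ ⁅ y ⁆ × Ind J × ∣ V ∣ ≤ suc ∣ J ∣)
    go (T , T⊆S , acT , spT) = Z₁ ∪ T , ∪-lub inZ (∪ˡ ∘ T⊆S) , forest-indep acT , s≤s⁻¹ (begin
      suc ∣ V ∣                    ≡⟨ card-W ⟨
      ∣ W ∣ + ∣ Z₁ ∣               ≤⟨ +-monoˡ-≤ ∣ Z₁ ∣ (joined-card G/Z (T ∪ ⁅ x ⁆) W jn) ⟩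
      suc ∣ T ∪ ⁅ x ⁆ ∣ + ∣ Z₁ ∣   ≡⟨ cong (λ z → suc z + ∣ Z₁ ∣) (card-+1 (x∉S ∘ T⊆S)) ⟩
      suc (suc (∣ T ∣ + ∣ Z₁ ∣))   ≡⟨ cong (2 +_) (trans (+-comm ∣ T ∣ ∣ Z₁ ∣) (sym (card-∪ (forest-disjoint acT)))) ⟩
      suc (suc ∣ Z₁ ∪ T ∣)         ∎)
      where
      open ≤-Reasoning
      inZ : Z₁ ⊆ S ∪ ⁅ y ⁆
      inZ {e} p = [ (λ q → ∪ʳ q) , (λ q → ∪ˡ (sub q)) ]′ (split-─ {A = ⁅ y ⁆} p)
      jn : Joined G/Z (T ∪ ⁅ x ⁆) W
      jn c nc p q = trans (cong c (sym (proj₂ (W-fixed p)))) (trans (con (c ∘ π)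
        (λ e∈ → [ spT c (nc ∘ ∪ˡ) , (λ z → nc (∪ʳ z)) ]′ (∪⁻ e∈)) (proj₁ (W-fixed p)) (proj₁ (W-fixed q))) (cong c (proj₂ (W-fixed q))))

-- The two disjoint cycles of L together

module BothCycles {n m : ℕ} {G : Graph n m} {B L F : Subset m → Bool} (K : Setting G B L F) where
  open Setting K
  open QuasiBiased qb
  module K₁ = Quotient K
  module K₂ = Quotient (swapZ K)
  module E₁ = Endgame K
  module E₂ = Endgame (swapZ K)
  open K₁ using (V; Ind; Circuit)
  open E₁ using (Par; par-end; Connects; on-V)

  disjoint-U : ∀ {v} → v ∈ K₁.U → v ∉ K₂.U
  disjoint-U p q = dZ _ (vertices⁻ G p) (vertices⁻ G q)

  module BothX (j₁ : Joined K₁.G/Z X K₁.W) (j₂ : Joined K₂.G/Z X K₂.W) {y₁ y₂ : Fin m}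
               (y₁∈Z : y₁ ∈ Z₁) (y₁∈Y : y₁ ∈ Y) (y₂∈Z : y₂ ∈ Z₂) (y₂∈Y : y₂ ∈ Y) where

    in₁ : ∀ {v} → IsEnd G v y₁ → v ∈ K₁.U
    in₁ t = vertices⁺ G (y₁ , y₁∈Z , t)

    in₂ : ∀ {v} → IsEnd G v y₂ → v ∈ K₂.U
    in₂ t = vertices⁺ G (y₂ , y₂∈Z , t)

    off₁ : ∀ {v} → IsEnd G v y₂ → v ∉ K₁.U
    off₁ t p = disjoint-U p (in₂ t)

    off₂ : ∀ {v} → IsEnd G v y₁ → v ∉ K₂.U
    off₂ t p = disjoint-U (in₁ t) p

    -- The first end of `e` is off one of the two cycles. In the quotient by that cycle `e` is no
    -- loop, so it is parallel to the edge of Y on the other cycle.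
    classes : ∀ {e} → e ∈ Y → Par y₁ e ⊎ Par y₂ e
    classes {e} e∈Y = lem (end₁ G e ∈? K₁.U)
      where
      lem : Dec (end₁ G e ∈ K₁.U) → Par y₁ e ⊎ Par y₂ e
      lem (no p) = inj₂ (E₁.parallel j₁ {v = end₁ G e} y₂∈Y e∈Y (off₁ (inj₁ refl)) (off₁ (inj₂ refl)) (inj₁ refl) p)
      lem (yes p) = inj₁ (E₂.parallel j₂ {v = end₁ G e} y₁∈Y e∈Y (off₂ (inj₁ refl)) (off₂ (inj₂ refl)) (inj₁ refl) (disjoint-U p))

    -- Three elements of Y: rank 3, so both Z₁ and Z₂ are 2-cycles in Y and F₁ ∪ F₂ lies in X.
    three-in-Y : (∀ {I} → I ⊆ X → Ind I → suc ∣ I ∣ < ∣ V ∣) → False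
    three-in-Y small = E₁.full-rank {F₁ ∪ F₂} {A} (∪-lub (inX F₁ F₂ f₂ dF) (inX F₂ F₁ f₁ (λ v p q → dF v q p)))
        (disjoint-F-indep G B L F qb f₁ f₂ dF) (λ {f} f∈ → vertices⁺ G (f , f∈ , inj₁ refl) , vertices⁺ G (f , f∈ , inj₂ refl))
        s∈A (K₁.toV ∘ vertices⁻ G) count
        (λ c nc h → E₁.spans j₁ c nc (λ p → trans (h (Z₁-in-A p)) (sym (h (Z₁-in-A K₁.r∈U)))))
      where
      A : Subset n
      A = vertices G (F₁ ∪ F₂)
      dig₁ : ∀ {v} → OnV G Z₁ v → IsEnd G v y₁
      dig₁ = E₁.Z-digon j₁ small y₁∈Z y₁∈Y (λ {e} e∈Z e∈Y → [ id , (λ p → ⊥-elim (off₁ (inj₁ refl) (vertices⁺ G (e , e∈Z , proj₁ p)))) ]′ (classes e∈Y))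
      dig₂ : ∀ {v} → OnV G Z₂ v → IsEnd G v y₂
      dig₂ = E₂.Z-digon j₂ small y₂∈Z y₂∈Y (λ {e} e∈Z e∈Y → [ (λ p → ⊥-elim (off₂ (inj₁ refl) (vertices⁺ G (e , e∈Z , proj₁ p)))) , id ]′ (classes e∈Y))
      -- An edge of `D` in Y would be parallel to `y₁` or `y₂`, so it would cover every vertex of
      -- `Z₁` or of `Z₂`; but `E` meets both cycles and is disjoint from `D`.
      inX : ∀ D E → F E ≡ true → VertexDisjoint G D E → D ⊆ X
      inX D E fE vd {e} e∈D = [ id , (λ e∈Y → ⊥-elim ([ hit Z₁ l₁ y₁ dig₁ , hit Z₂ l₂ y₂ dig₂ ]′ (classes e∈Y))) ]′ (cover e)
        where
        hit : ∀ Z → L Z ≡ true → ∀ y → (∀ {v} → OnV G Z v → IsEnd G v y) → Par y e → False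
        hit Z l y dig par = let v , onZ , onE = L-meets-F Z E l fE in vd v (e , e∈D , par-end par (dig onZ)) onE
      s∈A : end₁ G (proj₁ (proj₁ (F-cycle F₁ f₁))) ∈ A
      s∈A = vertices⁺ G (_ , ∪ˡ (proj₂ (proj₁ (F-cycle F₁ f₁))) , inj₁ refl)
      dis : Disjoint F₁ F₂
      dis e p q = dF _ (e , p , inj₁ refl) (e , q , inj₁ refl)
      count : ∣ A ∣ ≤ ∣ F₁ ∪ F₂ ∣
      count = begin
        ∣ A ∣                              ≡⟨ card-vertices G (F₁ ∪ F₂) ⟩
        vcount G (F₁ ∪ F₂)                 ≤⟨ ∑-mono (λ v → subst (λ z → sgn z ≤ sgn (deg G F₁ v) + sgn (deg G F₂ v)) (sym (deg-⊎ G {F₁ ∪ F₂} {F₁} {F₂} ∪⁻ ∪ˡ ∪ʳ dis v)) (sgn-+ (deg G F₁ v) (deg G F₂ v))) ⟩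
        ∑ (λ v → sgn (deg G F₁ v) + sgn (deg G F₂ v)) ≡⟨ ∑-+ (λ v → sgn (deg G F₁ v)) (λ v → sgn (deg G F₂ v)) ⟩
        vcount G F₁ + vcount G F₂          ≡⟨ cong₂ _+_ (cycle-card G (F-cycle F₁ f₁)) (cycle-card G (F-cycle F₂ f₂)) ⟨
        ∣ F₁ ∣ + ∣ F₂ ∣                    ≡⟨ card-∪ dis ⟨
        ∣ F₁ ∪ F₂ ∣                        ∎
        where
        open ≤-Reasoning
        sgn-+ : ∀ a b → sgn (a + b) ≤ sgn a + sgn b
        sgn-+ zero b = ≤-refl
        sgn-+ (suc a) b = s≤s z≤n
      -- `F₁` and `F₂` meet `Z₁` in different vertices, and all vertices of `Z₁` are ends of `y₁`.
      Z₁-in-A : ∀ {v} → v ∈ K₁.U → v ∈ A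
      Z₁-in-A p = go (L-meets-F Z₁ F₁ l₁ f₁) (L-meets-F Z₁ F₂ l₁ f₂)
        where
        go : ∃[ a ] (OnV G Z₁ a × OnV G F₁ a) → ∃[ b ] (OnV G Z₁ b × OnV G F₂ b) → _ ∈ A
        go (a , aZ , aF) (b , bZ , bF) = [ (λ { refl → vertices⁺ G (OnV-mono G ∪ˡ aF) }) , (λ { refl → vertices⁺ G (OnV-mono G ∪ʳ bF) }) ]′
          (ends-of G (dig₁ aZ) (dig₁ bZ) (λ { refl → dF b aF bF }) (dig₁ (vertices⁻ G p)))

    -- A simple matroid makes the parallel pair `a`, `b` independent, and `z` is no loop once their
    -- common ends are identified. So Y has rank at least 3, which tightens the bound on X by the 3
    -- counted here.
    rank-three : ∀ {a b z} → a ∈ Y → b ∈ Y → z ∈ Y → b ≢ a → Par a b → (∀ {v} → IsEnd G v z → ¬ IsEnd G v a) →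
                 ∀ {I} → I ⊆ X → Ind I → suc ∣ I ∣ < ∣ V ∣
    rank-three {a} {b} {z} a∈ b∈ z∈ b≢a par apart {I} I⊆X indI = s≤s⁻¹ (subst (_≤ suc ∣ V ∣) (trans (cong (∣ I ∣ +_) card-J) (+-comm ∣ I ∣ 3))
        (bound I⊆X (∪-lub (∪-lub (⁅⁆⊆ a∈) (⁅⁆⊆ b∈)) (⁅⁆⊆ z∈)) indI indJ))
      where
      A : Subset n
      A = ⁅ end₁ G a ⁆ ∪ ⁅ end₂ G a ⁆
      s = end₁ G a
      inA : ∀ {v} → IsEnd G v a → v ∈ A
      inA (inj₁ refl) = ∪ˡ (x∈⁅x⁆ _)
      inA (inj₂ refl) = ∪ʳ (x∈⁅x⁆ _)
      A⁻ : ∀ {v} → v ∈ A → IsEnd G v a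
      A⁻ p = [ (λ q → inj₁ (sym (⁅⁆⁻ q))) , (λ q → inj₂ (sym (⁅⁆⁻ q))) ]′ (∪⁻ p)
      back : ∀ {v} → IsEnd G v b → v ∈ A
      back t = [ (λ { refl → inA (inj₁ refl) }) , (λ { refl → inA (inj₂ refl) }) ]′ (ends-of G (proj₁ par) (proj₂ par) (loopless a ∘ sym) t)
      ends-in : ∀ {e} → e ∈ ⁅ a ⁆ ∪ ⁅ b ⁆ → end₁ G e ∈ A × end₂ G e ∈ A
      ends-in p = [ (λ q → subst (λ e → end₁ G e ∈ A × end₂ G e ∈ A) (sym (⁅⁆⁻ q)) (inA (inj₁ refl) , inA (inj₂ refl))) ,
                    (λ q → subst (λ e → end₁ G e ∈ A × end₂ G e ∈ A) (sym (⁅⁆⁻ q)) (back (inj₁ refl) , back (inj₂ refl))) ]′ (∪⁻ p)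
      acz : Acyclic (collapse G A s) ⁅ z ⁆
      acz = acyclic-edge (collapse G A s) λ eq → loopless z (trans (sym (proj-∉ G A s (apart (inj₁ refl) ∘ A⁻))) (trans eq (proj-∉ G A s (apart (inj₂ refl) ∘ A⁻))))
      indJ : Ind ((⁅ a ⁆ ∪ ⁅ b ⁆) ∪ ⁅ z ⁆)
      indJ = extend-indep G B L F qb (inA (inj₁ refl)) ends-in (pairs a b) acz
      card-J : ∣ (⁅ a ⁆ ∪ ⁅ b ⁆) ∪ ⁅ z ⁆ ∣ ≡ 3
      card-J = trans (card-+1 (λ p → extend-disjoint G B L F qb {A} {s} ends-in acz z p (x∈⁅x⁆ z)))
                 (cong suc (trans (card-+1 (b≢a ∘ ⁅⁆⁻)) (cong suc (∣⁅x⁆∣≡1 a))))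

    third : ∀ {e} → e ∈ Y → e ≢ y₁ → e ≢ y₂ → False
    third e∈Y ne₁ ne₂ = three-in-Y ([ (λ p {I} → rank-three y₁∈Y e∈Y y₂∈Y ne₁ p (λ t q → off₂ q (in₂ t)) {I}) ,
                                       (λ p {I} → rank-three y₂∈Y e∈Y y₁∈Y ne₂ p (λ t q → off₁ q (in₁ t)) {I}) ]′ (classes e∈Y))

    only-Y : ∀ {e} → e ∈ Y → e ≡ y₁ ⊎ e ≡ y₂
    only-Y {e} e∈Y = lem (e ≟ y₁) (e ≟ y₂)
      where
      lem : Dec (e ≡ y₁) → Dec (e ≡ y₂) → e ≡ y₁ ⊎ e ≡ y₂
      lem (yes p) _ = inj₁ p
      lem (no _) (yes p) = inj₂ p
      lem (no p) (no q) = ⊥-elim (third e∈Y p q)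

    Z₁-rest : Z₁ ─ ⁅ y₁ ⁆ ⊆ X
    Z₁-rest {e} p = [ id , (λ q → ⊥-elim ([ (λ { refl → ─-∌ p }) , (λ { refl → off₁ (inj₁ refl) (proj₁ (K₁.inU (─⁻ˡ p))) }) ]′ (only-Y q))) ]′ (cover e)

    Z₂-rest : Z₂ ─ ⁅ y₂ ⁆ ⊆ X
    Z₂-rest {e} p = [ id , (λ q → ⊥-elim ([ (λ { refl → off₂ (inj₁ refl) (proj₁ (K₂.inU (─⁻ˡ p))) }) , (λ { refl → ─-∌ p }) ]′ (only-Y q))) ]′ (cover e)

    conX : Connects X
    conX = E₁.connects j₁ y₁∈Z Z₁-rest

    balX : ∀ {Q} → Q ⊆ X → Cycle G Q → B Q ≡ true
    balX = E₁.balanced-in-X conX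

    S₀ : Subset m
    S₀ = (Z₁ ─ ⁅ y₁ ⁆) ∪ (Z₂ ─ ⁅ y₂ ⁆)

    S₀⊆X : S₀ ⊆ X
    S₀⊆X = ∪-lub Z₁-rest Z₂-rest

    S₀-acyclic : Acyclic G S₀
    S₀-acyclic R R⊆ cyR = [ (λ { refl → disj y₁ (S₀⊆X (R⊆ y₁∈Z)) y₁∈Y }) , (λ { refl → disj y₂ (S₀⊆X (R⊆ y₂∈Z)) y₂∈Y }) ]′
      (cycle-in-union G B L F qb K₁.cyZ K₂.cyZ dZ cyR (λ p → [ ∪ˡ ∘ ─⁻ˡ , ∪ʳ ∘ ─⁻ˡ ]′ (∪⁻ (R⊆ p))))

    -- {y₁, y₂} is a series pair and X is balanced: contract the two sides of the bridge x of a spanning tree T of X.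
    module Series {T : Subset m} (S₀⊆T : S₀ ⊆ T) (T⊆X : T ⊆ X) (spT : Spanning G T X)
                  {x : Fin m} (x∈T : x ∈ T) (x∉S₀ : x ∉ S₀) {A : Cut n} (ncA : NoCross G (T ─ ⁅ x ⁆) A) (xA : ¬ Same G A x) where

      Φ : Subset m
      Φ = ⟪ (λ e → lookup X e ∧ does (same? G A e)) ⟫

      Φ⁺ : ∀ {e} → e ∈ X → Same G A e → e ∈ Φ
      Φ⁺ {e} p q = ⟪⟫⁺ (cong₂ _∧_ (∈⇒lookup p) (dec-true (same? G A e) q))

      Φ⁻ : ∀ {e} → e ∈ Φ → e ∈ X × Same G A e
      Φ⁻ {e} p = lem (lookup X e) (same? G A e) refl (⟪⟫⁻ {f = λ e → lookup X e ∧ does (same? G A e)} p)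
        where
        lem : ∀ b (d : Dec (Same G A e)) → lookup X e ≡ b → b ∧ does d ≡ true → e ∈ X × Same G A e
        lem true (yes s) eq _ = lookup⇒∈ eq , s

      T⊆Φ : T ─ ⁅ x ⁆ ⊆ Φ
      T⊆Φ p = Φ⁺ (T⊆X (─⁻ˡ p)) (ncA p)

      x∈X : x ∈ X
      x∈X = T⊆X x∈T

      x∉Φ : x ∉ Φ
      x∉Φ p = xA (proj₂ (Φ⁻ p))

      S₀⊆Φ : S₀ ⊆ Φ
      S₀⊆Φ p = T⊆Φ (─-≢ (S₀⊆T p) (λ { refl → x∉S₀ p }))

      y₂A : Same G A y₂
      y₂A = cycle-cut G {Z₂} {A} K₂.cyZ y₂∈Z (λ p → proj₂ (Φ⁻ (S₀⊆Φ (∪ʳ p))))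

      conΦx : Connects (Φ ∪ ⁅ x ⁆)
      conΦx c nc = conX c (spT c (λ {e} e∈ → [ (λ q → nc (∪ʳ q)) , (λ q → nc (∪ˡ (T⊆Φ q))) ]′ (split-─ {A = ⁅ x ⁆} e∈)))

      -- Recolour everything off the side of `p` with `c p`. The new cut is crossed neither by
      -- `T ─ ⁅ x ⁆` nor by `x`, so it is constant, and on the side of `p` it is `c`.
      side : ∀ c → NoCross G (T ─ ⁅ x ⁆) c → ∀ {p} → IsEnd G p x → ∀ {v w} → v ∈ V → w ∈ V → A v ≡ A p → A w ≡ A p → c v ≡ c w
      side c nc {p} tp {v} {w} v∈ w∈ av aw = trans (sym (d-on av)) (trans (conX d (spT d ncd) v∈ w∈) (d-on aw))
        where
        d : Cut n
        d u = if does (A u Boolₚ.≟ A p) then c u else c p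
        d-on : ∀ {u} → A u ≡ A p → d u ≡ c u
        d-on {u} eq rewrite dec-true (A u Boolₚ.≟ A p) eq = refl
        d-off : ∀ {u} → A u ≢ A p → d u ≡ c p
        d-off {u} ne rewrite dec-false (A u Boolₚ.≟ A p) ne = refl
        ncd : NoCross G T d
        ncd {e} e∈ = lem (e ≟ x)
          where
          lem : Dec (e ≡ x) → Same G d e
          lem (no ne) = lem' (A (end₁ G e) Boolₚ.≟ A p)
            where
            e∈' = ─-≢ e∈ ne
            lem' : Dec (A (end₁ G e) ≡ A p) → Same G d e
            lem' (yes q) = trans (d-on q) (trans (nc e∈') (sym (d-on (trans (sym (ncA e∈')) q))))
            lem' (no q) = trans (d-off q) (sym (d-off (λ z → q (trans (ncA e∈') z))))
          lem (yes refl) = go (otherEnd G tp (loopless x))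
            where
            go : ∃[ q ] (IsEnd G q x × q ≢ p) → Same G d x
            go (q , tq , q≢p) = ends-same G {d} tp tq q≢p (trans (d-on refl) (sym (d-off (λ eq → xA (ends-same G {A} tp tq q≢p (sym eq))))))

      linked-sides : ∀ c → NoCross G Φ c → ∀ {v w} → v ∈ V → w ∈ V → A v ≡ A w → c v ≡ c w
      linked-sides c nc {v} {w} v∈ w∈ eq = lem (A v Boolₚ.≟ A (end₁ G x))
        where
        lem : Dec (A v ≡ A (end₁ G x)) → c v ≡ c w
        lem (yes p) = side c (nc ∘ T⊆Φ) (inj₁ refl) v∈ w∈ p (trans (sym eq) p)
        lem (no p) = side c (nc ∘ T⊆Φ) (inj₂ refl) v∈ w∈ q (trans (sym eq) q)
          where
          q : A v ≡ A (end₂ G x)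
          q = trans (Boolₚ.¬-not p) (sym (Boolₚ.¬-not (xA ∘ sym)))

      -- `Φ` connects each side of `A`, so any two edges across `A` become parallel when `Φ` is
      -- contracted.
      cross-link : ∀ {a b} → ¬ Same G A a → ¬ Same G A b → Linked G (Φ ∪ ⁅ b ⁆) (end₁ G a) (end₂ G a)
      cross-link {a} {b} na nb c nc = lem (A (end₁ G a) Boolₚ.≟ A (end₁ G b))
        where
        other : ∀ {p q u w : Bool} → p ≢ q → u ≢ w → p ≡ u → q ≡ w
        other pq uw eq = trans (Boolₚ.¬-not (pq ∘ sym)) (trans (cong not eq) (sym (Boolₚ.¬-not (uw ∘ sym))))
        ls : ∀ {v w} → v ∈ V → w ∈ V → A v ≡ A w → c v ≡ c w
        ls = linked-sides c (nc ∘ ∪ˡ)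
        sb : Same G c b
        sb = nc (∪ʳ (x∈⁅x⁆ b))
        va₁ = on-V {e = a} (inj₁ refl)
        va₂ = on-V {e = a} (inj₂ refl)
        vb₁ = on-V {e = b} (inj₁ refl)
        vb₂ = on-V {e = b} (inj₂ refl)
        lem : Dec (A (end₁ G a) ≡ A (end₁ G b)) → Same G c a
        lem (yes p) = trans (ls va₁ vb₁ p) (trans sb (sym (ls va₂ vb₂ (other na nb p))))
        lem (no p) = trans (ls va₁ vb₂ q) (trans (sym sb) (sym (ls va₂ vb₁ (other na (nb ∘ sym) q))))
          where
          q = trans (Boolₚ.¬-not p) (sym (Boolₚ.¬-not (nb ∘ sym)))

      loose-in-X : ∀ {C e} → Circuit C → C ⊆ X → e ∈ C → NoCross G (C ─ ⁅ e ⁆) A → ¬ Same G A e → False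
      loose-in-X {C} {e} fc C⊆X e∈C nc ns = go (single-crossing⇒loose G B L F qb {C} {A} {e} fc e∈C nc ns)
        where
        go : ∃[ C₁ ] ∃[ C₂ ] (LooseHandcuff G C₁ C₂ C × F C₁ ≡ true × F C₂ ≡ true) → False
        go (C₁ , C₂ , (cy₁ , _ , _ , _ , _ , _ , _ , _ , _ , _ , _ , refl) , fC₁ , _) = BF-disj C₁ (balX (C⊆X ∘ ∪ˡ ∘ ∪ˡ) cy₁) fC₁

      acyclic-in-X : ∀ {I} → I ⊆ X → Ind I → Acyclic G I
      acyclic-in-X I⊆X ind Q Q⊆I cy = ind Q (inj₁ (cy , balX (I⊆X ∘ Q⊆I) cy)) Q⊆I

      -- X is balanced, so independent subsets of `Φ` are forests, and they remain forests when `x`,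
      -- the only edge across `A`, is added. This costs one more unit of rank.
      rank-Φ : ∀ {I} → I ⊆ Φ → Ind I → suc ∣ I ∣ < ∣ V ∣
      rank-Φ {I} I⊆Φ ind = begin-strict
        suc ∣ I ∣                 ≡⟨ card-+1 (x∉Φ ∘ I⊆Φ) ⟨
        ∣ I ∪ ⁅ x ⁆ ∣             <⟨ acyclic-card G (x , ∪ʳ (x∈⁅x⁆ x)) ac ⟩
        vcount G (I ∪ ⁅ x ⁆)      ≤⟨ vcount-mono G (I ∪ ⁅ x ⁆) ⊤ (λ _ → ∈⊤) ⟩
        vcount G ⊤                ≡⟨ card-vertices G ⊤ ⟨
        ∣ V ∣                     ∎
        where
        open ≤-Reasoning
        ac : Acyclic G (I ∪ ⁅ x ⁆)
        ac R R⊆ cy = lem (x ∈? R)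
          where
          lem : Dec (x ∈ R) → False
          lem (yes x∈R) = xA (cycle-cut G {R} {A} cy x∈R (λ p → [ (λ q → proj₂ (Φ⁻ (I⊆Φ q))) , (λ q → ⊥-elim (─⁻ʳ p q)) ]′ (∪⁻ (R⊆ (─⁻ˡ p)))))
          lem (no x∉R) = acyclic-in-X (proj₁ ∘ Φ⁻ ∘ I⊆Φ) ind R (λ {e} p → [ id , (λ q → ⊥-elim (x∉R (subst (_∈ R) (⁅⁆⁻ q) p))) ]′ (∪⁻ (R⊆ p))) cy

      -- An edge of X across `A` could close a circuit only as the bridge of a loose handcuff, which
      -- balance forbids. For `y₁` and `y₂`, `enlarge` gives rank at least `∣ V ∣ - 1`, above the
      -- bound of `rank-Φ`.
      flatΦ : Flat Circuit Φ
      flatΦ = flat⁺ G B L F qb λ e e∉Φ I I⊆Φ ind → [ crossing e e∉Φ I I⊆Φ ind , (λ e∈Y → big e I I⊆Φ ind (only-Y e∈Y)) ]′ (cover e)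
        where
        Goal : Fin m → Subset m → Set
        Goal e I = ∃[ J ] (J ⊆ Φ ∪ ⁅ e ⁆ × Ind J × ∣ I ∣ < ∣ J ∣)
        crossing : ∀ e → e ∉ Φ → ∀ I → I ⊆ Φ → Ind I → e ∈ X → Goal e I
        crossing e e∉Φ I I⊆Φ ind e∈X = I ∪ ⁅ e ⁆ , ∪-lub (∪ˡ ∘ I⊆Φ) ∪ʳ , (λ C fc sub → lem C fc sub (e ∈? C)) , ≤-reflexive (sym (card-+1 (e∉Φ ∘ I⊆Φ)))
          where
          lem : ∀ C → Circuit C → C ⊆ I ∪ ⁅ e ⁆ → Dec (e ∈ C) → False
          lem C fc sub (no e∉C) = ind C fc (λ {f} p → [ id , (λ q → ⊥-elim (e∉C (subst (_∈ C) (⁅⁆⁻ q) p))) ]′ (∪⁻ (sub p)))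
          lem C fc sub (yes e∈C) = loose-in-X fc (λ p → ∪-lub (proj₁ ∘ Φ⁻ ∘ I⊆Φ) (⁅⁆⊆ e∈X) (sub p)) e∈C
            (λ p → [ (λ q → proj₂ (Φ⁻ (I⊆Φ q))) , (λ q → ⊥-elim (─⁻ʳ p q)) ]′ (∪⁻ (sub (─⁻ˡ p)))) (λ s → e∉Φ (Φ⁺ e∈X s))
        finish : ∀ {e} I → I ⊆ Φ → Ind I → ∃[ J ] (J ⊆ Φ ∪ ⁅ e ⁆ × Ind J × ∣ V ∣ ≤ suc ∣ J ∣) → Goal e I
        finish I I⊆Φ ind (J , J⊆ , indJ , le) = J , J⊆ , indJ , s≤s⁻¹ (≤-trans (rank-Φ I⊆Φ ind) le)
        big : ∀ e I → I ⊆ Φ → Ind I → e ≡ y₁ ⊎ e ≡ y₂ → Goal e I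
        big e I I⊆Φ ind (inj₁ refl) = finish I I⊆Φ ind (E₁.enlarge y₁∈Z (S₀⊆Φ ∘ ∪ˡ) x∉Φ conΦx)
        big e I I⊆Φ ind (inj₂ refl) = finish I I⊆Φ ind (E₂.enlarge y₂∈Z (S₀⊆Φ ∘ ∪ʳ) x∉Φ conΦx)

      absurd : False
      absurd = go (ub Φ flatΦ y₂ x (λ p → disj y₂ (proj₁ (Φ⁻ p)) y₂∈Y) x∉Φ (λ { refl → disj y₂ x∈X y₂∈Y }))
        where
        y∉Φ : ∀ {e} → e ∈ Y → e ∉ Φ
        y∉Φ e∈Y p = disj _ (proj₁ (Φ⁻ p)) e∈Y
        go : ∃[ D ] (ContractCircuit Circuit Φ D × y₂ ∈ D × x ∈ D) → False
        go (D , (_ , (C , fc , refl) , mn) , y₂∈D , x∈D) = second (any? (λ z → (z ∈? C) ×-dec (¬? (z ≟ x) ×-dec ¬? (same? G A z))))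
          where
          ZZ : Subset m
          ZZ = Z₁ ∪ Z₂
          fcZ : Circuit ZZ
          fcZ = inj₂ (inj₂ (inj₂ (inj₁ (Z₁ , Z₂ , l₁ , l₂ , K₁.cyZ , K₂.cyZ , dZ , refl))))
          ZZ⁻ : ∀ {e} → e ∈ ZZ → e ∈ Φ ⊎ (e ≡ y₁ ⊎ e ≡ y₂)
          ZZ⁻ p = [ (λ q → [ inj₂ ∘ inj₁ ∘ ⁅⁆⁻ , inj₁ ∘ S₀⊆Φ ∘ ∪ˡ ]′ (split-─ {A = ⁅ y₁ ⁆} q)) ,
                    (λ q → [ inj₂ ∘ inj₂ ∘ ⁅⁆⁻ , inj₁ ∘ S₀⊆Φ ∘ ∪ʳ ]′ (split-─ {A = ⁅ y₂ ⁆} q)) ]′ (∪⁻ p)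
          -- `Z₁ ∪ Z₂` is a circuit whose trace outside `Φ` consists of `y₁` and `y₂`. If `C`
          -- contained both, minimality would make this its whole trace, but `x` belongs to that
          -- trace as well.
          y₁∉C : y₁ ∉ C
          y₁∉C y₁∈C = [ x∉Φ , [ (λ { refl → disj x x∈X y₁∈Y }) , (λ { refl → disj x x∈X y₂∈Y }) ]′ ]′ (ZZ⁻ x∈ZZ)
            where
            into : ∀ {e} → e ∉ Φ → e ∈ Φ ⊎ (e ≡ y₁ ⊎ e ≡ y₂) → e ∈ C ─ Φ
            into ne (inj₁ p) = ⊥-elim (ne p)
            into ne (inj₂ (inj₁ refl)) = ─⁺ y₁∈C ne
            into ne (inj₂ (inj₂ refl)) = y₂∈D
            x∈ZZ : x ∈ ZZ
            x∈ZZ = ─⁻ˡ (subst (x ∈_) (sym (mn ZZ fcZ (y₂ , ─⁺ (∪ʳ y₂∈Z) (y∉Φ y₂∈Y)) (λ p → into (─⁻ʳ p) (ZZ⁻ (─⁻ˡ p))))) x∈D)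
          C⊆ : ∀ {e} → e ∈ C → e ≢ y₂ → e ∈ X
          C⊆ {e} e∈C ne = [ id , (λ q → ⊥-elim ([ (λ { refl → y₁∉C e∈C }) , ne ]′ (only-Y q))) ]′ (cover e)
          second : Dec (∃[ z ] (z ∈ C × z ≢ x × ¬ Same G A z)) → False
          -- A lone crossing at `x` makes `C` a loose handcuff. One of its two disjoint cycles
          -- avoids `y₂`, so it lies in X and is balanced.
          second (no none) = loose (single-crossing⇒loose G B L F qb {C} {A} {x} fc (─⁻ˡ x∈D)
              (λ {f} p → decidable-stable (same? G A f) (λ ns → none (f , ─⁻ˡ p , (λ { refl → ─-∌ p }) , ns))) xA)
            where
            loose : ∃[ C₁ ] ∃[ C₂ ] (LooseHandcuff G C₁ C₂ C × F C₁ ≡ true × F C₂ ≡ true) → False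
            loose (C₁ , C₂ , (cy₁ , cy₂ , vd , _ , _ , _ , _ , _ , _ , _ , _ , C≡) , fC₁ , fC₂) = pick (y₂ ∈? C₁)
              where
              C₁⊆C : C₁ ⊆ C
              C₁⊆C {e} p = subst (e ∈_) (sym C≡) (∪ˡ (∪ˡ p))
              C₂⊆C : C₂ ⊆ C
              C₂⊆C {e} p = subst (e ∈_) (sym C≡) (∪ˡ (∪ʳ p))
              bal : ∀ D → D ⊆ C → Cycle G D → F D ≡ true → y₂ ∉ D → False
              bal D D⊆C cy f ne = BF-disj D (balX (λ {e} p → C⊆ (D⊆C p) (λ { refl → ne p })) cy) f
              pick : Dec (y₂ ∈ C₁) → False
              pick (no ne) = bal C₁ C₁⊆C cy₁ fC₁ ne
              pick (yes p) = bal C₂ C₂⊆C cy₂ fC₂ (λ q → vd _ (y₂ , p , inj₁ refl) (y₂ , q , inj₁ refl))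
          -- With a second crossing edge `z`, there is a balanced cycle through `x` whose trace lies
          -- within `x` and `z`. By minimality it would contain `y₂`, although it lies in X.
          second (yes (z , z∈C , z≢x , nz)) = closed (closing-cycle G (Φ ∪ ⁅ z ⁆) x
              (λ p → [ x∉Φ , (λ q → z≢x (sym (⁅⁆⁻ q))) ]′ (∪⁻ p)) (cross-link xA nz))
            where
            z∈X : z ∈ X
            z∈X = C⊆ z∈C (λ { refl → nz y₂A })
            closed : ∃[ Q ] (Cycle G Q × x ∈ Q × Q ⊆ (Φ ∪ ⁅ z ⁆) ∪ ⁅ x ⁆) → False
            closed (Q , cy , x∈Q , Q⊆) = disj y₂ (Q⊆X y₂∈Q) y₂∈Y
              where
              Q⊆X : Q ⊆ X
              Q⊆X p = ∪-lub (∪-lub (proj₁ ∘ Φ⁻) (⁅⁆⊆ z∈X)) (⁅⁆⊆ x∈X) (Q⊆ p)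
              Q─ : Q ─ Φ ⊆ C ─ Φ
              Q─ {e} p = [ (λ q → [ (λ w → ⊥-elim (─⁻ʳ p w)) , (λ w → ⁅⁆⊆ (─⁺ z∈C (λ v → nz (proj₂ (Φ⁻ v)))) w) ]′ (∪⁻ q)) , ⁅⁆⊆ x∈D ]′ (∪⁻ (Q⊆ (─⁻ˡ p)))
              y₂∈Q : y₂ ∈ Q
              y₂∈Q = ─⁻ˡ (subst (y₂ ∈_) (sym (mn Q (inj₁ (cy , balX Q⊆X cy)) (x , ─⁺ x∈Q x∉Φ) Q─)) y₂∈D)

    -- A tree edge leaving the vertex set of `Z₁` exists because X connects `y₁` with `y₂`. It is
    -- outside `S₀`, because `Z₁` lies inside that vertex set and `Z₂` outside, and as a tree edge
    -- it is the only one across some cut.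
    absurd : False
    absurd = tree (spanning-forest G X S₀ S₀⊆X S₀-acyclic)
      where
      tree : ∃[ T ] (S₀ ⊆ T × T ⊆ X × Acyclic G T × Spanning G T X) → False
      tree (T , S₀⊆T , T⊆X , acT , spT) = edge (any? (λ e → (e ∈? T) ×-dec ¬? (same? G (lookup K₁.U) e)))
        where
        edge : Dec (∃[ x ] (x ∈ T × ¬ Same G (lookup K₁.U) x)) → False
        edge (no none) = contradiction (trans (sym (∈⇒lookup (in₁ (inj₁ refl)))) (trans
            (conX (lookup K₁.U) (spT (lookup K₁.U) (λ {e} p → decidable-stable (same? G (lookup K₁.U) e) (λ ns → none (e , p , ns)))) (on-V {e = y₁} (inj₁ refl)) (on-V {e = y₂} (inj₁ refl)))
            (∉⇒lookup (off₁ (inj₁ refl))))) λ ()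
        edge (yes (x , x∈T , nx)) = cut (separated? G (T ─ ⁅ x ⁆) (end₁ G x) (end₂ G x))
          where
          x∉S₀ : x ∉ S₀
          x∉S₀ p = nx ([ (λ q → trans (∈⇒lookup (proj₁ (K₁.inU (─⁻ˡ q)))) (sym (∈⇒lookup (proj₂ (K₁.inU (─⁻ˡ q)))))) ,
                         (λ q → trans (∉⇒lookup (λ u → disjoint-U u (proj₁ (K₂.inU (─⁻ˡ q))))) (sym (∉⇒lookup (λ u → disjoint-U u (proj₂ (K₂.inU (─⁻ˡ q))))))) ]′ (∪⁻ p))
          cut : (∃[ c ] (NoCross G (T ─ ⁅ x ⁆) c × c (end₁ G x) ≡ true × c (end₂ G x) ≡ false)) ⊎ Linked G (T ─ ⁅ x ⁆) (end₁ G x) (end₂ G x) → False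
          cut (inj₁ (c , nc , p , q)) = Series.absurd S₀⊆T T⊆X spT x∈T x∉S₀ {c} nc (λ s → contradiction (trans (sym p) (trans s q)) λ ())
          cut (inj₂ lk) = let Z , cy , _ , Z⊆ = closing-cycle G (T ─ ⁅ x ⁆) x ─-∌ lk in acT Z (λ p → ∪-lub ─⁻ˡ (⁅⁆⊆ x∈T) (Z⊆ p)) cy

  -- Different sides connect the two quotients

  module Mixed (j₁ : Joined K₁.G/Z X K₁.W) (k₂ : Joined K₂.G/Z Y K₂.W) where

    crossing : ∀ c → (∀ {v} → v ∈ K₁.U → c v ≡ c K₁.r) → ∀ {v w} → v ∈ V → w ∈ V → c v ≢ c w → ∃[ e ] (e ∈ X × ¬ Same G c e)
    crossing c cU v∈ w∈ ne = decidable-stable (any? (λ e → (e ∈? X) ×-dec ¬? (same? G c e))) λ none →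
      ne (E₁.spans j₁ c (λ {e} p → decidable-stable (same? G c e) (λ ns → none (e , p , ns))) cU v∈ w∈)

    U₂-edge : ∃[ x ] (x ∈ X × ¬ Same G (lookup K₂.U) x)
    U₂-edge = crossing (lookup K₂.U) (λ p → trans (∉⇒lookup (disjoint-U p)) (sym (∉⇒lookup (disjoint-U K₁.r∈U)))) (K₂.U⊆V K₂.r∈U) (K₁.U⊆V K₁.r∈U)
      (λ eq → contradiction (trans (sym (∈⇒lookup K₂.r∈U)) (trans eq (∉⇒lookup (disjoint-U K₁.r∈U)))) λ ())

    U₁-edge : ∃[ x ] (x ∈ X × ¬ Same G (lookup K₁.U) x)
    U₁-edge = crossing (lookup K₁.U) (λ p → trans (∈⇒lookup p) (sym (∈⇒lookup K₁.r∈U))) (K₁.U⊆V K₁.r∈U) (K₂.U⊆V K₂.r∈U)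
      (λ eq → contradiction (trans (sym (∈⇒lookup K₁.r∈U)) (trans eq (∉⇒lookup (λ q → disjoint-U q K₂.r∈U)))) λ ())

    crossing-ends : ∀ {U : Subset n} {e} → ¬ Same G (lookup U) e → ∃[ s ] ∃[ p ] (IsEnd G s e × IsEnd G p e × s ∈ U × p ∉ U)
    crossing-ends {U} {e} ns = lem (end₁ G e ∈? U) (end₂ G e ∈? U)
      where
      lem : Dec (end₁ G e ∈ U) → Dec (end₂ G e ∈ U) → ∃[ s ] ∃[ p ] (IsEnd G s e × IsEnd G p e × s ∈ U × p ∉ U)
      lem (yes a) (yes b) = ⊥-elim (ns (trans (∈⇒lookup a) (sym (∈⇒lookup b))))
      lem (yes a) (no b) = _ , _ , inj₁ refl , inj₂ refl , a , b
      lem (no a) (yes b) = _ , _ , inj₂ refl , inj₁ refl , b , a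
      lem (no a) (no b) = ⊥-elim (ns (trans (∉⇒lookup a) (sym (∉⇒lookup b))))

    Conclusion : Set
    Conclusion = (∀ {v} → v ∈ V → v ∈ K₁.U ⊎ v ∈ K₂.U) × Z₁ ⊆ Y × ∃[ x ] (x ∈ X × end₁ K₂.G/Z x ≢ end₂ K₂.G/Z x)

    -- The X-edges leaving V(Z₂) all end in one vertex p, which therefore lies on Z₁.
    conclusion : Conclusion
    conclusion = go U₂-edge U₁-edge
      where
      go : ∃[ x ] (x ∈ X × ¬ Same G (lookup K₂.U) x) → ∃[ x ] (x ∈ X × ¬ Same G (lookup K₁.U) x) → Conclusion
      go (x , x∈X , nx) (x' , x'∈X , nx') = locate (crossing-ends nx) (crossing-ends nx')
        where
        locate : ∃[ s ] ∃[ p ] (IsEnd G s x × IsEnd G p x × s ∈ K₂.U × p ∉ K₂.U) → ∃[ s ] ∃[ p ] (IsEnd G s x' × IsEnd G p x' × s ∈ K₁.U × p ∉ K₁.U) → Conclusion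
        locate (s , p , ts , tp , s∈ , p∉) (t , _ , tt , _ , t∈ , _) = covered , Z₁⊆Y , x , x∈X , nlx
          where
          nlx : end₁ K₂.G/Z x ≢ end₂ K₂.G/Z x
          nlx = E₂.nonloop {x} tp p∉
          star : ∀ {g z} → g ∈ X → IsEnd G z g → z ∉ K₂.U → z ≡ p
          star {g} {z} g∈X tz z∉ = [ (λ { refl → ⊥-elim (z∉ K₂.r∈U) }) , id ]′
            (ends-of K₂.G/Z {K₂.r} {p} {z} {x} (subst (λ w → IsEnd K₂.G/Z w x) (K₂.π-∈ s∈) (isEnd-collapse G K₂.U K₂.r ts))
              (K₂.isEnd/Z p∉ tp) (λ { refl → p∉ K₂.r∈U }) (at (K₂.isEnd/Z z∉ tz)))
            where
            par = Quotient.one-class (swapXY (swapZ K)) k₂ g∈X x∈X (E₂.nonloop {g} tz z∉) nlx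
            at : IsEnd K₂.G/Z z g → IsEnd K₂.G/Z z x
            at (inj₁ refl) = proj₁ par
            at (inj₂ refl) = proj₂ par
          -- The end `t` of `x'` lies on `Z₁`, hence off `Z₂`, so `star` identifies it with `p`.
          p∈ : p ∈ K₁.U
          p∈ = subst (_∈ K₁.U) (star x'∈X tt (disjoint-U t∈)) t∈
          covered : ∀ {v} → v ∈ V → v ∈ K₁.U ⊎ v ∈ K₂.U
          covered {v} v∈ = decidable-stable ((v ∈? K₁.U) ⊎-dec (v ∈? K₂.U)) λ none → miss none
            (crossing (point G v) (λ q → trans (away none q) (sym (away none K₁.r∈U))) v∈ (K₁.U⊆V K₁.r∈U)
              (λ eq → contradiction (trans (sym (point-at G v)) (trans eq (away none K₁.r∈U))) λ ()))
            where
            away : ¬ (v ∈ K₁.U ⊎ v ∈ K₂.U) → ∀ {w} → w ∈ K₁.U → point G v w ≡ false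
            away none {w} q = point-off G {v} {w} (λ { refl → none (inj₁ q) })
            miss : ¬ (v ∈ K₁.U ⊎ v ∈ K₂.U) → ∃[ e ] (e ∈ X × ¬ Same G (point G v) e) → False
            miss none (e , e∈X , ns) = let _ , tv , _ = crosses-point G ns in
              none (inj₁ (subst (_∈ K₁.U) (sym (star e∈X tv (none ∘ inj₂))) p∈))
          Z₁⊆Y : Z₁ ⊆ Y
          Z₁⊆Y {e} e∈Z = [ (λ e∈X → ⊥-elim (loopless e (trans (star e∈X (inj₁ refl) (disjoint-U (proj₁ (K₁.inU e∈Z)))) (sym (star e∈X (inj₂ refl) (disjoint-U (proj₂ (K₁.inU e∈Z)))))))) , id ]′ (cover e)

-- By symmetry both conclusions hold: the two cycles cover all vertices and lie on different sides,
-- and each side has an edge that extends its cycle to a larger independent set. These sets have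
-- `∣ Z₁ ∣ + ∣ Z₂ ∣ + 2` elements together, one more than `bound` permits.
mixed-absurd : ∀ {n m} {G : Graph n m} {B L F} (K : Setting G B L F) →
  Joined (Quotient.G/Z K) (Setting.X K) (Quotient.W K) → Joined (Quotient.G/Z (swapZ K)) (Setting.Y K) (Quotient.W (swapZ K)) → False
mixed-absurd {G = G} {B} {L} {F} K j₁ k₂ = go (BothCycles.Mixed.conclusion K j₁ k₂) (BothCycles.Mixed.conclusion (swapXY (swapZ K)) k₂ j₁)
  where
  open Setting K
  module K₁ = Quotient K
  module K₂ = Quotient (swapZ K)
  go : BothCycles.Mixed.Conclusion K j₁ k₂ → BothCycles.Mixed.Conclusion (swapXY (swapZ K)) k₂ j₁ → False
  go (cov , Z₁⊆Y , x , x∈X , nlx) (_ , Z₂⊆X , y , y∈Y , nly) = <⇒≱ (begin-strict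
    suc ∣ K₁.V ∣                                  ≤⟨ s≤s (p⊆q⇒∣p∣≤∣q∣ {q = K₁.U ∪ K₂.U} (x∈p∪q⁺ ∘ cov)) ⟩
    suc ∣ K₁.U ∪ K₂.U ∣                           ≡⟨ cong suc (trans (card-∪ (λ v → BothCycles.disjoint-U K {v})) (cong₂ _+_ K₁.card-U K₂.card-U)) ⟩
    suc (∣ Z₁ ∣ + ∣ Z₂ ∣)                         <⟨ s≤s (≤-reflexive (trans (cong suc (+-comm ∣ Z₁ ∣ ∣ Z₂ ∣)) (sym (+-suc ∣ Z₂ ∣ ∣ Z₁ ∣)))) ⟩
    suc ∣ Z₂ ∣ + suc ∣ Z₁ ∣                       ≡⟨ cong₂ _+_ (card-one K₂.forest-disjoint (acyclic-edge K₂.G/Z {x} nlx)) (card-one K₁.forest-disjoint (acyclic-edge K₁.G/Z {y} nly)) ⟨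
    ∣ Z₂ ∪ ⁅ x ⁆ ∣ + ∣ Z₁ ∪ ⁅ y ⁆ ∣               ∎)
    (bound (∪-lub Z₂⊆X (⁅⁆⊆ x∈X)) (∪-lub Z₁⊆Y (⁅⁆⊆ y∈Y)) (K₂.forest-indep (acyclic-edge K₂.G/Z {x} nlx)) (K₁.forest-indep (acyclic-edge K₁.G/Z {y} nly)))
    where
    open ≤-Reasoning
    card-one : ∀ {Z e} {P : Subset _ → Set} → (∀ {T} → P T → Disjoint Z T) → P ⁅ e ⁆ → ∣ Z ∪ ⁅ e ⁆ ∣ ≡ suc ∣ Z ∣
    card-one {e = e} dis p = card-+1 (λ q → dis p e q (x∈⁅x⁆ e))

-- The quotient by `Z₂` is connected by X, by Y or by neither; each case is excluded separately.
X-joined-absurd : ∀ {n m} {G : Graph n m} {B L F} (K : Setting G B L F) → Joined (Quotient.G/Z K) (Setting.X K) (Quotient.W K) → False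
X-joined-absurd K j₁ = Quotient.NotJoined.absurd (swapZ K) both (mixed-absurd K j₁)
  where
  both : Joined (Quotient.G/Z (swapZ K)) (Setting.X K) (Quotient.W (swapZ K)) → False
  both j₂ = go (Endgame.Z-meets-Y K j₁) (Endgame.Z-meets-Y (swapZ K) j₂)
    where
    go : ∃[ y ] (y ∈ Setting.Z₁ K × y ∈ Setting.Y K) → ∃[ y ] (y ∈ Setting.Z₂ K × y ∈ Setting.Y K) → False
    go (_ , a , b) (_ , c , d) = BothCycles.BothX.absurd K j₁ j₂ a b c d

context-absurd : ∀ {n m} {G : Graph n m} {B L F} → Setting G B L F → False
context-absurd K = Quotient.NotJoined.absurd K (X-joined-absurd K) (X-joined-absurd (swapXY K))

-- From a separation of the matroid to the setting

module _ {n m : ℕ} (G : Graph n m) (B L F : Subset m → Bool) (qb : QuasiBiased G B L F) where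
  open QuasiBiased qb

  private
    M : Subset m → Set
    M = FrameCircuit G B L F

  -- A balanced loop is a circuit of size 1. A loop in L meets both `F₁` and `F₂` at its only
  -- vertex, although these are disjoint; a loop in F meets `Z₁` and `Z₂` likewise.
  no-loops : Simple M → NonDegenerate G L → NonDegenerate G F → ∀ e → end₁ G e ≢ end₂ G e
  no-loops simple (Z₁ , Z₂ , l₁ , l₂ , dZ) (F₁ , F₂ , f₁ , f₂ , dF) e lp = go (loop-cycle G {⁅ e ⁆} (x∈⁅x⁆ e) lp)
    where
    go : ∃[ R ] (R ⊆ ⁅ e ⁆ × Cycle G R) → False
    go (R , R⊆ , cy@((f , f∈) , _)) = kind (covers R cy)
      where
      card-R : ∣ R ∣ ≡ 1
      card-R = trans (cong ∣_∣ (⊆-antisym R⊆ (⁅⁆⊆ (subst (_∈ R) (⁅⁆⁻ (R⊆ f∈)) f∈)))) (∣⁅x⁆∣≡1 e)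
      at : ∀ {v} → OnV G R v → v ≡ end₁ G e
      at (g , g∈ , t) = lem (⁅⁆⁻ (R⊆ g∈)) t
        where
        lem : ∀ {v} → g ≡ e → IsEnd G v g → v ≡ end₁ G e
        lem refl (inj₁ p) = sym p
        lem refl (inj₂ p) = trans (sym p) (sym lp)
      kind : (B R ≡ true) ⊎ (L R ≡ true) ⊎ (F R ≡ true) → False
      kind (inj₁ b) = proj₁ (simple R (inj₁ (cy , b))) card-R
      kind (inj₂ (inj₁ l)) = let v , a , p = L-meets-F R F₁ l f₁
                                 w , b , q = L-meets-F R F₂ l f₂
                             in dF v p (subst (OnV G F₂) (trans (at b) (sym (at a))) q)
      kind (inj₂ (inj₂ f)) = let v , p , a = L-meets-F Z₁ R l₁ f
                                 w , q , b = L-meets-F Z₂ R l₂ f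
                             in dZ v p (subst (OnV G Z₂) (trans (at b) (sym (at a))) q)

  -- Every other edge shares a circuit with the fixed edge `z` of `Z₁`. The only circuits that are
  -- not connected subgraphs are pairs of cycles of L, and each of those cycles is tied to `Z₁`
  -- through `F₁`.
  graph-connected : Connected M → NonDegenerate G L → NonDegenerate G F → Joined G ⊤ (vertices G ⊤)
  graph-connected conn (Z₁ , _ , l₁ , _) (F₁ , _ , f₁ , _) c nc {v} {w} v∈ w∈ = trans (at v∈) (sym (at w∈))
    where
    z : Fin m
    z = proj₁ (proj₁ (L-cycle Z₁ l₁))
    side : ∀ {S v w} → ConnectedES G S → OnV G S v → OnV G S w → c v ≡ c w
    side {S} con = one-sided G {S} {c} con (λ _ → nc ∈⊤)
    con : ∀ {S} → Cycle G S → ConnectedES G S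
    con cy = proj₁ (proj₂ cy)
    b : Bool
    b = c (end₁ G z)
    onZ : OnV G Z₁ (end₁ G z)
    onZ = z , proj₂ (proj₁ (L-cycle Z₁ l₁)) , inj₁ refl
    F-side : ∀ {S v} → F S ≡ true → OnV G S v → c v ≡ b
    F-side {S} f on = let u , p , q = L-meets-F Z₁ S l₁ f in trans (side (con (F-cycle S f)) on q) (side (con (L-cycle Z₁ l₁)) p onZ)
    L-side : ∀ {S v} → L S ≡ true → OnV G S v → c v ≡ b
    L-side {S} l on = let u , p , q = L-meets-F S F₁ l f₁ in trans (side (con (L-cycle S l)) on p) (F-side f₁ q)
    C-side : ∀ {C v} → M C → z ∈ C → OnV G C v → c v ≡ b
    C-side {C} (inj₁ (cy , _)) z∈ on = side (con cy) on (z , z∈ , inj₁ refl)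
    C-side (inj₂ (inj₁ ((cn , _) , _))) z∈ on = side cn on (z , z∈ , inj₁ refl)
    C-side (inj₂ (inj₂ (inj₁ (C₁ , C₂ , (cy₁ , cy₂ , _ , refl , u , u₁ , u₂ , _) , _)))) z∈ on = trans (to-u on) (sym (to-u (z , z∈ , inj₁ refl)))
      where
      to-u : ∀ {x} → OnV G (C₁ ∪ C₂) x → c x ≡ c u
      to-u on = [ (λ p → side (con cy₁) p u₁) , (λ p → side (con cy₂) p u₂) ]′ (OnV-split G ∪⁻ on)
    C-side (inj₂ (inj₂ (inj₂ (inj₁ (C₁ , C₂ , lC₁ , lC₂ , _ , _ , _ , refl))))) z∈ on = [ L-side lC₁ , L-side lC₂ ]′ (OnV-split G ∪⁻ on)
    C-side (inj₂ (inj₂ (inj₂ (inj₂ (C₁ , C₂ , (cy₁ , cy₂ , _ , P , u , w , (_ , _ , cP , dPu , _) , u₁ , _ , _ , _ , refl) , fC₁ , fC₂))))) z∈ on =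
      [ (λ p → [ F-side fC₁ , F-side fC₂ ]′ (OnV-split G ∪⁻ p)) , (λ p → trans (side cP p (pos-OnV G {P} (subst (0 <_) (sym dPu) (s≤s z≤n)))) (F-side fC₁ u₁)) ]′ (OnV-split G ∪⁻ on)
    at : ∀ {v} → v ∈ vertices G ⊤ → c v ≡ b
    at p = go (vertices⁻ G p)
      where
      go : ∀ {v} → OnV G ⊤ v → c v ≡ b
      go (e , _ , t) = lem (e ≟ z)
        where
        lem : Dec (e ≡ z) → c _ ≡ b
        lem (yes refl) = same-ends G {c} {e} (nc ∈⊤) t (inj₁ refl)
        lem (no ne) = let C , fc , e∈ , z∈ = conn e z ne in C-side fc z∈ (e , e∈ , t)

  pair-indep : Simple M → ∀ a b → Indep M (⁅ a ⁆ ∪ ⁅ b ⁆)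
  pair-indep simple a b C fc sub = lem ∣ C ∣ refl (nonempty⇒card (circuit-nonempty G B L F qb fc)) small
    where
    small : ∣ C ∣ ≤ 2
    small = ≤-trans (p⊆q⇒∣p∣≤∣q∣ sub) (two (b ≟ a))
      where
      two : Dec (b ≡ a) → ∣ ⁅ a ⁆ ∪ ⁅ b ⁆ ∣ ≤ 2
      two (no ne) = ≤-reflexive (trans (card-+1 (ne ∘ ⁅⁆⁻)) (cong suc (∣⁅x⁆∣≡1 a)))
      two (yes refl) = ≤-trans (p⊆q⇒∣p∣≤∣q∣ {q = ⁅ a ⁆} (∪-lub id id)) (≤-trans (≤-reflexive (∣⁅x⁆∣≡1 a)) (s≤s z≤n))
    lem : ∀ k → ∣ C ∣ ≡ k → 0 < ∣ C ∣ → ∣ C ∣ ≤ 2 → False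
    lem zero eq lt _ = <-irrefl (sym eq) lt
    lem (suc zero) eq _ _ = proj₁ (simple C fc) eq
    lem (suc (suc zero)) eq _ _ = proj₂ (simple C fc) eq
    lem (suc (suc (suc k))) eq _ le = contradiction (subst (_≤ 2) eq le) λ { (s≤s (s≤s ())) }

  indep-bound : ∀ {I} → Indep M I → ∣ I ∣ ≤ ∣ vertices G ⊤ ∣
  indep-bound {I} ind = ≮⇒≥ λ lt → let C , sub , fc = edges>vertices⇒circuit G B L F qb I
                                        (≤-trans (s≤s (≤-trans (vcount-mono G I ⊤ (λ _ → ∈⊤)) (≤-reflexive (sym (card-vertices G ⊤))))) lt)
                                   in ind C fc sub

  -- In a simple matroid two elements are always independent, so a side with at least `k` elements
  -- has rank at least `k`. This is what makes the other side fall short of full rank.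
  small-indep : Simple M → ∀ k → 1 ≤ k → k < 3 → ∀ S → k ≤ ∣ S ∣ → ∃[ J ] (J ⊆ S × Indep M J × ∣ J ∣ ≡ k)
  small-indep simple k 1≤k k<3 S k≤ = go k 1≤k k<3 k≤ (card⇒nonempty (≤-trans 1≤k k≤))
    where
    go : ∀ k → 1 ≤ k → k < 3 → k ≤ ∣ S ∣ → Nonempty S → ∃[ J ] (J ⊆ S × Indep M J × ∣ J ∣ ≡ k)
    go (suc zero) _ _ _ (a , a∈) = ⁅ a ⁆ , ⁅⁆⊆ a∈ , (λ C fc sub → pair-indep simple a a C fc (∪ˡ ∘ sub)) , ∣⁅x⁆∣≡1 a
    go (suc (suc zero)) _ _ le (a , a∈) = second (card⇒nonempty (s≤s⁻¹ (≤-trans le (≤-reflexive (card-─ a∈)))))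
      where
      second : Nonempty (S ─ ⁅ a ⁆) → ∃[ J ] (J ⊆ S × Indep M J × ∣ J ∣ ≡ 2)
      second (b , b∈) = ⁅ a ⁆ ∪ ⁅ b ⁆ , ∪-lub (⁅⁆⊆ a∈) (⁅⁆⊆ (─⁻ˡ b∈)) , pair-indep simple a b ,
        trans (card-+1 (─⁻ʳ b∈)) (cong suc (∣⁅x⁆∣≡1 a))
    go (suc (suc (suc k))) _ (s≤s (s≤s (s≤s ()))) _ _

  separation⇒context : NonDegenerate G L → NonDegenerate G F → Simple M →
    Unbreakable M → ∀ k → 1 ≤ k → k < 3 → Separation M k → Setting G B L F
  separation⇒context ndL@(Z₁ , Z₂ , l₁ , l₂ , dZ) ndF@(F₁ , F₂ , f₁ , f₂ , dF) simple (conn , ub) k 1≤k k<3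
    (X , k≤X , k≤Y , rX , rY , rE , (_ , maxX) , (_ , maxY) , ((E , _ , indE , refl) , _) , lt) = record
    { qb = qb ; Z₁ = Z₁ ; Z₂ = Z₂ ; F₁ = F₁ ; F₂ = F₂ ; X = X ; Y = ∁ X
    ; l₁ = l₁ ; l₂ = l₂ ; f₁ = f₁ ; f₂ = f₂ ; dZ = dZ ; dF = dF
    ; loopless = no-loops simple ndL ndF
    ; joined = graph-connected conn ndL ndF
    ; pairs = pair-indep simple
    ; ub = ub
    ; cover = λ e → cov (e ∈? X)
    ; disj = λ e p q → x∈∁p⇒x∉p q p
    -- Since `k` is at most 2, the strict inequality below `∣ V ∣ + k` becomes a bound by
    -- `suc ∣ V ∣`.
    ; bound = λ {I} {J} I⊆ J⊆ indI indJ → s≤s⁻¹ (≤-trans (total I⊆ J⊆ indI indJ) (≤-trans (+-monoʳ-≤ ∣ V ∣ (s≤s⁻¹ k<3)) (≤-reflexive (+-comm ∣ V ∣ 2))))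
    ; boundX = λ {I} I⊆ indI → let J , J⊆ , indJ , cJ = small-indep simple k 1≤k k<3 (∁ X) k≤Y in
                 +-cancelʳ-< k ∣ I ∣ ∣ V ∣ (subst (λ z → ∣ I ∣ + z < ∣ V ∣ + k) cJ (total I⊆ J⊆ indI indJ))
    ; boundY = λ {J} J⊆ indJ → let I , I⊆ , indI , cI = small-indep simple k 1≤k k<3 X k≤X in
                 +-cancelˡ-< k ∣ J ∣ ∣ V ∣ (subst₂ _<_ (cong (_+ ∣ J ∣) cI) (+-comm ∣ V ∣ k) (total I⊆ J⊆ indI indJ))
    }
    where
    V : Subset n
    V = vertices G ⊤
    cov : ∀ {e} → Dec (e ∈ X) → e ∈ X ⊎ e ∈ ∁ X
    cov (yes p) = inj₁ p
    cov (no p) = inj₂ (x∉p⇒x∈∁p p)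
    total : ∀ {I J} → I ⊆ X → J ⊆ ∁ X → Indep M I → Indep M J → ∣ I ∣ + ∣ J ∣ < ∣ V ∣ + k
    total I⊆ J⊆ indI indJ = ≤-trans (s≤s (+-mono-≤ (maxX _ I⊆ indI) (maxY _ J⊆ indJ))) (≤-trans lt (+-monoˡ-≤ k (indep-bound indE)))

theorem1p7 : ∀ {n m : ℕ} (G : Graph n m) (B L F : Subset m → Bool) →
    QuasiBiased G B L F → NonDegenerate G L → NonDegenerate G F →
    Simple (FrameCircuit G B L F) → Connected (FrameCircuit G B L F) →
    ¬ ThreeConnected (FrameCircuit G B L F) →
    ¬ Unbreakable (FrameCircuit G B L F)
theorem1p7 G B L F qb ndL ndF simple conn ¬3c ub = ¬3c λ k 1≤k k<3 sep →
  context-absurd (separation⇒context G B L F qb ndL ndF simple ub k 1≤k k<3 sep)
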